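{- For $|q|<1$, $$\sum_{m,k\geq0}\frac{q^{2T(k)+2T(m+k)}}{(q)_m(q)_{2k+1}}(-q;q^2)_k=\frac{(q^{20},q^6,q^{14};q^{20})_\infty}{(q)_\infty}.$$
   Context: For $m$ a nonnegative integer, $(a;q)_m=\prod_{j=0}^{m-1}(1-aq^j)$ (with $(a;q)_0=1$), $(a;q)_\infty=\prod_{j\ge0}(1-aq^j)$, and $(a_1,\ldots,a_r;q)_\infty=(a_1;q)_\infty\cdots(a_r;q)_\infty$. In particular $(q)_m=(q;q)_m=\prod_{j=1}^m(1-q^j)$, $(q)_\infty=(q;q)_\infty$, and $(-q;q^2)_m=\prod_{j=0}^{m-1}(1+q^{2j+1})$. $T(j)=\frac{j(j+1)}{2}$. -}

module Defs where

open import Algebra.Apartness.Bundles using (HeytingCommutativeRing; HeytingField)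
open import Algebra.Bundles using (CommutativeRing; RawRing)
open import Data.List.Base using (List; foldr; map)
open import Data.List.Relation.Binary.Subset.Propositional using (_⊆_)
open import Data.List.Relation.Unary.Unique.Propositional using (Unique)
open import Data.Nat.Base as ℕ using (ℕ; zero; suc)
open import Data.Product.Base using (∃; _×_; _,_; proj₁; proj₂; uncurry)
open import Data.Sum.Base using (_⊎_; inj₁; inj₂; [_,_]′)
open import Data.Empty using (⊥-elim)
open import Function.Base using (_∘_)
open import Function.Bundles using (_⇔_; Equivalence)
open import Level using (Level; _⊔_) renaming (suc to lsuc)
open import Relation.Binary.Core using (Rel)
open import Relation.Binary.Structures using (IsStrictPartialOrder)
open import Relation.Nullary.Negation.Core using (¬_)

import Algebra.Definitions.RawMonoid as RawMonoidDefinitions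
import Algebra.Definitions.RawSemiring as RawSemiringDefinitions
import Algebra.Apartness.Properties.HeytingCommutativeRing as HeytingProperties
import Algebra.Properties.Ring as RingProperties
import Algebra.Solver.Ring.NaturalCoefficients.Default as SemiringSolver
import Relation.Binary.Reasoning.Setoid as SetoidReasoning

-- The library has no real numbers, so ℝ is axiomatised as a Cauchy complete
-- Archimedean ordered field.  The axioms are the constructive ones (Heyting
-- field, apartness x # y meaning x < y or y < x), so that they hold for the
-- Cauchy reals of Bishop as well as for the classical reals; classically they
-- determine ℝ up to isomorphism.

record RealNumbers c ℓ₁ ℓ₂ ℓ₃ : Set (lsuc (c ⊔ ℓ₁ ⊔ ℓ₂ ⊔ ℓ₃)) where
  infix 4 _<_
  field
    heytingField : HeytingField c ℓ₁ ℓ₂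

  open HeytingField heytingField public
  open HeytingCommutativeRing heytingCommutativeRing public using (commutativeRing)
  open RawMonoidDefinitions (CommutativeRing.+-rawMonoid commutativeRing) public using () renaming (_×_ to _·_)

  field
    _<_                  : Rel Carrier ℓ₃
    isStrictPartialOrder : IsStrictPartialOrder _≈_ _<_
    #⇔<⊎>                : ∀ {x y} → x # y ⇔ (x < y ⊎ y < x)
    +-monoˡ-<            : ∀ {x y} z → x < y → x + z < y + z
    *-pos                : ∀ {x y} → 0# < x → 0# < y → 0# < x * y
    archimedean          : ∀ x → ∃ λ n → x < n · 1#

  Cauchy : (ℕ → Carrier) → Set (c ⊔ ℓ₃)
  Cauchy f = ∀ ε → 0# < ε → ∃ λ N → ∀ m n → N ℕ.≤ m → N ℕ.≤ n → f m - f n < ε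

  ConvergesTo : (ℕ → Carrier) → Carrier → Set (c ⊔ ℓ₃)
  ConvergesTo f x =
    ∀ ε → 0# < ε → ∃ λ N → ∀ n → N ℕ.≤ n → (f n - x < ε) × (x - f n < ε)

  field
    complete : ∀ f → Cauchy f → ∃ λ x → ConvergesTo f x

module RealProperties {c ℓ₁ ℓ₂ ℓ₃ : Level} (R : RealNumbers c ℓ₁ ℓ₂ ℓ₃) where
  open RealNumbers R
  open IsStrictPartialOrder isStrictPartialOrder public
    using (<-respˡ-≈; <-respʳ-≈) renaming (irrefl to <-irrefl; trans to <-trans)
  open HeytingProperties heytingCommutativeRing public using (1#0; x#0y#0→xy#0)
  open HeytingProperties heytingCommutativeRing using (invertibleʳ⇒#; x-0≈x; #-congʳ)
  open RingProperties (CommutativeRing.ring commutativeRing)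
    using (-‿distribˡ-*; -‿distribʳ-*; -‿involutive; ⁻¹-anti-homo‿-)
  open SemiringSolver (CommutativeRing.commutativeSemiring commutativeRing)
    using (solve; _:=_; _:+_; _:*_)
  open SetoidReasoning setoid

  #⇒<⊎> : ∀ {x y} → x # y → x < y ⊎ y < x
  #⇒<⊎> = Equivalence.to #⇔<⊎>

  <⇒# : ∀ {x y} → x < y → x # y
  <⇒# = Equivalence.from #⇔<⊎> ∘ inj₁

  >⇒# : ∀ {x y} → y < x → x # y
  >⇒# = Equivalence.from #⇔<⊎> ∘ inj₂

  <-cotrans : ∀ {x y} → x < y → ∀ z → x < z ⊎ z < y
  <-cotrans x<y z with #-cotrans (<⇒# x<y) z
  ... | inj₁ x#z = [ inj₁ , (λ z<x → inj₂ (<-trans z<x x<y)) ]′ (#⇒<⊎> x#z)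
  ... | inj₂ z#y = [ inj₂ , (λ y<z → inj₁ (<-trans x<y y<z)) ]′ (#⇒<⊎> z#y)

  x<y⇒0<y-x : ∀ {x y} → x < y → 0# < y - x
  x<y⇒0<y-x {x} x<y = <-respˡ-≈ (-‿inverseʳ x) (+-monoˡ-< (- x) x<y)

  0<y-x⇒x<y : ∀ {x y} → 0# < y - x → x < y
  0<y-x⇒x<y {x} {y} 0<y-x = <-respʳ-≈ eq (<-respˡ-≈ (+-identityˡ x) (+-monoˡ-< x 0<y-x))
    where
    eq : (y - x) + x ≈ y
    eq = trans (+-assoc y (- x) x) (trans (+-congˡ (-‿inverseˡ x)) (+-identityʳ y))

  x<0⇒0<-x : ∀ {x} → x < 0# → 0# < - x
  x<0⇒0<-x x<0 = <-respʳ-≈ (+-identityˡ _) (x<y⇒0<y-x x<0)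

  -x*-y≈x*y : ∀ x y → - x * - y ≈ x * y
  -x*-y≈x*y x y = trans (sym (-‿distribˡ-* x (- y)))
    (trans (-‿cong (sym (-‿distribʳ-* x y))) (-‿involutive (x * y)))

  x#0⇒0<x² : ∀ {x} → x # 0# → 0# < x * x
  x#0⇒0<x² {x} x#0 with #⇒<⊎> x#0
  ... | inj₂ 0<x = *-pos 0<x 0<x
  ... | inj₁ x<0 = <-respʳ-≈ (-x*-y≈x*y x x) (*-pos (x<0⇒0<-x x<0) (x<0⇒0<-x x<0))

  0<1 : 0# < 1#
  0<1 = <-respʳ-≈ (*-identityˡ 1#) (x#0⇒0<x² 1#0)

  xy#0⇒x#0 : ∀ {x y} → x * y # 0# → x # 0#
  xy#0⇒x#0 {x} {y} xy#0 with #⇒invertible xy#0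
  ... | w , _ , inv = invertibleʳ⇒# (y * w , (begin
    (x - 0#) * (y * w)  ≈⟨ *-congʳ (x-0≈x x) ⟩
    x * (y * w)         ≈⟨ *-assoc x y w ⟨
    x * y * w           ≈⟨ *-congʳ (x-0≈x (x * y)) ⟨
    (x * y - 0#) * w    ≈⟨ inv ⟩
    1#                  ∎))

  x²≮0 : ∀ x → ¬ (x * x < 0#)
  x²≮0 x x²<0 = <-irrefl refl (<-trans (x#0⇒0<x² (xy#0⇒x#0 (<⇒# x²<0))) x²<0)

  0<x+y : ∀ {x y} → 0# < x → ¬ (y < 0#) → 0# < x + y
  0<x+y {x} {y} 0<x y≮0 with <-cotrans 0<x (x + y)
  ... | inj₁ 0<x+y = 0<x+y
  ... | inj₂ x+y<x = ⊥-elim (y≮0 (<-respʳ-≈ (-‿inverseʳ x)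
    (<-respˡ-≈ eq (+-monoˡ-< (- x) x+y<x))))
    where
    eq : x + y - x ≈ y
    eq = trans (+-congʳ (+-comm x y))
      (trans (+-assoc y x (- x)) (trans (+-congˡ (-‿inverseʳ x)) (+-identityʳ y)))

  x²+y²≮0 : ∀ x y → ¬ (x * x + y * y < 0#)
  x²+y²≮0 x y lt with <-cotrans lt (x * x)
  ... | inj₂ x²<0 = x²≮0 x x²<0
  ... | inj₁ x²+y²<x² = x²≮0 y (0<y-x⇒x<y (<-respʳ-≈ eq (x<y⇒0<y-x x²+y²<x²)))
    where
    eq : x * x - (x * x + y * y) ≈ 0# - y * y
    eq = begin
      x * x - (x * x + y * y)                ≈⟨ +-identityʳ _ ⟨
      x * x - (x * x + y * y) + 0#           ≈⟨ +-congˡ (-‿inverseʳ (y * y)) ⟨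
      x * x - (x * x + y * y) + (y * y - y * y)
        ≈⟨ solve 4 (λ a b n m → a :+ n :+ (b :+ m) := (a :+ b) :+ n :+ m) refl
             (x * x) (y * y) (- (x * x + y * y)) (- (y * y)) ⟩
      (x * x + y * y) - (x * x + y * y) - y * y  ≈⟨ +-congʳ (-‿inverseʳ _) ⟩
      0# - y * y                             ∎

  xy<1 : ∀ {x y} → x < 1# → y < 1# → ¬ (y < 0#) → x * y < 1#
  xy<1 {x} {y} x<1 y<1 y≮0 with <-cotrans y<1 (x * y)
  ... | inj₂ xy<1 = xy<1
  ... | inj₁ y<xy = ⊥-elim ([ y≮0 , 0≮y ]′ (#⇒<⊎> (xy#0⇒x#0 (<⇒# y[1-x]<0))))
    where
    y[1-x]<0 : y * (1# - x) < 0#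
    y[1-x]<0 = 0<y-x⇒x<y (<-respʳ-≈ (begin
      x * y - y               ≈⟨ ⁻¹-anti-homo‿- y (x * y) ⟨
      - (y - x * y)           ≈⟨ +-identityˡ _ ⟨
      0# - (y - x * y)        ≈⟨ +-congˡ (-‿cong (+-cong (sym (*-identityʳ y))
                                   (trans (-‿cong (*-comm x y)) (-‿distribʳ-* y x)))) ⟩
      0# - (y * 1# + y * - x) ≈⟨ +-congˡ (-‿cong (distribˡ y 1# (- x))) ⟨
      0# - y * (1# - x)       ∎) (x<y⇒0<y-x y<xy))
    0≮y : ¬ (0# < y)
    0≮y 0<y = <-irrefl refl (<-trans (*-pos 0<y (x<y⇒0<y-x x<1)) y[1-x]<0)

  x²<1⇒1-x#0 : ∀ {x} → x * x < 1# → 1# - x # 0#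
  x²<1⇒1-x#0 {x} x²<1 = xy#0⇒x#0 {y = 1# + x} (>⇒# (<-respʳ-≈ eq (x<y⇒0<y-x x²<1)))
    where
    eq : 1# - x * x ≈ (1# - x) * (1# + x)
    eq = begin
      1# - x * x                       ≈⟨ +-cong (sym (*-identityˡ 1#)) (-‿distribˡ-* x x) ⟩
      1# * 1# + - x * x                ≈⟨ +-identityʳ _ ⟨
      1# * 1# + - x * x + 0#           ≈⟨ +-congˡ (trans (*-congˡ (-‿inverseʳ x)) (zeroʳ 1#)) ⟨
      1# * 1# + - x * x + 1# * (x - x)
        ≈⟨ solve 3 (λ o x n → o :* o :+ n :* x :+ o :* (x :+ n) := (o :+ n) :* (o :+ x)) refl
             1# x (- x) ⟩
      (1# - x) * (1# + x)              ∎

  x²+y²<1⇒x²<1 : ∀ {x y} → x * x + y * y < 1# → x * x < 1#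
  x²+y²<1⇒x²<1 {x} {y} lt = 0<y-x⇒x<y (<-respʳ-≈ eq (0<x+y (x<y⇒0<y-x lt) (x²≮0 y)))
    where
    eq : 1# - (x * x + y * y) + y * y ≈ 1# - x * x
    eq = begin
      1# - (x * x + y * y) + y * y                    ≈⟨ +-identityʳ _ ⟨
      1# - (x * x + y * y) + y * y + 0#               ≈⟨ +-congˡ (-‿inverseʳ (x * x)) ⟨
      1# - (x * x + y * y) + y * y + (x * x - x * x)
        ≈⟨ solve 5 (λ o a b n m → o :+ n :+ b :+ (a :+ m) := o :+ m :+ (a :+ b :+ n)) refl
             1# (x * x) (y * y) (- (x * x + y * y)) (- (x * x)) ⟩
      1# - x * x + (x * x + y * y - (x * x + y * y))  ≈⟨ +-congˡ (-‿inverseʳ _) ⟩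
      1# - x * x + 0#                                 ≈⟨ +-identityʳ _ ⟩
      1# - x * x                                      ∎

  brahmagupta : ∀ a b x y → (a * x - b * y) * (a * x - b * y) + (a * y + b * x) * (a * y + b * x)
                          ≈ (a * a + b * b) * (x * x + y * y)
  brahmagupta a b x y = begin
    (a * x - b * y) * (a * x - b * y) + (a * y + b * x) * (a * y + b * x)
      ≈⟨ +-congʳ (*-cong (+-congˡ (-‿distribˡ-* b y)) (+-congˡ (-‿distribˡ-* b y))) ⟩
    (a * x + - b * y) * (a * x + - b * y) + (a * y + b * x) * (a * y + b * x)
      ≈⟨ solve 5 (λ a b x y n →
           (a :* x :+ n :* y) :* (a :* x :+ n :* y) :+ (a :* y :+ b :* x) :* (a :* y :+ b :* x)
           := a :* a :* (x :* x :+ y :* y) :+ b :* b :* (x :* x) :+ n :* n :* (y :* y)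
              :+ (a :* x :* y :+ a :* x :* y) :* (b :+ n)) refl a b x y (- b) ⟩
    a * a * (x * x + y * y) + b * b * (x * x) + - b * - b * (y * y)
      + (a * x * y + a * x * y) * (b - b)
      ≈⟨ +-cong (+-congˡ (*-congʳ (-x*-y≈x*y b b)))
           (trans (*-congˡ (-‿inverseʳ b)) (zeroʳ _)) ⟩
    a * a * (x * x + y * y) + b * b * (x * x) + b * b * (y * y) + 0#
      ≈⟨ +-identityʳ _ ⟩
    a * a * (x * x + y * y) + b * b * (x * x) + b * b * (y * y)
      ≈⟨ solve 4 (λ a b x y →
           a :* a :* (x :* x :+ y :* y) :+ b :* b :* (x :* x) :+ b :* b :* (y :* y)
           := (a :* a :+ b :* b) :* (x :* x :+ y :* y)) refl a b x y ⟩
    (a * a + b * b) * (x * x + y * y) ∎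

module Complex {c ℓ₁ ℓ₂ ℓ₃ : Level} (R : RealNumbers c ℓ₁ ℓ₂ ℓ₃) where

  private
    module ℝ = RealNumbers R
    module ℝₚ = RealProperties R

  infix 5 _+i_
  record ℂ : Set c where
    constructor _+i_
    field
      re im : ℝ.Carrier
  open ℂ public

  infix  8 -_
  infixl 7 _*_
  infixl 6 _+_ _-_
  infix  4 _≈_ _≉0 ∣_∣<_

  _≈_ : Rel ℂ ℓ₁
  z ≈ w = (re z ℝ.≈ re w) × (im z ℝ.≈ im w)

  0ℂ 1ℂ : ℂ
  0ℂ = ℝ.0# +i ℝ.0#
  1ℂ = ℝ.1# +i ℝ.0#

  _+_ _*_ : ℂ → ℂ → ℂ
  z + w = (re z ℝ.+ re w) +i (im z ℝ.+ im w)
  z * w = (re z ℝ.* re w ℝ.- im z ℝ.* im w) +i (re z ℝ.* im w ℝ.+ im z ℝ.* re w)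

  -_ : ℂ → ℂ
  - z = (ℝ.- re z) +i (ℝ.- im z)

  _-_ : ℂ → ℂ → ℂ
  z - w = z + (- w)

  rawRing : RawRing c ℓ₁
  rawRing = record
    { Carrier = ℂ ; _≈_ = _≈_ ; _+_ = _+_ ; _*_ = _*_ ; -_ = -_ ; 0# = 0ℂ ; 1# = 1ℂ }

  open RawSemiringDefinitions (RawRing.rawSemiring rawRing) public using (_^_)

  ∣_∣² : ℂ → ℝ.Carrier
  ∣ z ∣² = re z ℝ.* re z ℝ.+ im z ℝ.* im z

  -- |z| < r, written without the square root in |z|.
  ∣_∣<_ : ℂ → ℝ.Carrier → Set ℓ₃
  ∣ z ∣< r = (ℝ.0# ℝ.< r) × (∣ z ∣² ℝ.< r ℝ.* r)

  -- Constructively positive form of z ≠ 0, i.e. |z|² is apart from 0.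
  _≉0 : ℂ → Set ℓ₂
  z ≉0 = ∣ z ∣² ℝ.# ℝ.0#

  -- conj w / |w|²; the library states invertibility for |w|² - 0.
  inv : ∀ w → w ≉0 → ℂ
  inv w w≉0 = (re w ℝ.* n) +i ((ℝ.- im w) ℝ.* n)
    where
    n : ℝ.Carrier
    n = proj₁ (ℝ.#⇒invertible w≉0)

  infixl 7 _/_[_]
  _/_[_] : ℂ → ∀ w → w ≉0 → ℂ
  z / w [ w≉0 ] = z * inv w w≉0

  Limit : (ℕ → ℂ) → ℂ → Set (c ⊔ ℓ₃)
  Limit f L = ∀ ε → ℝ.0# ℝ.< ε → ∃ λ N → ∀ n → N ℕ.≤ n → ∣ f n - L ∣< ε

  ∑ : {I : Set} → List I → (I → ℂ) → ℂ
  ∑ F t = foldr _+_ 0ℂ (map t F)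

  -- Unconditional (for ℂ, equivalently absolute) convergence: the limit of the
  -- sums over finite subsets of I, directed by inclusion.  A finite subset is a
  -- list without repetitions.
  HasSum : {I : Set} → (I → ℂ) → ℂ → Set (c ⊔ ℓ₃)
  HasSum t S = ∀ ε → ℝ.0# ℝ.< ε →
    ∃ λ F₀ → ∀ F → Unique F → F₀ ⊆ F → ∣ ∑ F t - S ∣< ε

  -- (a;q)_m

  infix 9 ⟨_⨾_⟩_
  ⟨_⨾_⟩_ : ℂ → ℂ → ℕ → ℂ
  ⟨ a ⨾ q ⟩ zero  = 1ℂ
  ⟨ a ⨾ q ⟩ suc m = ⟨ a ⨾ q ⟩ m * (1ℂ - a * q ^ m)

  -- P is the value of the infinite product (a;q)_∞.
  infix 4 ⟨_⨾_⟩∞↦_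
  ⟨_⨾_⟩∞↦_ : ℂ → ℂ → ℂ → Set (c ⊔ ℓ₃)
  ⟨ a ⨾ q ⟩∞↦ P = Limit (λ m → ⟨ a ⨾ q ⟩ m) P

  private
    ∣1∣²≈1 : ∣ 1ℂ ∣² ℝ.≈ ℝ.1#
    ∣1∣²≈1 = ℝ.trans (ℝ.+-cong (ℝ.*-identityˡ ℝ.1#) (ℝ.zeroˡ ℝ.0#)) (ℝ.+-identityʳ ℝ.1#)

  ≉0-1 : 1ℂ ≉0
  ≉0-1 = ℝₚ.>⇒# (ℝₚ.<-respʳ-≈ (ℝ.sym ∣1∣²≈1) ℝₚ.0<1)

  ≉0-* : ∀ {z w} → z ≉0 → w ≉0 → z * w ≉0
  ≉0-* {z} {w} z≉0 w≉0 =
    HeytingProperties.#-congʳ ℝ.heytingCommutativeRing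
      (ℝ.sym (ℝₚ.brahmagupta (re z) (im z) (re w) (im w))) (ℝₚ.x#0y#0→xy#0 z≉0 w≉0)

  ∣q^1+j∣²<1 : ∀ {q} → ∣ q ∣< ℝ.1# → ∀ j → ∣ q ^ suc j ∣² ℝ.< ℝ.1#
  ∣q^1+j∣²<1 {q} (_ , ∣q∣²<1²) = go
    where
    ∣q∣²<1 : ∣ q ∣² ℝ.< ℝ.1#
    ∣q∣²<1 = ℝₚ.<-respʳ-≈ (ℝ.*-identityˡ ℝ.1#) ∣q∣²<1²
    go : ∀ j → ∣ q ^ suc j ∣² ℝ.< ℝ.1#
    go zero = ℝₚ.<-respˡ-≈ (ℝ.sym (ℝ.trans (ℝₚ.brahmagupta (re q) (im q) ℝ.1# ℝ.0#)
      (ℝ.trans (ℝ.*-congˡ ∣1∣²≈1) (ℝ.*-identityʳ _)))) ∣q∣²<1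
    go (suc j) = ℝₚ.<-respˡ-≈
      (ℝ.sym (ℝₚ.brahmagupta (re q) (im q) (re (q ^ suc j)) (im (q ^ suc j))))
      (ℝₚ.xy<1 ∣q∣²<1 (go j) (ℝₚ.x²+y²≮0 _ _))

  ∣z∣²<1⇒1-z≉0 : ∀ {z} → ∣ z ∣² ℝ.< ℝ.1# → 1ℂ - z ≉0
  ∣z∣²<1⇒1-z≉0 {z} lt = ℝₚ.>⇒# (ℝₚ.0<x+y
    (ℝₚ.x#0⇒0<x² (ℝₚ.x²<1⇒1-x#0 (ℝₚ.x²+y²<1⇒x²<1 lt))) (ℝₚ.x²≮0 _))

  ⟨q⨾q⟩≉0 : ∀ {q} → ∣ q ∣< ℝ.1# → ∀ m → ⟨ q ⨾ q ⟩ m ≉0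
  ⟨q⨾q⟩≉0 ∣q∣<1 zero    = ≉0-1
  ⟨q⨾q⟩≉0 ∣q∣<1 (suc m) =
    ≉0-* (⟨q⨾q⟩≉0 ∣q∣<1 m) (∣z∣²<1⇒1-z≉0 (∣q^1+j∣²<1 ∣q∣<1 m))

  T : ℕ → ℕ
  T j = (j ℕ.* (j ℕ.+ 1)) ℕ./ 2

  summand : ∀ q → ∣ q ∣< ℝ.1# → ℕ × ℕ → ℂ
  summand q ∣q∣<1 (m , k) =
    q ^ (2 ℕ.* T k ℕ.+ 2 ℕ.* T (m ℕ.+ k))
      / ⟨ q ⨾ q ⟩ m * ⟨ q ⨾ q ⟩ (2 ℕ.* k ℕ.+ 1)
        [ ≉0-* (⟨q⨾q⟩≉0 ∣q∣<1 m) (⟨q⨾q⟩≉0 ∣q∣<1 (2 ℕ.* k ℕ.+ 1)) ]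
    * ⟨ - q ⨾ q ^ 2 ⟩ k

{-# OPTIONS --safe #-}

-- With β_k = (-q;q²)_k / (q)_{2k+1} and n = m + k, the double sum is
-- ∑_n q^{n(n+1)} ∑_k q^{k(k+1)} β_k / (q)_{n-k}, two steps of the Bailey chain relative to a = q.
-- Taking the part even in X of the finite Jacobi triple product for ∏ (1 + Xq^l)(1 - Xq^l), X² = -q,
-- gives β_k = ∑_r α_r / ((q)_{k-r} (q)_{k+r+1}) with α_{2j} = α_{2j-1} = (-1)^j q^{2j²}, whence
--   ∑_{n≤N} (1/(q)_{N-n}) q^{n(n+1)} ∑_{k≤n} q^{k(k+1)} β_k / (q)_{n-k}
--     = ∑_{r≤N} α_r q^{2r(r+1)} / ((q)_{N-r} (q)_{N+r+1}).
-- The numerators on the right are the terms (-1)^j q^{10j²+4j}, j ∈ ℤ, whose sum is the product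
-- (q²⁰,q⁶,q¹⁴;q²⁰)_∞ by the finite triple product in base q²⁰.  All convergence is geometric, with a
-- ratio ρ such that |q| ≤ ρ < 1, so N → ∞ only requires keeping track of bounds Kρᴺ.

module Submission where

open import Defs
open import Algebra.Bundles using (CommutativeRing; RawRing)
open import Algebra.Solver.Ring.AlmostCommutativeRing using (fromCommutativeRing; _-Raw-AlmostCommutative⟶_)
open import Algebra.Structures using (IsCommutativeRing)
open import Data.Empty using (⊥-elim)
open import Data.Integer.Base as ℤ using (ℤ; +_; -[1+_]; _◃_)
open import Data.List.Base using (List; []; _∷_; _++_; foldr; map)
open import Data.List.Membership.Propositional using (_∈_; _∉_)
open import Data.List.Membership.Propositional.Properties using (∈-∃++; ∈-++⁻; ∈-++⁺ˡ; ∈-++⁺ʳ; ∈-map⁺; ∈-map⁻)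
open import Data.List.Relation.Binary.Permutation.Propositional as ↭ using (_↭_; ↭⇒↭ₛ)
open import Data.List.Relation.Binary.Subset.Propositional using (_⊆_)
open import Data.List.Relation.Unary.All as All using ([]; _∷_)
open import Data.List.Relation.Unary.AllPairs using ([]; _∷_)
open import Data.List.Relation.Unary.Any using (here; there)
open import Data.List.Relation.Unary.Unique.Propositional using (Unique)
open import Data.Maybe.Base using (Maybe; just; nothing)
open import Data.Nat.Base as ℕ using (ℕ; zero; suc)
open import Data.Nat.Tactic.RingSolver using (solve-∀)
open import Data.Product.Base using (∃; Σ; _×_; _,_; proj₁; proj₂; map₁)
open import Data.Sign.Base as Sign using (Sign)
open import Data.Sum.Base using (inj₁; inj₂; [_,_]′)
open import Function.Base using (id)
open import Level using (Level; _⊔_) renaming (suc to lsuc)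
open import Relation.Binary.PropositionalEquality as ≡ using (_≡_)
open import Relation.Nullary.Decidable.Core using (yes; no)
open import Relation.Nullary.Negation.Core using (¬_)

import Algebra.Properties.Ring
import Algebra.Properties.Semiring.Exp
import Algebra.Properties.Semiring.Mult.TCOptimised
import Algebra.Solver.Ring
import Data.Integer.Properties as ℤ
import Data.List.Relation.Binary.Permutation.Propositional.Properties as ↭ₚ
import Data.List.Relation.Binary.Permutation.Setoid.Properties as ↭ₛ
import Data.List.Relation.Unary.Unique.Propositional.Properties as Unique
import Data.Nat.DivMod as ℕ
import Data.Nat.Properties as ℕ
import Relation.Binary.Reasoning.Setoid

-- No square root X of -q is ever adjoined. The theta coefficients are split into a part `U` free of
-- X and a coefficient `V` of X, and the recursions of the triple product run on both at once: only
-- the first part is wanted, but each step mixes it with the other, whose convolutions are known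
-- from parity in X. A truncation at odd N would contain the term of index -j without its partner j,
-- so the limits are taken along N = 2n. For fixed r the weights 1/((q)_{N-r} (q)_{N+r+1}) tend to
-- 1/(q)_∞². A quantitative form of Tannery's theorem exchanges limit and sum; it is needed for the
-- theta series, for the sum over α, and to strip the outer 1/(q)_{N-n}. Only upper bounds on the
-- reciprocals 1/(q)_m enter, and (q)_∞ ≠ 0 then follows by passing to the limit in (q)_m · 1/(q)_m
-- = 1. A term of the double series is at most Mρ^{2(m+k)}: one half of the exponent pays for the
-- rate of convergence, the other for summability over arbitrary finite sets.

-- A ring solver with integer coefficients

module IntegerSolver {c ℓ} (R : CommutativeRing c ℓ) where
  open CommutativeRing R
  open Algebra.Properties.Ring ring
  open Algebra.Properties.Semiring.Mult.TCOptimised semiring using (×-homo-+; ×1-homo-*) renaming (_×_ to _·ₙ_)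
  open Relation.Binary.Reasoning.Setoid setoid

  private
    ⟦_⟧ℤ : ℤ → Carrier
    ⟦ + n ⟧ℤ      = n ·ₙ 1#
    ⟦ -[1+ n ] ⟧ℤ = - (suc n ·ₙ 1#)

    ⟦_⟧± : Sign → Carrier → Carrier
    ⟦ Sign.+ ⟧± x = x
    ⟦ Sign.- ⟧± x = - x

    [1+x]-[1+y]≈x-y : ∀ x y → (1# + x) - (1# + y) ≈ x - y
    [1+x]-[1+y]≈x-y x y = begin
      (1# + x) - (1# + y)      ≈⟨ +-cong (+-comm 1# x) (sym (-‿+-comm 1# y)) ⟩
      (x + 1#) + (- 1# - y)    ≈⟨ +-assoc x 1# _ ⟩
      x + (1# + (- 1# - y))    ≈⟨ +-congˡ (+-assoc 1# (- 1#) (- y)) ⟨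
      x + ((1# - 1#) - y)      ≈⟨ +-congˡ (+-congʳ (-‿inverseʳ 1#)) ⟩
      x + (0# - y)             ≈⟨ +-congˡ (+-identityˡ (- y)) ⟩
      x - y                    ∎

    ⊖-homo : ∀ m n → ⟦ m ℤ.⊖ n ⟧ℤ ≈ m ·ₙ 1# - n ·ₙ 1#
    ⊖-homo m zero = begin
      m ·ₙ 1#             ≈⟨ +-identityʳ _ ⟨
      m ·ₙ 1# + 0#        ≈⟨ +-congˡ -0#≈0# ⟨
      m ·ₙ 1# - 0#        ∎
    ⊖-homo zero (suc n) = sym (+-identityˡ _)
    ⊖-homo (suc m) (suc n) = begin
      ⟦ suc m ℤ.⊖ suc n ⟧ℤ            ≡⟨ ≡.cong ⟦_⟧ℤ (ℤ.[1+m]⊖[1+n]≡m⊖n m n) ⟩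
      ⟦ m ℤ.⊖ n ⟧ℤ                    ≈⟨ ⊖-homo m n ⟩
      m ·ₙ 1# - n ·ₙ 1#                 ≈⟨ [1+x]-[1+y]≈x-y _ _ ⟨
      (1# + m ·ₙ 1#) - (1# + n ·ₙ 1#)
        ≈⟨ +-cong (×-homo-+ 1# 1 m) (-‿cong (×-homo-+ 1# 1 n)) ⟨
      suc m ·ₙ 1# - suc n ·ₙ 1#         ∎

    +-homo : ∀ i j → ⟦ i ℤ.+ j ⟧ℤ ≈ ⟦ i ⟧ℤ + ⟦ j ⟧ℤ
    +-homo (+ m)    (+ n)    = ×-homo-+ 1# m n
    +-homo (+ m)    -[1+ n ] = ⊖-homo m (suc n)
    +-homo -[1+ m ] (+ n)    = trans (⊖-homo n (suc m)) (+-comm _ _)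
    +-homo -[1+ m ] -[1+ n ] = begin
      - (suc (suc (m ℕ.+ n)) ·ₙ 1#)        ≡⟨ ≡.cong (λ k → - (suc k ·ₙ 1#)) (≡.sym (ℕ.+-suc m n)) ⟩
      - ((suc m ℕ.+ suc n) ·ₙ 1#)          ≈⟨ -‿cong (×-homo-+ 1# (suc m) (suc n)) ⟩
      - (suc m ·ₙ 1# + suc n ·ₙ 1#)         ≈⟨ -‿+-comm _ _ ⟨
      - (suc m ·ₙ 1#) - suc n ·ₙ 1#         ∎

    ◃-homo : ∀ s n → ⟦ s ◃ n ⟧ℤ ≈ ⟦ s ⟧± (n ·ₙ 1#)
    ◃-homo Sign.+ zero    = refl
    ◃-homo Sign.- zero    = sym -0#≈0#
    ◃-homo Sign.+ (suc n) = refl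
    ◃-homo Sign.- (suc n) = refl

    *-homo : ∀ i j → ⟦ i ℤ.* j ⟧ℤ ≈ ⟦ i ⟧ℤ * ⟦ j ⟧ℤ
    *-homo (+ m) (+ n) = trans (◃-homo Sign.+ (m ℕ.* n)) (×1-homo-* m n)
    *-homo (+ m) -[1+ n ] = begin
      ⟦ Sign.- ◃ (m ℕ.* suc n) ⟧ℤ  ≈⟨ ◃-homo Sign.- (m ℕ.* suc n) ⟩
      - ((m ℕ.* suc n) ·ₙ 1#)       ≈⟨ -‿cong (×1-homo-* m (suc n)) ⟩
      - (m ·ₙ 1# * suc n ·ₙ 1#)      ≈⟨ -‿distribʳ-* _ _ ⟩
      m ·ₙ 1# * - (suc n ·ₙ 1#)      ∎
    *-homo -[1+ m ] (+ n) = begin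
      ⟦ Sign.- ◃ (suc m ℕ.* n) ⟧ℤ  ≈⟨ ◃-homo Sign.- (suc m ℕ.* n) ⟩
      - ((suc m ℕ.* n) ·ₙ 1#)       ≈⟨ -‿cong (×1-homo-* (suc m) n) ⟩
      - (suc m ·ₙ 1# * n ·ₙ 1#)      ≈⟨ -‿distribˡ-* _ _ ⟩
      - (suc m ·ₙ 1#) * n ·ₙ 1#      ∎
    *-homo -[1+ m ] -[1+ n ] = begin
      (suc m ℕ.* suc n) ·ₙ 1#            ≈⟨ ×1-homo-* (suc m) (suc n) ⟩
      suc m ·ₙ 1# * suc n ·ₙ 1#           ≈⟨ -‿involutive _ ⟨
      - - (suc m ·ₙ 1# * suc n ·ₙ 1#)     ≈⟨ -‿cong (-‿distribʳ-* _ _) ⟩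
      - (suc m ·ₙ 1# * - (suc n ·ₙ 1#))   ≈⟨ -‿distribˡ-* _ _ ⟩
      - (suc m ·ₙ 1#) * - (suc n ·ₙ 1#)   ∎

    -‿homo : ∀ i → ⟦ ℤ.- i ⟧ℤ ≈ - ⟦ i ⟧ℤ
    -‿homo (+ zero)  = sym -0#≈0#
    -‿homo (+ suc n) = refl
    -‿homo -[1+ n ]  = sym (-‿involutive _)

    ℤ-rawRing : RawRing _ _
    ℤ-rawRing = record
      { Carrier = ℤ ; _≈_ = _≡_ ; _+_ = ℤ._+_ ; _*_ = ℤ._*_ ; -_ = ℤ.-_
      ; 0# = + 0 ; 1# = + 1 }

    homomorphism : ℤ-rawRing -Raw-AlmostCommutative⟶ fromCommutativeRing R
    homomorphism = record
      { ⟦_⟧ = ⟦_⟧ℤ ; +-homo = +-homo ; *-homo = *-homo ; -‿homo = -‿homo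
      ; 0-homo = refl ; 1-homo = refl }

    coefficient≟ : ∀ i j → Maybe (⟦ i ⟧ℤ ≈ ⟦ j ⟧ℤ)
    coefficient≟ i j with i ℤ.≟ j
    ... | yes ≡.refl = just refl
    ... | no _       = nothing

  open Algebra.Solver.Ring ℤ-rawRing (fromCommutativeRing R) homomorphism coefficient≟ public
    using (solve; con; _:=_; _:+_; _:*_; _:-_; :-_; _:^_)

-- Sums over antidiagonals

twice : ℕ → ℕ
twice zero    = zero
twice (suc n) = suc (suc (twice n))

module AntidiagonalSums {c ℓ} (R : CommutativeRing c ℓ) where
  open CommutativeRing R
  open IntegerSolver R
  open Relation.Binary.Reasoning.Setoid setoid

  -- Carrying both indices avoids truncated subtraction. A summand that ignores its second index
  -- gives an ordinary partial sum.
  anti : ℕ → (ℕ → ℕ → Carrier) → Carrier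
  anti zero    F = F 0 0
  anti (suc n) F = F 0 (suc n) + anti n (λ i j → F (suc i) j)

  anti-cong-≡ : ∀ n {F G : ℕ → ℕ → Carrier} →
                (∀ i j → i ℕ.+ j ≡ n → F i j ≈ G i j) → anti n F ≈ anti n G
  anti-cong-≡ zero    F≈G = F≈G 0 0 ≡.refl
  anti-cong-≡ (suc n) F≈G = +-cong (F≈G 0 (suc n) ≡.refl)
    (anti-cong-≡ n (λ i j i+j≡n → F≈G (suc i) j (≡.cong suc i+j≡n)))

  anti-cong : ∀ n {F G : ℕ → ℕ → Carrier} → (∀ i j → F i j ≈ G i j) → anti n F ≈ anti n G
  anti-cong n F≈G = anti-cong-≡ n (λ i j _ → F≈G i j)

  anti-+ : ∀ n F G → anti n (λ i j → F i j + G i j) ≈ anti n F + anti n G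
  anti-+ zero    F G = refl
  anti-+ (suc n) F G = trans (+-congˡ (anti-+ n _ _))
    (solve 4 (λ a b c d → (a :+ b) :+ (c :+ d) := (a :+ c) :+ (b :+ d)) refl _ _ _ _)

  anti-*ˡ : ∀ n x F → anti n (λ i j → x * F i j) ≈ x * anti n F
  anti-*ˡ zero    x F = refl
  anti-*ˡ (suc n) x F = trans (+-congˡ (anti-*ˡ n x _)) (sym (distribˡ x _ _))

  anti-last : ∀ n F → anti (suc n) F ≈ anti n (λ i j → F i (suc j)) + F (suc n) 0
  anti-last zero    F = refl
  anti-last (suc n) F =
    trans (+-congˡ (anti-last n (λ i j → F (suc i) j))) (sym (+-assoc _ _ _))

  anti-flip : ∀ n F → anti n (λ i j → F j i) ≈ anti n F
  anti-flip zero    F = refl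
  anti-flip (suc n) F = begin
    F (suc n) 0 + anti n (λ i j → F j (suc i))  ≈⟨ +-comm _ _ ⟩
    anti n (λ i j → F j (suc i)) + F (suc n) 0  ≈⟨ +-congʳ (anti-flip n (λ i j → F i (suc j))) ⟩
    anti n (λ i j → F i (suc j)) + F (suc n) 0  ≈⟨ anti-last n F ⟨
    anti (suc n) F                              ∎

  -- Both sides run over the triples with sum n. In the induction, the terms with first index 0 are
  -- split off from every inner sum on the left.
  anti-assoc : ∀ n (F : ℕ → ℕ → ℕ → Carrier) →
    anti n (λ i j → anti i (λ k l → F k l j)) ≈ anti n (λ i j → anti j (F i))
  anti-assoc zero    F = refl
  anti-assoc (suc n) F = begin
    F 0 0 (suc n) + anti n (λ i j → F 0 (suc i) j + anti i (λ k l → F (suc k) l j))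
      ≈⟨ +-congˡ (anti-+ n _ _) ⟩
    F 0 0 (suc n) + (anti n (λ i j → F 0 (suc i) j) + anti n (λ i j → anti i (λ k l → F (suc k) l j)))
      ≈⟨ +-congˡ (+-congˡ (anti-assoc n (λ k → F (suc k)))) ⟩
    F 0 0 (suc n) + (anti n (λ i j → F 0 (suc i) j) + anti n (λ i j → anti j (F (suc i))))
      ≈⟨ +-assoc _ _ _ ⟨
    anti (suc n) (F 0) + anti n (λ i j → anti j (F (suc i)))
      ∎

  private
    anti-ends : ∀ n F → anti (suc (suc n)) F
                      ≈ anti n (λ i j → F (suc i) (suc j)) + (F 0 (suc (suc n)) + F (suc (suc n)) 0)
    anti-ends n F = trans (+-congˡ (anti-last n (λ i j → F (suc i) j)))
      (solve 3 (λ a b c → a :+ (b :+ c) := b :+ (a :+ c)) refl _ _ _)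

  -- Two indices with odd sum differ by some 2r + 1; j is the smaller one, and each pair is taken
  -- together with its mirror image.
  foldᵒ : (ℕ → ℕ → Carrier) → ℕ → ℕ → Carrier
  foldᵒ F r j = F j (j ℕ.+ suc (twice r)) + F (j ℕ.+ suc (twice r)) j

  anti-foldᵒ : ∀ n F → anti (suc (twice n)) F ≈ anti n (foldᵒ F)
  anti-foldᵒ zero    F = refl
  anti-foldᵒ (suc n) F = begin
    anti (suc (suc (suc (twice n)))) F   ≈⟨ anti-ends (suc (twice n)) F ⟩
    anti (suc (twice n)) (λ i j → F (suc i) (suc j)) + foldᵒ F (suc n) 0
      ≈⟨ +-congʳ (anti-foldᵒ n (λ i j → F (suc i) (suc j))) ⟩
    anti n (λ r j → foldᵒ F r (suc j)) + foldᵒ F (suc n) 0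
      ≈⟨ anti-last n (foldᵒ F) ⟨
    anti (suc n) (foldᵒ F)               ∎

  -- Here the indices differ by 2r, and the central term r = 0 is its own mirror image, hence
  -- counted once.
  foldᵉ : (ℕ → ℕ → Carrier) → ℕ → ℕ → Carrier
  foldᵉ F zero    j = F j j
  foldᵉ F (suc r) j = F j (j ℕ.+ twice (suc r)) + F (j ℕ.+ twice (suc r)) j

  anti-foldᵉ : ∀ n F → anti (twice n) F ≈ anti n (foldᵉ F)
  anti-foldᵉ zero    F = refl
  anti-foldᵉ (suc n) F = begin
    anti (suc (suc (twice n))) F         ≈⟨ anti-ends (twice n) F ⟩
    anti (twice n) (λ i j → F (suc i) (suc j)) + foldᵉ F (suc n) 0
      ≈⟨ +-congʳ (anti-foldᵉ n (λ i j → F (suc i) (suc j))) ⟩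
    anti n (foldᵉ (λ i j → F (suc i) (suc j))) + foldᵉ F (suc n) 0
      ≈⟨ +-congʳ (anti-cong n λ { zero j → refl ; (suc r) j → refl }) ⟩
    anti n (λ r j → foldᵉ F r (suc j)) + foldᵉ F (suc n) 0
      ≈⟨ anti-last n (foldᵉ F) ⟨
    anti (suc n) (foldᵉ F)               ∎

-- Identities between finite q-series

twice≡+ : ∀ n → twice n ≡ n ℕ.+ n
twice≡+ zero    = ≡.refl
twice≡+ (suc n) = ≡.cong suc (≡.trans (≡.cong suc (twice≡+ n)) (≡.sym (ℕ.+-suc n n)))

-- A sequence indexed by the integer k - n, built from its two halves.
module TwoSided {c} {A : Set c} where
  ⟪_,_⟫ : (ℕ → A) → (ℕ → A) → ℕ → ℕ → A
  ⟪ f , g ⟫ zero    zero    = f 0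
  ⟪ f , g ⟫ (suc k) zero    = f (suc k)
  ⟪ f , g ⟫ zero    (suc n) = g (suc n)
  ⟪ f , g ⟫ (suc k) (suc n) = ⟪ f , g ⟫ k n

  ⟪⟫-zeroʳ : ∀ f g k → ⟪ f , g ⟫ k 0 ≡ f k
  ⟪⟫-zeroʳ f g zero    = ≡.refl
  ⟪⟫-zeroʳ f g (suc k) = ≡.refl

  ⟪⟫-diagonal : ∀ f g n → ⟪ f , g ⟫ n n ≡ f 0
  ⟪⟫-diagonal f g zero    = ≡.refl
  ⟪⟫-diagonal f g (suc n) = ⟪⟫-diagonal f g n

  ⟪⟫-positive : ∀ f g n k → ⟪ f , g ⟫ (n ℕ.+ k) n ≡ f k
  ⟪⟫-positive f g zero    k = ⟪⟫-zeroʳ f g k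
  ⟪⟫-positive f g (suc n) k = ⟪⟫-positive f g n k

  ⟪⟫-negative : ∀ f g k n → ⟪ f , g ⟫ k (k ℕ.+ suc n) ≡ g (suc n)
  ⟪⟫-negative f g zero    n = ≡.refl
  ⟪⟫-negative f g (suc k) n = ⟪⟫-negative f g k n

module Pochhammer {c ℓ} (R : CommutativeRing c ℓ) where
  open CommutativeRing R
  open Algebra.Properties.Semiring.Exp semiring public using (_^_)

  poch : Carrier → Carrier → ℕ → Carrier
  poch a q zero    = 1#
  poch a q (suc m) = poch a q m * (1# - a * q ^ m)

  -- With the reciprocals 1/(q)_m given as a sequence, the finite identities make sense in every
  -- commutative ring.
  Reciprocal : Carrier → (ℕ → Carrier) → Set ℓ
  Reciprocal q u = ∀ m → poch q q m * u m ≈ 1#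

  -- (-x)ʳ q^(r(r-1)/2)
  gauss : Carrier → Carrier → ℕ → Carrier
  gauss x q zero    = 1#
  gauss x q (suc r) = gauss x q r * (- x * q ^ r)

  -- The r-th and the (-r)-th term of Jacobi's theta series, added up.
  θ : Carrier → Carrier → Carrier → ℕ → Carrier
  θ a b q zero    = 1#
  θ a b q (suc r) = gauss b q (suc r) + gauss a q (suc r)

module QSeries {c ℓ} (R : CommutativeRing c ℓ)
  (q : CommutativeRing.Carrier R) (u : ℕ → CommutativeRing.Carrier R)
  (poch*u≈1 : Pochhammer.Reciprocal R q u) where

  open CommutativeRing R
  open Pochhammer R
  open IntegerSolver R
  open AntidiagonalSums R
  open TwoSided {A = Carrier}
  open Algebra.Properties.Semiring.Exp semiring using (^-homo-*; ^-congʳ)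
  open Relation.Binary.Reasoning.Setoid setoid

  private
    ^-≡ : ∀ {m n} → m ≡ n → q ^ m ≈ q ^ n
    ^-≡ = ^-congʳ q

  u-zero : u 0 ≈ 1#
  u-zero = trans (sym (*-identityˡ _)) (poch*u≈1 0)

  u-suc : ∀ m → (1# - q ^ suc m) * u (suc m) ≈ u m
  u-suc m = begin
    w * v              ≈⟨ *-identityˡ _ ⟨
    1# * (w * v)       ≈⟨ *-congʳ (poch*u≈1 m) ⟨
    p * u m * (w * v)  ≈⟨ solve 4 (λ p x w v → p :* x :* (w :* v) := x :* (p :* w :* v)) refl p (u m) w v ⟩
    u m * (p * w * v)  ≈⟨ *-congˡ (poch*u≈1 (suc m)) ⟩
    u m * 1#           ≈⟨ *-identityʳ _ ⟩
    u m                ∎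
    where
    p = poch q q m
    w = 1# - q ^ suc m
    v = u (suc m)

  -- 1 - q^{m+1} can be cancelled because it is a factor of the invertible (q)_{m+1}. This closes
  -- every induction based on a Pascal rule.
  divide : ∀ m {x y} → (1# - q ^ suc m) * x ≈ u m * y → x ≈ u (suc m) * y
  divide m {x} {y} eq = begin
    x                  ≈⟨ *-identityˡ _ ⟨
    1# * x             ≈⟨ *-congʳ (poch*u≈1 (suc m)) ⟨
    p * w * v * x      ≈⟨ solve 4 (λ p w v x → p :* w :* v :* x := p :* v :* (w :* x)) refl p w v x ⟩
    p * v * (w * x)    ≈⟨ *-congˡ eq ⟩
    p * v * (u m * y)  ≈⟨ solve 4 (λ p v x y → p :* v :* (x :* y) := p :* x :* (v :* y)) refl p v (u m) y ⟩
    p * u m * (v * y)  ≈⟨ *-congʳ (poch*u≈1 m) ⟩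
    1# * (v * y)       ≈⟨ *-identityˡ _ ⟩
    v * y              ∎
    where
    p = poch q q m
    w = 1# - q ^ suc m
    v = u (suc m)

  -- Since u i * u j is the Gaussian binomial coefficient divided by (q)_n, this is a q-binomial sum
  -- up to the factor 1/(q)_n.
  conv : ℕ → (ℕ → ℕ → Carrier) → Carrier
  conv n G = anti n (λ i j → u i * u j * G i j)

  conv-cong : ∀ n {F G : ℕ → ℕ → Carrier} →
              (∀ i j → i ℕ.+ j ≡ n → F i j ≈ G i j) → conv n F ≈ conv n G
  conv-cong n F≈G = anti-cong-≡ n (λ i j i+j≡n → *-congˡ (F≈G i j i+j≡n))

  conv-+ : ∀ n F G → conv n (λ i j → F i j + G i j) ≈ conv n F + conv n G
  conv-+ n F G = trans (anti-cong n (λ i j → distribˡ _ _ _)) (anti-+ n _ _)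

  conv-*ˡ : ∀ n x G → conv n (λ i j → x * G i j) ≈ x * conv n G
  conv-*ˡ n x G = trans
    (anti-cong n (λ i j → solve 3 (λ w x g → w :* (x :* g) := x :* (w :* g)) refl _ _ _))
    (anti-*ˡ n x (λ i j → u i * u j * G i j))

  conv-flip : ∀ n G → conv n (λ i j → G j i) ≈ conv n G
  conv-flip n G = trans (anti-cong n (λ i j → *-congʳ (*-comm _ _)))
    (anti-flip n (λ i j → u i * u j * G i j))

  -- The q-Pascal rule, from 1 - q^(i+j) = q^i (1 - q^j) + (1 - q^i).
  conv-pascalˡ : ∀ n G → (1# - q ^ suc n) * conv (suc n) G
                       ≈ conv n (λ i j → q ^ i * G i (suc j) + G (suc i) j)
  conv-pascalˡ n G = begin
    (1# - q ^ suc n) * conv (suc n) G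
      ≈⟨ anti-*ˡ (suc n) (1# - q ^ suc n) (λ i j → u i * u j * G i j) ⟨
    anti (suc n) (λ i j → (1# - q ^ suc n) * (u i * u j * G i j))
      ≈⟨ anti-cong-≡ (suc n) split ⟩
    anti (suc n) (λ i j → A i j + B i j)
      ≈⟨ anti-+ (suc n) A B ⟩
    anti (suc n) A + anti (suc n) B
      ≈⟨ +-cong (trans (anti-last n A) (trans (+-congˡ A-zero) (+-identityʳ _)))
                (trans (+-congʳ B-zero) (+-identityˡ _)) ⟩
    anti n (λ i j → A i (suc j)) + anti n (λ i j → B (suc i) j)
      ≈⟨ anti-+ n _ _ ⟨
    anti n (λ i j → A i (suc j) + B (suc i) j)
      ≈⟨ anti-cong n merge ⟩
    conv n (λ i j → q ^ i * G i (suc j) + G (suc i) j)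
      ∎
    where
    A B : ℕ → ℕ → Carrier
    A i j = q ^ i * u i * G i j * ((1# - q ^ j) * u j)
    B i j = u j * G i j * ((1# - q ^ i) * u i)
    split : ∀ i j → i ℕ.+ j ≡ suc n → (1# - q ^ suc n) * (u i * u j * G i j) ≈ A i j + B i j
    split i j eq = begin
      (1# - q ^ suc n) * (u i * u j * G i j)
        ≈⟨ *-congʳ (+-congˡ (-‿cong (trans (sym (^-≡ eq)) (^-homo-* q i j)))) ⟩
      (1# - q ^ i * q ^ j) * (u i * u j * G i j)
        ≈⟨ solve 5 (λ x y u v g → (con (+ 1) :- x :* y) :* (u :* v :* g)
             := x :* u :* g :* ((con (+ 1) :- y) :* v) :+ v :* g :* ((con (+ 1) :- x) :* u))
             refl (q ^ i) (q ^ j) (u i) (u j) (G i j) ⟩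
      A i j + B i j ∎
    0-lemma : ∀ x y → x * ((1# - 1#) * y) ≈ 0#
    0-lemma = solve 2 (λ x y → x :* ((con (+ 1) :- con (+ 1)) :* y) := con (+ 0)) refl
    -- The factor 1 - q^0 kills one boundary term of each sum, so both reduce to sums over i + j =
    -- n.
    A-zero : A (suc n) 0 ≈ 0#
    A-zero = 0-lemma _ _
    B-zero : B 0 (suc n) ≈ 0#
    B-zero = 0-lemma _ _
    merge : ∀ i j → A i (suc j) + B (suc i) j ≈ u i * u j * (q ^ i * G i (suc j) + G (suc i) j)
    merge i j = trans (+-cong (*-congˡ (u-suc j)) (*-congˡ (u-suc i)))
      (solve 5 (λ x u v g h → x :* u :* g :* v :+ v :* h :* u := u :* v :* (x :* g :+ h))
        refl (q ^ i) (u i) (u j) (G i (suc j)) (G (suc i) j))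

  -- The mirror image of the previous rule, from 1 - q^{i+j} = (1 - q^j) + q^j (1 - q^i).
  conv-pascalʳ : ∀ n G → (1# - q ^ suc n) * conv (suc n) G
                       ≈ conv n (λ i j → G i (suc j) + q ^ j * G (suc i) j)
  conv-pascalʳ n G = begin
    (1# - q ^ suc n) * conv (suc n) G                        ≈⟨ *-congˡ (conv-flip (suc n) G) ⟨
    (1# - q ^ suc n) * conv (suc n) (λ i j → G j i)          ≈⟨ conv-pascalˡ n (λ i j → G j i) ⟩
    conv n (λ i j → q ^ i * G (suc j) i + G j (suc i))
      ≈⟨ conv-cong n (λ i j _ → +-comm _ _) ⟩
    conv n (λ i j → G j (suc i) + q ^ i * G (suc j) i)
      ≈⟨ conv-flip n (λ i j → G i (suc j) + q ^ j * G (suc i) j) ⟩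
    conv n (λ i j → G i (suc j) + q ^ j * G (suc i) j)       ∎

  -- A limiting case of the q-Chu-Vandermonde sum. Writing 1/(q)_{i+s} as (1 -
  -- q^{i+s+1})/(q)_{i+s+1} makes the Pascal rule carry (n + 1, s) to (n, s + 1), so the induction
  -- needs s to vary.
  vandermonde : ∀ n s → conv n (λ i j → q ^ (i ℕ.* (i ℕ.+ s)) * u (i ℕ.+ s)) ≈ u n * u (n ℕ.+ s)
  vandermonde zero s = begin
    u 0 * u 0 * (1# * u s)  ≈⟨ *-congʳ (*-congˡ u-zero) ⟩
    u 0 * 1# * (1# * u s)   ≈⟨ solve 2 (λ x y → x :* con (+ 1) :* (con (+ 1) :* y) := x :* y) refl _ _ ⟩
    u 0 * u s               ∎
  vandermonde (suc n) s = divide n (begin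
    (1# - q ^ suc n) * conv (suc n) (G s)                    ≈⟨ conv-pascalˡ n (G s) ⟩
    conv n (λ i j → q ^ i * G s i (suc j) + G s (suc i) j)   ≈⟨ conv-cong n (λ i j _ → step i j) ⟩
    conv n (G (suc s))                                       ≈⟨ vandermonde n (suc s) ⟩
    u n * u (n ℕ.+ suc s)                                    ≡⟨ ≡.cong (λ k → u n * u k) (ℕ.+-suc n s) ⟩
    u n * u (suc n ℕ.+ s)                                    ∎)
    where
    G : ℕ → ℕ → ℕ → Carrier
    G s i j = q ^ (i ℕ.* (i ℕ.+ s)) * u (i ℕ.+ s)
    step : ∀ i j → q ^ i * G s i (suc j) + G s (suc i) j ≈ G (suc s) i j
    step i j = begin
      q ^ i * (q ^ (i ℕ.* (i ℕ.+ s)) * u (i ℕ.+ s)) + q ^ (suc i ℕ.* (suc i ℕ.+ s)) * W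
        ≈⟨ +-cong (trans (sym (*-assoc _ _ _)) (*-cong e₁ (sym (u-suc (i ℕ.+ s))))) (*-congʳ e₂) ⟩
      E * ((1# - Z) * W) + E * Z * W
        ≈⟨ solve 3 (λ e z w → e :* ((con (+ 1) :- z) :* w) :+ e :* z :* w := e :* w) refl E Z W ⟩
      E * W
        ≡⟨ ≡.cong (λ k → E * u k) (≡.sym (ℕ.+-suc i s)) ⟩
      G (suc s) i j ∎
      where
      E = q ^ (i ℕ.* (i ℕ.+ suc s))
      Z = q ^ suc (i ℕ.+ s)
      W = u (suc (i ℕ.+ s))
      e₁ : q ^ i * q ^ (i ℕ.* (i ℕ.+ s)) ≈ E
      e₁ = trans (sym (^-homo-* q i _)) (^-≡ (lemma i s))
        where
        lemma : ∀ i s → i ℕ.+ i ℕ.* (i ℕ.+ s) ≡ i ℕ.* (i ℕ.+ suc s)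
        lemma = solve-∀
      e₂ : q ^ (suc i ℕ.* (suc i ℕ.+ s)) ≈ E * Z
      e₂ = trans (^-≡ (lemma i s)) (^-homo-* q (i ℕ.* (i ℕ.+ suc s)) (suc (i ℕ.+ s)))
        where
        lemma : ∀ i s → suc i ℕ.* (suc i ℕ.+ s) ≡ i ℕ.* (i ℕ.+ suc s) ℕ.+ suc (i ℕ.+ s)
        lemma = solve-∀

  -- βₙ = ∑ᵣ αᵣ / ((q)ₙ₋ᵣ (q)ₙ₊ᵣ₊₁), a Bailey pair relative to a = q up to the factor 1 - q.
  bailey : (ℕ → Carrier) → ℕ → Carrier
  bailey α n = anti n (λ r j → α r * (u j * u (j ℕ.+ suc (twice r))))

  -- Bailey's lemma with both free parameters sent to infinity. With k = r + j the exponent k(k+1)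
  -- splits as r(r+1) + j(j+2r+1), and the sum over j becomes `vandermonde` with s = 2r + 1.
  bailey-chain : ∀ α n →
    anti n (λ k m → q ^ (k ℕ.* suc k) * u m * bailey α k) ≈ bailey (λ r → q ^ (r ℕ.* suc r) * α r) n
  bailey-chain α n = begin
    anti n (λ k m → q ^ (k ℕ.* suc k) * u m * bailey α k)
      ≈⟨ anti-cong n (λ k m → anti-*ˡ k _ _) ⟨
    anti n (λ k m → anti k (λ r j → q ^ (k ℕ.* suc k) * u m * (α r * (u j * u (j ℕ.+ suc (twice r))))))
      ≈⟨ anti-cong n (λ k m → anti-cong-≡ k (λ r j r+j≡k →
           *-congʳ (*-congʳ (^-≡ (≡.cong (λ k → k ℕ.* suc k) (≡.sym r+j≡k)))))) ⟩
    anti n (λ k m → anti k (λ r j → F r j m))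
      ≈⟨ anti-assoc n F ⟩
    anti n (λ r l → anti l (F r))
      ≈⟨ anti-cong n inner ⟩
    bailey (λ r → q ^ (r ℕ.* suc r) * α r) n
      ∎
    where
    F : ℕ → ℕ → ℕ → Carrier
    F r j m = q ^ ((r ℕ.+ j) ℕ.* suc (r ℕ.+ j)) * u m * (α r * (u j * u (j ℕ.+ suc (twice r))))
    exponent : ∀ r j → (r ℕ.+ j) ℕ.* suc (r ℕ.+ j) ≡ r ℕ.* suc r ℕ.+ j ℕ.* (j ℕ.+ suc (r ℕ.+ r))
    exponent = solve-∀
    regroup : ∀ r j m → F r j m
      ≈ (q ^ (r ℕ.* suc r) * α r) * (u j * u m * (q ^ (j ℕ.* (j ℕ.+ suc (twice r))) * u (j ℕ.+ suc (twice r))))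
    regroup r j m = begin
      F r j m
        ≈⟨ *-congʳ (*-congʳ (trans (^-≡ (≡.trans (exponent r j)
             (≡.cong (λ k → r ℕ.* suc r ℕ.+ j ℕ.* (j ℕ.+ suc k)) (≡.sym (twice≡+ r)))))
             (^-homo-* q (r ℕ.* suc r) _))) ⟩
      (q ^ (r ℕ.* suc r) * q ^ (j ℕ.* (j ℕ.+ suc (twice r)))) * u m * (α r * (u j * u (j ℕ.+ suc (twice r))))
        ≈⟨ solve 6 (λ x y m a j v → (x :* y) :* m :* (a :* (j :* v)) := (x :* a) :* (j :* m :* (y :* v)))
             refl _ _ _ _ _ _ ⟩
      _ ∎
    inner : ∀ r l → anti l (F r) ≈ (q ^ (r ℕ.* suc r) * α r) * (u l * u (l ℕ.+ suc (twice r)))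
    inner r l = begin
      anti l (F r)       ≈⟨ anti-cong l (regroup r) ⟩
      anti l _           ≈⟨ anti-*ˡ l _ _ ⟩
      _ * conv l _       ≈⟨ *-congˡ (vandermonde l (suc (twice r))) ⟩
      _ * (u l * u (l ℕ.+ suc (twice r))) ∎

  module JacobiTriple (a b : Carrier) (ab≈q : a * b ≈ q) where
    -- `C i n` stands for the coefficient c_k = (-a)^k q^{k(k-1)/2} at k = i - n. For negative k it
    -- is formally rewritten through b = q/a, so that a need not be inverted.
    C : ℕ → ℕ → Carrier
    C = ⟪ gauss a q , gauss b q ⟫

    -- This is c_{k+1} = -a q^k c_k. The exponent k = i - n may be negative, and the factor q^j
    -- raises it to m.
    C-right : ∀ i j m n → i ℕ.+ j ≡ m ℕ.+ n → q ^ j * C (suc i) n ≈ - a * q ^ m * C i n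
    C-right i j m zero eq = begin
      q ^ j * (gauss a q i * (- a * q ^ i))
        ≈⟨ solve 4 (λ x t a y → x :* (t :* (a :* y)) := a :* (y :* x) :* t) refl _ _ _ _ ⟩
      - a * (q ^ i * q ^ j) * gauss a q i
        ≈⟨ *-cong (*-congˡ (trans (sym (^-homo-* q i j)) (^-≡ (≡.trans eq (ℕ.+-identityʳ m)))))
             (reflexive (≡.sym (⟪⟫-zeroʳ _ _ i))) ⟩
      - a * q ^ m * C i 0 ∎
    C-right zero j m (suc n) eq = begin
      q ^ j * C 0 n
        ≈⟨ *-cong (trans (^-≡ (≡.trans eq (ℕ.+-suc m n))) (*-cong (sym ab≈q) (^-homo-* q m n)))
             (C-zero n) ⟩
      a * b * (q ^ m * q ^ n) * gauss b q n
        ≈⟨ solve 5 (λ a b x y t → a :* b :* (x :* y) :* t := :- a :* x :* (t :* (:- b :* y)))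
             refl _ _ _ _ _ ⟩
      - a * q ^ m * (gauss b q n * (- b * q ^ n)) ∎
      where
      C-zero : ∀ n → C 0 n ≈ gauss b q n
      C-zero zero    = refl
      C-zero (suc n) = refl
    C-right (suc i) j m (suc n) eq = C-right i j m n (ℕ.suc-injective (≡.trans eq (ℕ.+-suc m n)))

    C-left : ∀ i n → q ^ i * C i (suc n) ≈ - b * q ^ n * C i n
    C-left zero zero = solve 1 (λ b → con (+ 1) :* (con (+ 1) :* (:- b :* con (+ 1)))
        := :- b :* con (+ 1) :* con (+ 1)) refl b
    C-left zero (suc n) = solve 3 (λ t b x → con (+ 1) :* (t :* (:- b :* x)) := :- b :* x :* t) refl _ _ _
    C-left (suc i) zero = begin
      q * q ^ i * C i 0
        ≈⟨ *-cong (*-congʳ (sym ab≈q)) (reflexive (⟪⟫-zeroʳ _ _ i)) ⟩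
      a * b * q ^ i * gauss a q i
        ≈⟨ solve 4 (λ a b x t → a :* b :* x :* t := :- b :* con (+ 1) :* (t :* (:- a :* x))) refl _ _ _ _ ⟩
      - b * 1# * (gauss a q i * (- a * q ^ i)) ∎
    C-left (suc i) (suc n) = begin
      q * q ^ i * C i (suc n)       ≈⟨ *-assoc _ _ _ ⟩
      q * (q ^ i * C i (suc n))     ≈⟨ *-congˡ (C-left i n) ⟩
      q * (- b * q ^ n * C i n)     ≈⟨ solve 4 (λ q b x c → q :* (b :* x :* c)
          := b :* (q :* x) :* c) refl _ _ _ _ ⟩
      - b * (q * q ^ n) * C i n     ∎

    -- The step to n + 1 uses both Pascal rules: passing to 2n + 1 contributes 1 - a q^n by
    -- `C-right`, passing to 2n + 2 contributes 1 - b q^n by `C-left`.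
    jacobi-triple : ∀ n → conv (twice n) (λ i j → C i n) ≈ u (twice n) * (poch a q n * poch b q n)
    jacobi-triple zero = trans (*-congʳ (*-congˡ u-zero))
      (solve 1 (λ x → x :* con (+ 1) :* con (+ 1) := x :* (con (+ 1) :* con (+ 1))) refl _)
    jacobi-triple (suc n) = begin
      conv (suc (suc (twice n))) (λ i j → C i (suc n))
        ≈⟨ divide (suc (twice n)) (trans (conv-pascalˡ (suc (twice n)) (λ i j → C i (suc n))) left) ⟩
      u (suc (suc (twice n))) * ((1# - b * q ^ n) * ((1# - a * q ^ n) * (poch a q n * poch b q n)))
        ≈⟨ *-congˡ (solve 4 (λ x y p r → y :* (x :* (p :* r)) := (p :* x) :* (r :* y)) refl _ _ _ _) ⟩
      u (suc (suc (twice n))) * (poch a q (suc n) * poch b q (suc n)) ∎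
      where
      1+ : ∀ x y z → z + - x * y * z ≈ (1# - x * y) * z
      1+ = solve 3 (λ x y z → z :+ :- x :* y :* z := (con (+ 1) :- x :* y) :* z) refl
      right : conv (suc (twice n)) (λ i j → C i n)
            ≈ u (suc (twice n)) * ((1# - a * q ^ n) * (poch a q n * poch b q n))
      right = divide (twice n) (begin
        (1# - q ^ suc (twice n)) * conv (suc (twice n)) (λ i j → C i n)
          ≈⟨ conv-pascalʳ (twice n) (λ i j → C i n) ⟩
        conv (twice n) (λ i j → C i n + q ^ j * C (suc i) n)
          ≈⟨ conv-cong (twice n) (λ i j eq → trans
               (+-congˡ (C-right i j n n (≡.trans eq (twice≡+ n)))) (1+ a _ _)) ⟩
        conv (twice n) (λ i j → (1# - a * q ^ n) * C i n)
          ≈⟨ conv-*ˡ (twice n) _ (λ i j → C i n) ⟩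
        (1# - a * q ^ n) * conv (twice n) (λ i j → C i n)
          ≈⟨ *-congˡ (jacobi-triple n) ⟩
        (1# - a * q ^ n) * (u (twice n) * (poch a q n * poch b q n))
          ≈⟨ solve 3 (λ x y z → x :* (y :* z) := y :* (x :* z)) refl _ _ _ ⟩
        u (twice n) * ((1# - a * q ^ n) * (poch a q n * poch b q n)) ∎)
      left : conv (suc (twice n)) (λ i j → q ^ i * C i (suc n) + C i n)
           ≈ u (suc (twice n)) * ((1# - b * q ^ n) * ((1# - a * q ^ n) * (poch a q n * poch b q n)))
      left = begin
        conv (suc (twice n)) (λ i j → q ^ i * C i (suc n) + C i n)
          ≈⟨ conv-cong (suc (twice n)) (λ i j _ → trans (+-comm _ _)
               (trans (+-congˡ (C-left i n)) (1+ b _ _))) ⟩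
        conv (suc (twice n)) (λ i j → (1# - b * q ^ n) * C i n)
          ≈⟨ conv-*ˡ (suc (twice n)) _ (λ i j → C i n) ⟩
        (1# - b * q ^ n) * conv (suc (twice n)) (λ i j → C i n)
          ≈⟨ *-congˡ right ⟩
        (1# - b * q ^ n) * (u (suc (twice n)) * ((1# - a * q ^ n) * (poch a q n * poch b q n)))
          ≈⟨ solve 3 (λ x y z → x :* (y :* z) := y :* (x :* z)) refl _ _ _ ⟩
        _ ∎

    -- In this form the weight is 1/((q)_{n-r} (q)_{n+r}), which has a limit for fixed r as n grows.
    jacobi-triple-folded : ∀ n → anti n (λ r j → θ a b q r * (u j * u (j ℕ.+ twice r)))
                               ≈ u (twice n) * (poch a q n * poch b q n)
    jacobi-triple-folded n = begin
      anti n (λ r j → θ a b q r * (u j * u (j ℕ.+ twice r)))       ≈⟨ anti-cong-≡ n fold ⟩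
      anti n (foldᵉ (λ i j → u i * u j * C i n))             ≈⟨ anti-foldᵉ n (λ i j → u i * u j * C i n) ⟨
      conv (twice n) (λ i j → C i n)                         ≈⟨ jacobi-triple n ⟩
      u (twice n) * (poch a q n * poch b q n)                ∎
      where
      fold : ∀ r j → r ℕ.+ j ≡ n → θ a b q r * (u j * u (j ℕ.+ twice r)) ≈ foldᵉ (λ i j → u i * u j * C i n) r j
      fold zero j ≡.refl = begin
        1# * (u j * u (j ℕ.+ 0))  ≡⟨ ≡.cong (λ k → 1# * (u j * u k)) (ℕ.+-identityʳ j) ⟩
        1# * (u j * u j)          ≈⟨ *-comm _ _ ⟩
        u j * u j * 1#            ≡⟨ ≡.cong (u j * u j *_) (≡.sym (⟪⟫-diagonal (gauss a q) (gauss b q) j)) ⟩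
        u j * u j * C j j         ∎
      fold (suc r) j ≡.refl = begin
        (gauss b q (suc r) + gauss a q (suc r)) * (u j * v)
          ≈⟨ solve 4 (λ x y u v → (x :+ y) :* (u :* v) := u :* v :* x :+ v :* u :* y) refl _ _ _ _ ⟩
        u j * v * gauss b q (suc r) + v * u j * gauss a q (suc r)
          ≡⟨ ≡.cong₂ (λ x y → u j * v * x + v * u j * y)
               (≡.sym (≡.trans (≡.cong (C j) (ℕ.+-comm (suc r) j)) (⟪⟫-negative (gauss a q) (gauss b q) j r)))
               (≡.sym (≡.trans (≡.cong (λ k → C k (suc r ℕ.+ j)) (shift r j))
                 (⟪⟫-positive (gauss a q) (gauss b q) (suc r ℕ.+ j) (suc r)))) ⟩
        u j * v * C j (suc r ℕ.+ j) + v * u j * C (j ℕ.+ twice (suc r)) (suc r ℕ.+ j) ∎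
        where
        v = u (j ℕ.+ twice (suc r))
        lemma : ∀ r j → j ℕ.+ (suc r ℕ.+ suc r) ≡ (suc r ℕ.+ j) ℕ.+ suc r
        lemma = solve-∀
        shift : ∀ r j → j ℕ.+ twice (suc r) ≡ (suc r ℕ.+ j) ℕ.+ suc r
        shift r j = ≡.trans (≡.cong (j ℕ.+_) (twice≡+ (suc r))) (lemma r j)

-- Theta coefficients for a root of -q

module ImaginaryGauss {c ℓ} (R : CommutativeRing c ℓ)
  (q : CommutativeRing.Carrier R) where
  open CommutativeRing R
  open Pochhammer R
  open IntegerSolver R
  open AntidiagonalSums R
  open Algebra.Properties.Semiring.Exp semiring using (^-homo-*; ^-congʳ; ^-assocʳ)
  open Relation.Binary.Reasoning.Setoid setoid

  -- gauss (-X) q r = U r + X V r in the extension by a root X of X² = -q.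
  U V : ℕ → Carrier
  U zero    = 1#
  U (suc r) = - q ^ suc r * V r
  V zero    = 0#
  V (suc r) = q ^ r * U r

  -- Among an odd number of terms, the exponents -r and r + 1 of X carry the same weight
  -- 1/((q)_{n-r} (q)_{n+r+1}); `U` has the same value at -r and r.
  α : ℕ → Carrier
  α r = U r + U (suc r)

  α″ : ℕ → Carrier
  α″ r = q ^ (r ℕ.* suc r) * (q ^ (r ℕ.* suc r) * α r)

  private
    w : ℕ → Carrier
    w r = q ^ (r ℕ.* suc r)

    U-odd : ∀ j → U (suc (twice j)) ≈ 0#
    U-odd zero    = zeroʳ _
    U-odd (suc j) = trans (*-congˡ (trans (*-congˡ (U-odd j)) (zeroʳ _))) (zeroʳ _)

    -- The exponent of `w` grows by (r+2)(r+3) - r(r+1) = 4r + 6, twice over, and U adds 2x + 2. The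
    -- arguments are kept apart because x = r for even r and x = r + 1 for odd r.
    weighted-step : ∀ r x → w (suc (suc r)) * (w (suc (suc r)) * (- q ^ suc (suc x) * (q ^ x * U x)))
                  ≈ w r * (w r * U x) * - q ^ (8 ℕ.* r ℕ.+ 2 ℕ.* x ℕ.+ 14)
    weighted-step r x = begin
      W * (W * (- q ^ suc (suc x) * (q ^ x * U x)))
        ≈⟨ *-cong w-step (*-congʳ w-step) ⟩
      w r * e * (w r * e * (- q ^ suc (suc x) * (q ^ x * U x)))
        ≈⟨ solve 5 (λ w e x y u → w :* e :* (w :* e :* (:- x :* (y :* u)))
            := w :* (w :* u) :* :- (e :* e :* (x :* y)))
             refl _ _ _ _ _ ⟩
      w r * (w r * U x) * - (e * e * (q ^ suc (suc x) * q ^ x))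
        ≈⟨ *-congˡ (-‿cong (*-cong (^-homo-* q d d) (^-homo-* q (suc (suc x)) x))) ⟨
      w r * (w r * U x) * - (q ^ (d ℕ.+ d) * q ^ (suc (suc x) ℕ.+ x))
        ≈⟨ *-congˡ (-‿cong (^-homo-* q (d ℕ.+ d) (suc (suc x) ℕ.+ x))) ⟨
      w r * (w r * U x) * - q ^ ((d ℕ.+ d) ℕ.+ (suc (suc x) ℕ.+ x))
        ≈⟨ *-congˡ (-‿cong (^-congʳ q (exponent r x))) ⟩
      w r * (w r * U x) * - q ^ (8 ℕ.* r ℕ.+ 2 ℕ.* x ℕ.+ 14) ∎
      where
      W = w (suc (suc r))
      d = 4 ℕ.* r ℕ.+ 6
      e = q ^ d
      exponent : ∀ r x → ((4 ℕ.* r ℕ.+ 6) ℕ.+ (4 ℕ.* r ℕ.+ 6)) ℕ.+ (suc (suc x) ℕ.+ x) ≡ 8 ℕ.* r ℕ.+ 2 ℕ.* x ℕ.+ 14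
      exponent = solve-∀
      w-exponent : ∀ r → suc (suc r) ℕ.* suc (suc (suc r)) ≡ r ℕ.* suc r ℕ.+ (4 ℕ.* r ℕ.+ 6)
      w-exponent = solve-∀
      w-step : W ≈ w r * e
      w-step = trans (^-congʳ q (w-exponent r)) (^-homo-* q (r ℕ.* suc r) d)

    q^20 : ∀ m {n} x → m ℕ.+ 20 ℕ.* x ≡ n → q ^ n ≈ q ^ m * (q ^ 20) ^ x
    q^20 m x ≡.refl = trans (^-homo-* q m (20 ℕ.* x)) (*-congˡ (sym (^-assocʳ q 20 x)))

    -q^20 : ∀ m {n} x → m ℕ.+ 20 ℕ.* x ≡ n → - q ^ n ≈ - q ^ m * (q ^ 20) ^ x
    -q^20 m x eq = trans (-‿cong (q^20 m x eq)) (solve 2 (λ x y → :- (x :* y) := :- x :* y) refl _ _)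

    -- At r = x = 2j the step factor is -q^{14+20j}, the ratio of consecutive values of
    -- `gauss (q ^ 14) (q ^ 20)`.
    U-even : ∀ j → w (twice j) * (w (twice j) * U (twice j)) ≈ gauss (q ^ 14) (q ^ 20) j
    U-even zero    = trans (*-identityˡ _) (*-identityˡ _)
    U-even (suc j) = trans (weighted-step (twice j) (twice j)) (*-cong (U-even j) (-q^20 14 j (lemma j)))
      where
      lemma′ : ∀ j → 14 ℕ.+ 20 ℕ.* j ≡ 8 ℕ.* (j ℕ.+ j) ℕ.+ 2 ℕ.* (j ℕ.+ j) ℕ.+ 14
      lemma′ = solve-∀
      lemma : ∀ j → 14 ℕ.+ 20 ℕ.* j ≡ 8 ℕ.* twice j ℕ.+ 2 ℕ.* twice j ℕ.+ 14
      lemma j = ≡.trans (lemma′ j) (≡.cong (λ k → 8 ℕ.* k ℕ.+ 2 ℕ.* k ℕ.+ 14) (≡.sym (twice≡+ j)))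

    -- At r = 2j + 1, x = 2j + 2 the step factor is -q^{26+20j}; the sequence starts at -q^6, two
    -- powers each from the two weights and from `U 2`.
    U-even′ : ∀ j → w (suc (twice j)) * (w (suc (twice j)) * U (suc (suc (twice j)))) ≈ gauss (q ^ 6) (q ^ 20) (suc j)
    U-even′ zero    = solve 1 (λ q → q :^ 2 :* (q :^ 2 :* (:- (q :^ 2) :* (con (+ 1) :* con (+ 1))))
        := con (+ 1) :* (:- (q :^ 6) :* con (+ 1))) refl q
    U-even′ (suc j) = trans (weighted-step (suc (twice j)) (suc (suc (twice j))))
        (*-cong (U-even′ j) (-q^20 6 (suc j) (lemma j)))
      where
      lemma′ : ∀ j → 6 ℕ.+ 20 ℕ.* suc j ≡ 8 ℕ.* suc (j ℕ.+ j) ℕ.+ 2 ℕ.* suc (suc (j ℕ.+ j)) ℕ.+ 14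
      lemma′ = solve-∀
      lemma : ∀ j → 6 ℕ.+ 20 ℕ.* suc j ≡ 8 ℕ.* suc (twice j) ℕ.+ 2 ℕ.* suc (suc (twice j)) ℕ.+ 14
      lemma j = ≡.trans (lemma′ j) (≡.cong (λ k → 8 ℕ.* suc k ℕ.+ 2 ℕ.* suc (suc k) ℕ.+ 14) (≡.sym (twice≡+ j)))

  α″-odd : ∀ j → α″ (suc (twice j)) ≈ gauss (q ^ 6) (q ^ 20) (suc j)
  α″-odd j = trans (*-congˡ (*-congˡ (trans (+-congʳ (U-odd j)) (+-identityˡ _)))) (U-even′ j)

  α″-even : ∀ j → α″ (twice j) ≈ gauss (q ^ 14) (q ^ 20) j
  α″-even j = trans (*-congˡ (*-congˡ (trans (+-congˡ (U-odd j)) (+-identityʳ _)))) (U-even j)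

  -- The terms r = 2j - 1 and r = 2j are the two theta terms of index -j and j, so only an even
  -- cut-off leaves complete pairs.
  ∑α″≈∑θ : ∀ n → anti (twice n) (λ r _ → α″ r) ≈ anti n (λ r _ → θ (q ^ 14) (q ^ 6) (q ^ 20) r)
  ∑α″≈∑θ zero    = α″-even 0
  ∑α″≈∑θ (suc n) = begin
    anti (twice (suc n)) (λ r _ → α″ r)
      ≈⟨ trans (anti-last (suc (twice n)) (λ r _ → α″ r)) (+-congʳ (anti-last (twice n) (λ r _ → α″ r))) ⟩
    anti (twice n) (λ r _ → α″ r) + α″ (suc (twice n)) + α″ (twice (suc n))
      ≈⟨ +-assoc _ _ _ ⟩
    anti (twice n) (λ r _ → α″ r) + (α″ (suc (twice n)) + α″ (twice (suc n)))
      ≈⟨ +-cong (∑α″≈∑θ n) (+-cong (α″-odd n) (α″-even (suc n))) ⟩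
    anti n (λ r _ → θ (q ^ 14) (q ^ 6) (q ^ 20) r) + θ (q ^ 14) (q ^ 6) (q ^ 20) (suc n)
      ≈⟨ anti-last n (λ r _ → θ (q ^ 14) (q ^ 6) (q ^ 20) r) ⟨
    anti (suc n) (λ r _ → θ (q ^ 14) (q ^ 6) (q ^ 20) r) ∎

-- The Bailey pair and the finite form of the identity

module FiniteIdentity {c ℓ} (R : CommutativeRing c ℓ)
  (q : CommutativeRing.Carrier R) (u : ℕ → CommutativeRing.Carrier R)
  (poch*u≈1 : Pochhammer.Reciprocal R q u) where

  open CommutativeRing R
  open Pochhammer R
  open QSeries R q u poch*u≈1
  open ImaginaryGauss R q
  open IntegerSolver R
  open AntidiagonalSums R
  open TwoSided {A = Carrier}
  open Algebra.Properties.Ring ring using (-0#≈0#)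
  open Algebra.Properties.Semiring.Exp semiring using (^-homo-*; ^-congʳ; ^-assocʳ)
  open Relation.Binary.Reasoning.Setoid setoid

  private
    ^-≡ : ∀ {m n} → m ≡ n → q ^ m ≈ q ^ n
    ^-≡ = ^-congʳ q

    -- Negative indices belong to b = X instead of a = -X. Changing the sign of X fixes the even
    -- part and negates the coefficient of X.
    U± V± : ℕ → ℕ → Carrier
    U± = ⟪ U , U ⟫
    V± = ⟪ V , (λ r → - V r) ⟫

    U±-zero : ∀ n → U± 0 n ≡ U n
    U±-zero zero    = ≡.refl
    U±-zero (suc n) = ≡.refl

    V±-zero : ∀ n → V± 0 n ≈ - V n
    V±-zero zero    = sym -0#≈0#
    V±-zero (suc n) = refl

    -- The part free of X in `C-right` for a = -X, where X · XV = -qV; `V±-right` is the coefficient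
    -- of X, and `U±-left` comes from `C-left` in the same way.
    U±-right : ∀ i j m n → i ℕ.+ j ≡ m ℕ.+ n → q ^ j * U± (suc i) n ≈ - q ^ suc m * V± i n
    U±-right i j m zero eq = begin
      q ^ j * (- (q * q ^ i) * V i)
        ≈⟨ solve 4 (λ y q x v → y :* (:- (q :* x) :* v) := :- (q :* (x :* y)) :* v) refl _ _ _ _ ⟩
      - (q * (q ^ i * q ^ j)) * V i
        ≈⟨ *-cong (-‿cong (*-congˡ (trans (sym (^-homo-* q i j)) (^-≡ (≡.trans eq (ℕ.+-identityʳ m))))))
             (reflexive (≡.sym (⟪⟫-zeroʳ _ _ i))) ⟩
      - q ^ suc m * V± i 0 ∎
    U±-right zero j m (suc n) eq = begin
      q ^ j * U± 0 n
        ≈⟨ *-cong (trans (^-≡ (≡.trans eq (ℕ.+-suc m n))) (*-congˡ (^-homo-* q m n)))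
             (reflexive (U±-zero n)) ⟩
      q * (q ^ m * q ^ n) * U n
        ≈⟨ solve 4 (λ q x y u → q :* (x :* y) :* u := :- (q :* x) :* :- (y :* u)) refl _ _ _ _ ⟩
      - q ^ suc m * - (q ^ n * U n) ∎
    U±-right (suc i) j m (suc n) eq = U±-right i j m n (ℕ.suc-injective (≡.trans eq (ℕ.+-suc m n)))

    V±-right : ∀ i j m n → i ℕ.+ j ≡ m ℕ.+ n → q ^ j * V± (suc i) n ≈ q ^ m * U± i n
    V±-right i j m zero eq = begin
      q ^ j * (q ^ i * U i)
        ≈⟨ solve 3 (λ y x u → y :* (x :* u) := x :* y :* u) refl _ _ _ ⟩
      q ^ i * q ^ j * U i
        ≈⟨ *-cong (trans (sym (^-homo-* q i j)) (^-≡ (≡.trans eq (ℕ.+-identityʳ m))))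
             (reflexive (≡.sym (⟪⟫-zeroʳ _ _ i))) ⟩
      q ^ m * U± i 0 ∎
    V±-right zero j m (suc n) eq = begin
      q ^ j * V± 0 n
        ≈⟨ *-cong (trans (^-≡ eq) (^-homo-* q m (suc n))) (V±-zero n) ⟩
      q ^ m * q ^ suc n * - V n
        ≈⟨ solve 3 (λ x y v → x :* y :* :- v := x :* (:- y :* v)) refl _ _ _ ⟩
      q ^ m * U (suc n) ∎
    V±-right (suc i) j m (suc n) eq = V±-right i j m n (ℕ.suc-injective (≡.trans eq (ℕ.+-suc m n)))

    U±-left : ∀ i n → q ^ i * U± i (suc n) ≈ q ^ suc n * V± i n
    U±-left zero zero = solve 1 (λ q → con (+ 1) :* (:- q :* con (+ 0)) := q :* con (+ 0)) refl (q ^ 1)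
    U±-left zero (suc n) = solve 2 (λ q v → con (+ 1) :* (:- q :* v)
        := q :* :- v) refl (q ^ suc (suc n)) (V (suc n))
    U±-left (suc i) zero = begin
      q * q ^ i * U± i 0         ≡⟨ ≡.cong (q * q ^ i *_) (⟪⟫-zeroʳ _ _ i) ⟩
      q * q ^ i * U i            ≈⟨ solve 3 (λ q x u → q :* x :* u := q :* con (+ 1) :* (x :* u)) refl _ _ _ ⟩
      q * 1# * (q ^ i * U i)     ∎
    U±-left (suc i) (suc n) = begin
      q * q ^ i * U± i (suc n)       ≈⟨ *-assoc _ _ _ ⟩
      q * (q ^ i * U± i (suc n))     ≈⟨ *-congˡ (U±-left i n) ⟩
      q * (q ^ suc n * V± i n)       ≈⟨ *-assoc _ _ _ ⟨
      q * q ^ suc n * V± i n         ∎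

    -- The product of n complete pairs (1 + Xq^l)(1 - Xq^l) is even in X. Concretely, `V±` is odd
    -- under exchange of i and j while the weights are symmetric.
    conv-V± : ∀ n → conv (twice n) (λ i j → V± i n) ≈ 0#
    conv-V± n = begin
      conv (twice n) (λ i j → V± i n)               ≈⟨ anti-foldᵉ n (λ i j → u i * u j * V± i n) ⟩
      anti n (foldᵉ (λ i j → u i * u j * V± i n))   ≈⟨ anti-cong-≡ n cancel ⟩
      -- Zero is written as a product so that `anti-*ˡ` can pull it out of the sum.
      anti n (λ i j → 0# * 0#)                      ≈⟨ anti-*ˡ n 0# (λ _ _ → 0#) ⟩
      0# * anti n (λ i j → 0#)                      ≈⟨ zeroˡ _ ⟩
      0#                                            ∎
      where
      cancel : ∀ r j → r ℕ.+ j ≡ n → foldᵉ (λ i j → u i * u j * V± i n) r j ≈ 0# * 0#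
      cancel zero j ≡.refl = *-cong-zero (reflexive (⟪⟫-diagonal V _ j))
        where
        *-cong-zero : ∀ {x y} → y ≈ 0# → x * y ≈ 0# * 0#
        *-cong-zero eq = trans (*-congˡ eq) (trans (zeroʳ _) (sym (zeroˡ _)))
      cancel (suc r) j ≡.refl = begin
        u j * v * V± j (suc r ℕ.+ j) + v * u j * V± (j ℕ.+ twice (suc r)) (suc r ℕ.+ j)
          ≡⟨ ≡.cong₂ (λ x y → u j * v * x + v * u j * y)
               (≡.trans (≡.cong (V± j) (ℕ.+-comm (suc r) j)) (⟪⟫-negative V (λ r → - V r) j r))
               (≡.trans (≡.cong (λ k → V± k (suc r ℕ.+ j)) (shift r j))
                 (⟪⟫-positive V (λ r → - V r) (suc r ℕ.+ j) (suc r))) ⟩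
        u j * v * - V (suc r) + v * u j * V (suc r)
          ≈⟨ solve 3 (λ u v x → u :* v :* :- x :+ v :* u :* x := con (+ 0) :* con (+ 0)) refl _ _ _ ⟩
        0# * 0# ∎
        where
        v = u (j ℕ.+ twice (suc r))
        lemma : ∀ r j → j ℕ.+ (suc r ℕ.+ suc r) ≡ (suc r ℕ.+ j) ℕ.+ suc r
        lemma = solve-∀
        shift : ∀ r j → j ℕ.+ twice (suc r) ≡ (suc r ℕ.+ j) ℕ.+ suc r
        shift r j = ≡.trans (≡.cong (j ℕ.+_) (twice≡+ (suc r))) (lemma r j)

    Π : ℕ → Carrier
    Π = poch (- q) (q ^ 2)

    conv-linear : ∀ n x {E F G : ℕ → ℕ → Carrier} →
                  (∀ i j → i ℕ.+ j ≡ n → E i j ≈ F i j + x * G i j) → conv n E ≈ conv n F + x * conv n G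
    conv-linear n x {E} {F} {G} eq = begin
      conv n E                                 ≈⟨ conv-cong n eq ⟩
      conv n (λ i j → F i j + x * G i j)       ≈⟨ conv-+ n F (λ i j → x * G i j) ⟩
      conv n F + conv n (λ i j → x * G i j)    ≈⟨ +-congˡ (conv-*ˡ n x G) ⟩
      conv n F + x * conv n G                  ∎

    -- The additional factor 1 + Xq^n leaves the even part `Π n` unchanged. The even case is an
    -- argument because its own induction calls this lemma.
    conv-U±ᵒ : ∀ n → conv (twice n) (λ i j → U± i n) ≈ u (twice n) * Π n →
               conv (suc (twice n)) (λ i j → U± i n) ≈ u (suc (twice n)) * Π n
    conv-U±ᵒ n IH = divide (twice n) (begin
      (1# - q ^ suc (twice n)) * conv (suc (twice n)) (λ i j → U± i n)
        ≈⟨ conv-pascalʳ (twice n) (λ i j → U± i n) ⟩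
      conv (twice n) (λ i j → U± i n + q ^ j * U± (suc i) n)
        ≈⟨ conv-linear (twice n) (- q ^ suc n)
             (λ i j eq → +-congˡ (U±-right i j n n (≡.trans eq (twice≡+ n)))) ⟩
      conv (twice n) (λ i j → U± i n) + - q ^ suc n * conv (twice n) (λ i j → V± i n)
        ≈⟨ +-cong IH (trans (*-congˡ (conv-V± n)) (zeroʳ _)) ⟩
      u (twice n) * Π n + 0#
        ≈⟨ +-identityʳ _ ⟩
      u (twice n) * Π n ∎)

    -- Multiplying Π n (1 + Xq^n) by 1 - Xq^n feeds the coefficient of X back into the even part as
    -- q^{2n+1} Π n, which completes the factor 1 + q^{2n+1}.
    conv-U±ᵉ : ∀ n → conv (twice n) (λ i j → U± i n) ≈ u (twice n) * Π n
    conv-U±ᵉ zero = trans (*-congʳ (*-congˡ u-zero))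
      (solve 1 (λ x → x :* con (+ 1) :* con (+ 1) := x :* con (+ 1)) refl _)
    conv-U±ᵉ (suc n) = divide (suc (twice n)) (begin
      (1# - q ^ suc (suc (twice n))) * conv (suc (suc (twice n))) (λ i j → U± i (suc n))
        ≈⟨ conv-pascalˡ (suc (twice n)) (λ i j → U± i (suc n)) ⟩
      conv (suc (twice n)) (λ i j → q ^ i * U± i (suc n) + U± i n)
        ≈⟨ conv-linear (suc (twice n)) (q ^ suc n) {F = λ i j → U± i n} {G = λ i j → V± i n} (λ i j _ → trans (+-comm _ _) (+-congˡ (U±-left i n))) ⟩
      conv (suc (twice n)) (λ i j → U± i n) + q ^ suc n * conv (suc (twice n)) (λ i j → V± i n)
        ≈⟨ +-cong (conv-U±ᵒ n (conv-U±ᵉ n)) (*-congˡ conv-V±ᵒ) ⟩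
      u (suc (twice n)) * Π n + q ^ suc n * (u (suc (twice n)) * (q ^ n * Π n))
        ≈⟨ solve 5 (λ u p q x y → u :* p :+ q :* x :* (u :* (y :* p))
            := u :* (p :* (con (+ 1) :- :- q :* (x :* y))))
             refl (u (suc (twice n))) (Π n) q (q ^ n) (q ^ n) ⟩
      u (suc (twice n)) * (Π n * (1# - - q * (q ^ n * q ^ n)))
        ≈⟨ *-congˡ (*-congˡ (+-congˡ (-‿cong (*-congˡ square)))) ⟩
      u (suc (twice n)) * Π (suc n) ∎)
      where
      square : q ^ n * q ^ n ≈ (q ^ 2) ^ n
      square = begin
        q ^ n * q ^ n     ≈⟨ ^-homo-* q n n ⟨
        q ^ (n ℕ.+ n)     ≈⟨ ^-≡ (≡.cong (n ℕ.+_) (≡.sym (ℕ.+-identityʳ n))) ⟩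
        q ^ (2 ℕ.* n)     ≈⟨ ^-assocʳ q 2 n ⟨
        (q ^ 2) ^ n       ∎
      -- The coefficient of X in Π n (1 + Xq^n).
      conv-V±ᵒ : conv (suc (twice n)) (λ i j → V± i n) ≈ u (suc (twice n)) * (q ^ n * Π n)
      conv-V±ᵒ = divide (twice n) (begin
        (1# - q ^ suc (twice n)) * conv (suc (twice n)) (λ i j → V± i n)
          ≈⟨ conv-pascalʳ (twice n) (λ i j → V± i n) ⟩
        conv (twice n) (λ i j → V± i n + q ^ j * V± (suc i) n)
          ≈⟨ conv-linear (twice n) (q ^ n)
               (λ i j eq → +-congˡ (V±-right i j n n (≡.trans eq (twice≡+ n)))) ⟩
        conv (twice n) (λ i j → V± i n) + q ^ n * conv (twice n) (λ i j → U± i n)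
          ≈⟨ +-cong (conv-V± n) (*-congˡ (conv-U±ᵉ n)) ⟩
        0# + q ^ n * (u (twice n) * Π n)
          ≈⟨ solve 3 (λ x y z → con (+ 0) :+ x :* (y :* z) := y :* (x :* z)) refl _ _ _ ⟩
        u (twice n) * (q ^ n * Π n) ∎)

  bailey-α : ∀ n → bailey α n ≈ u (suc (twice n)) * poch (- q) (q ^ 2) n
  bailey-α n = begin
    bailey α n                                          ≈⟨ anti-cong-≡ n fold ⟩
    anti n (foldᵒ (λ i j → u i * u j * U± i n))         ≈⟨ anti-foldᵒ n (λ i j → u i * u j * U± i n) ⟨
    conv (suc (twice n)) (λ i j → U± i n)               ≈⟨ conv-U±ᵒ n (conv-U±ᵉ n) ⟩
    u (suc (twice n)) * poch (- q) (q ^ 2) n            ∎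
    where
    U±-negative : ∀ r j → U± j (r ℕ.+ j) ≡ U r
    U±-negative zero    j = ⟪⟫-diagonal U U j
    U±-negative (suc r) j = ≡.trans (≡.cong (U± j) (ℕ.+-comm (suc r) j)) (⟪⟫-negative U U j r)
    lemma : ∀ r j → j ℕ.+ suc (r ℕ.+ r) ≡ (r ℕ.+ j) ℕ.+ suc r
    lemma = solve-∀
    U±-positive : ∀ r j → U± (j ℕ.+ suc (twice r)) (r ℕ.+ j) ≡ U (suc r)
    U±-positive r j = ≡.trans
      (≡.cong (λ k → U± k (r ℕ.+ j)) (≡.trans (≡.cong (λ k → j ℕ.+ suc k) (twice≡+ r)) (lemma r j)))
      (⟪⟫-positive U U (r ℕ.+ j) (suc r))
    fold : ∀ r j → r ℕ.+ j ≡ n →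
           α r * (u j * u (j ℕ.+ suc (twice r))) ≈ foldᵒ (λ i j → u i * u j * U± i n) r j
    fold r j ≡.refl = begin
      (U r + U (suc r)) * (u j * v)
        ≈⟨ solve 4 (λ x y u v → (x :+ y) :* (u :* v) := u :* v :* x :+ v :* u :* y) refl _ _ _ _ ⟩
      u j * v * U r + v * u j * U (suc r)
        ≡⟨ ≡.cong₂ (λ x y → u j * v * x + v * u j * y) (≡.sym (U±-negative r j)) (≡.sym (U±-positive r j)) ⟩
      u j * v * U± j (r ℕ.+ j) + v * u j * U± (j ℕ.+ suc (twice r)) (r ℕ.+ j) ∎
      where v = u (j ℕ.+ suc (twice r))

  double-sum : ∀ n →
    anti n (λ k m → q ^ (k ℕ.* suc k) * u m *
      anti k (λ k m → q ^ (k ℕ.* suc k) * u m * (u (suc (twice k)) * poch (- q) (q ^ 2) k)))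
    ≈ anti n (λ r j → α″ r * (u j * u (j ℕ.+ suc (twice r))))
  double-sum n = begin
    _  ≈⟨ anti-cong n (λ k m → *-congˡ (anti-cong k (λ k m → *-congˡ (sym (bailey-α k))))) ⟩
    _  ≈⟨ anti-cong n (λ k m → *-congˡ (bailey-chain α k)) ⟩
    _  ≈⟨ bailey-chain _ n ⟩
    anti n (λ r j → α″ r * (u j * u (j ℕ.+ suc (twice r)))) ∎

-- Inequalities between real numbers

module RealInequalities {c ℓ₁ ℓ₂ ℓ₃} (R : RealNumbers c ℓ₁ ℓ₂ ℓ₃) where
  open RealNumbers R public
    using (Carrier; _≈_; _+_; _*_; -_; _-_; 0#; 1#; _<_; +-monoˡ-<; *-pos; #⇒invertible; _·_; archimedean; commutativeRing)
  open CommutativeRing commutativeRing public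
    using (refl; sym; trans; reflexive; +-cong; +-congˡ; +-congʳ; *-cong; *-congˡ; *-congʳ; -‿cong; +-comm; +-assoc;
           *-comm; *-assoc; +-identityˡ; +-identityʳ; *-identityˡ; *-identityʳ; zeroˡ; zeroʳ; distribˡ; semiring; setoid)
  open RealProperties R public
  open IntegerSolver commutativeRing public
  open Relation.Binary.Reasoning.Setoid setoid

  infix 4 _≤_
  -- The constructive weak order. It composes with `_<_` through cotransitivity, without deciding
  -- between strict inequality and equality.
  _≤_ : Carrier → Carrier → Set ℓ₃
  x ≤ y = ¬ (y < x)

  ≤-reflexive : ∀ {x y} → x ≈ y → x ≤ y
  ≤-reflexive x≈y = <-irrefl (sym x≈y)

  ≤-refl : ∀ {x} → x ≤ x
  ≤-refl = ≤-reflexive refl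

  <⇒≤ : ∀ {x y} → x < y → x ≤ y
  <⇒≤ x<y y<x = <-irrefl refl (<-trans x<y y<x)

  <-≤-trans : ∀ {x y z} → x < y → y ≤ z → x < z
  <-≤-trans {z = z} x<y y≤z with <-cotrans x<y z
  ... | inj₁ x<z = x<z
  ... | inj₂ z<y = ⊥-elim (y≤z z<y)

  ≤-<-trans : ∀ {x y z} → x ≤ y → y < z → x < z
  ≤-<-trans {x} x≤y y<z with <-cotrans y<z x
  ... | inj₁ y<x = ⊥-elim (x≤y y<x)
  ... | inj₂ x<z = x<z

  ≤-trans : ∀ {x y z} → x ≤ y → y ≤ z → x ≤ z
  ≤-trans x≤y y≤z z<x = y≤z (<-≤-trans z<x x≤y)

  ≤-respˡ : ∀ {x y z} → x ≈ y → x ≤ z → y ≤ z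
  ≤-respˡ x≈y x≤z = ≤-trans (≤-reflexive (sym x≈y)) x≤z

  ≤-respʳ : ∀ {x y z} → x ≈ y → z ≤ x → z ≤ y
  ≤-respʳ x≈y z≤x = ≤-trans z≤x (≤-reflexive x≈y)

  +-monoˡ-≤ : ∀ {x y} z → x ≤ y → x + z ≤ y + z
  +-monoˡ-≤ z x≤y y+z<x+z = x≤y (<-respˡ-≈ (cancel _ z) (<-respʳ-≈ (cancel _ z) (+-monoˡ-< (- z) y+z<x+z)))
    where
    cancel : ∀ x z → x + z - z ≈ x
    cancel = solve 2 (λ x z → x :+ z :- z := x) refl

  +-mono-≤ : ∀ {w x y z} → w ≤ x → y ≤ z → w + y ≤ x + z
  +-mono-≤ {x = x} {y} w≤x y≤z = ≤-trans (+-monoˡ-≤ y w≤x)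
    (≤-respˡ (+-comm _ _) (≤-respʳ (+-comm _ _) (+-monoˡ-≤ x y≤z)))

  x≤y⇒0≤y-x : ∀ {x y} → x ≤ y → 0# ≤ y - x
  x≤y⇒0≤y-x {x} x≤y = ≤-respˡ (solve 1 (λ x → x :- x := con (+ 0)) refl x) (+-monoˡ-≤ (- x) x≤y)

  0≤y-x⇒x≤y : ∀ {x y} → 0# ≤ y - x → x ≤ y
  0≤y-x⇒x≤y {x} {y} le = ≤-respˡ (+-identityˡ x)
    (≤-respʳ (solve 2 (λ x y → y :- x :+ x := y) refl x y) (+-monoˡ-≤ x le))

  -- If the product were negative, both factors would be apart from 0, and then their signs can be
  -- decided.
  *-nonneg : ∀ {x y} → 0# ≤ x → 0# ≤ y → 0# ≤ x * y
  *-nonneg 0≤x 0≤y xy<0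
    with #⇒<⊎> (xy#0⇒x#0 (<⇒# xy<0)) | #⇒<⊎> (xy#0⇒x#0 (<⇒# (<-respˡ-≈ (*-comm _ _) xy<0)))
  ... | inj₁ x<0 | _        = 0≤x x<0
  ... | inj₂ _   | inj₁ y<0 = 0≤y y<0
  ... | inj₂ 0<x | inj₂ 0<y = <⇒≤ (*-pos 0<x 0<y) xy<0

  *-monoʳ-≤ : ∀ {x y z} → 0# ≤ z → x ≤ y → z * x ≤ z * y
  *-monoʳ-≤ 0≤z x≤y = 0≤y-x⇒x≤y
    (≤-respʳ (solve 3 (λ x y z → z :* (y :- x) := z :* y :- z :* x) refl _ _ _) (*-nonneg 0≤z (x≤y⇒0≤y-x x≤y)))

  *-monoˡ-≤ : ∀ {x y z} → 0# ≤ z → x ≤ y → x * z ≤ y * z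
  *-monoˡ-≤ 0≤z x≤y = ≤-respˡ (*-comm _ _) (≤-respʳ (*-comm _ _) (*-monoʳ-≤ 0≤z x≤y))

  *-mono-≤ : ∀ {w x y z} → 0# ≤ w → 0# ≤ z → w ≤ x → y ≤ z → w * y ≤ x * z
  *-mono-≤ 0≤w 0≤z w≤x y≤z = ≤-trans (*-monoʳ-≤ 0≤w y≤z) (*-monoˡ-≤ 0≤z w≤x)

  *-monoʳ-< : ∀ {x y z} → 0# < z → x < y → z * x < z * y
  *-monoʳ-< 0<z x<y = 0<y-x⇒x<y
    (<-respʳ-≈ (solve 3 (λ x y z → z :* (y :- x) := z :* y :- z :* x) refl _ _ _) (*-pos 0<z (x<y⇒0<y-x x<y)))

  0≤1 : 0# ≤ 1#
  0≤1 = <⇒≤ 0<1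

  +-nonneg : ∀ {x y} → 0# ≤ x → 0# ≤ y → 0# ≤ x + y
  +-nonneg 0≤x 0≤y = ≤-respˡ (+-identityˡ 0#) (+-mono-≤ 0≤x 0≤y)

  x≤x+y : ∀ {x y} → 0# ≤ y → x ≤ x + y
  x≤x+y {x} 0≤y = ≤-respˡ (+-identityʳ x) (+-mono-≤ ≤-refl 0≤y)

  square-mono-< : ∀ {x y} → 0# ≤ x → x < y → x * x < y * y
  square-mono-< 0≤x x<y = ≤-<-trans (*-monoʳ-≤ 0≤x (<⇒≤ x<y))
    (<-respˡ-≈ (*-comm _ _) (*-monoʳ-< (≤-<-trans 0≤x x<y) x<y))

  square-cancel-≤ : ∀ {x y} → 0# ≤ y → x * x ≤ y * y → x ≤ y
  square-cancel-≤ 0≤y x²≤y² y<x = x²≤y² (square-mono-< 0≤y y<x)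

  0≤x² : ∀ x → 0# ≤ x * x
  0≤x² = x²≮0

  positive-cancel : ∀ {x y} → 0# < x → y * x ≈ 1# → 0# < y
  positive-cancel {x} {y} 0<x yx≈1 =
    [ (λ y<0 → ⊥-elim (<-irrefl refl (<-trans 0<1 (1<0 y<0)))) , id ]′
      (#⇒<⊎> (xy#0⇒x#0 (>⇒# (<-respʳ-≈ (sym yx≈1) 0<1))))
    where
    1<0 : y < 0# → 1# < 0#
    1<0 y<0 = 0<y-x⇒x<y (<-respʳ-≈ (trans (solve 2 (λ x y → :- y :* x := con (+ 0) :- y :* x) refl x y)
      (+-congˡ (-‿cong yx≈1))) (*-pos (x<0⇒0<-x y<0) 0<x))

  reciprocal : ∀ {x} → 0# < x → ∃ λ y → y * x ≈ 1#
  reciprocal {x} 0<x = from (#⇒invertible (>⇒# 0<x))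
    where
    from : (∃ λ y → (y * (x - 0#) ≈ 1#) × ((x - 0#) * y ≈ 1#)) → ∃ λ y → y * x ≈ 1#
    from (y , y[x-0]≈1 , _) =
      y , trans (solve 2 (λ x y → y :* x := y :* (x :- con (+ 0))) refl x y) y[x-0]≈1

-- Geometric decay

record Ratio {c ℓ₁ ℓ₂ ℓ₃} (R : RealNumbers c ℓ₁ ℓ₂ ℓ₃) : Set (c ⊔ ℓ₁ ⊔ ℓ₃) where
  open RealNumbers R
  field
    ρ κ      : Carrier
    0<ρ      : 0# < ρ
    ρ<1      : ρ < 1#
    κ[1-ρ]≈1 : κ * (1# - ρ) ≈ 1#

module GeometricDecay {c ℓ₁ ℓ₂ ℓ₃} (R : RealNumbers c ℓ₁ ℓ₂ ℓ₃) (ratio : Ratio R) where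
  open RealInequalities R
  open Ratio ratio
  open AntidiagonalSums commutativeRing
  open Pochhammer commutativeRing using (_^_) public
  open Relation.Binary.Reasoning.Setoid setoid

  0<κ : 0# < κ
  0<κ = positive-cancel (x<y⇒0<y-x ρ<1) κ[1-ρ]≈1

  1+κρ≈κ : 1# + κ * ρ ≈ κ
  1+κρ≈κ = trans (+-congʳ (sym κ[1-ρ]≈1))
    (solve 2 (λ k r → k :* (con (+ 1) :- r) :+ k :* r := k) refl κ ρ)

  0<ρ^ : ∀ n → 0# < ρ ^ n
  0<ρ^ zero    = 0<1
  0<ρ^ (suc n) = *-pos 0<ρ (0<ρ^ n)

  0≤ρ^ : ∀ n → 0# ≤ ρ ^ n
  0≤ρ^ n = <⇒≤ (0<ρ^ n)

  ρ^≤1 : ∀ n → ρ ^ n ≤ 1#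
  ρ^≤1 zero    = ≤-refl
  ρ^≤1 (suc n) = ≤-respʳ (*-identityˡ 1#) (*-mono-≤ (<⇒≤ 0<ρ) 0≤1 (<⇒≤ ρ<1) (ρ^≤1 n))

  ρ^-mono : ∀ {m n} → m ℕ.≤ n → ρ ^ n ≤ ρ ^ m
  ρ^-mono {n = n} ℕ.z≤n = ρ^≤1 n
  ρ^-mono (ℕ.s≤s m≤n)   = *-monoʳ-≤ (<⇒≤ 0<ρ) (ρ^-mono m≤n)

  -- A division-free form of Bernoulli's inequality for 1/ρ. The left-hand side decreases in n, by
  -- ρ^n (n+1)(1-ρ)² at each step.
  bernoulli : ∀ n → ρ ^ n * (1# + n · 1# * (1# - ρ)) ≤ 1#
  bernoulli zero    = ≤-reflexive (solve 1 (λ x → con (+ 1) :* (con (+ 1) :+ con (+ 0) :* x) := con (+ 1)) refl _)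
  bernoulli (suc n) = ≤-trans (0≤y-x⇒x≤y (≤-respʳ
      (solve 3 (λ r x y → x :* ((con (+ 1) :+ y) :* ((con (+ 1) :- r) :* (con (+ 1) :- r)))
       
            := x :* (con (+ 1) :+ y :* (con (+ 1) :- r)) :- r :* x :* (con (+ 1) :+ (con (+ 1) :+ y) :* (con (+ 1) :- r)))
        refl ρ (ρ ^ n) (n · 1#))
      (*-nonneg (0≤ρ^ n) (*-nonneg (+-nonneg 0≤1 (0≤· n)) (0≤x² _)))))
    (bernoulli n)
    where
    0≤· : ∀ n → 0# ≤ n · 1#
    0≤· zero    = ≤-refl
    0≤· (suc n) = +-nonneg 0≤1 (0≤· n)

  ρ^→0 : ∀ K ε → 0# ≤ K → 0# < ε → ∃ λ N → ∀ n → N ℕ.≤ n → K * ρ ^ n < ε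
  ρ^→0 K ε 0≤K 0<ε = N , λ n N≤n → ≤-<-trans (*-monoʳ-≤ 0≤K (ρ^-mono N≤n)) Kρ^N<ε
    where
    e = proj₁ (reciprocal 0<ε)
    eε≈1 = proj₂ (reciprocal 0<ε)
    -- N exceeds K/((1-ρ)ε). Multiplying by ρ^N (1-ρ)ε gives Kρ^N < ερ^N N(1-ρ), which `bernoulli`
    -- bounds by ε.
    N = proj₁ (archimedean (K * κ * e))
    Kκe<N = proj₂ (archimedean (K * κ * e))
    δ = 1# - ρ
    0<s : 0# < ρ ^ N * (δ * ε)
    0<s = *-pos (0<ρ^ N) (*-pos (x<y⇒0<y-x ρ<1) 0<ε)
    eq : ρ ^ N * (δ * ε) * (K * κ * e) ≈ K * ρ ^ N
    eq = begin
      ρ ^ N * (δ * ε) * (K * κ * e)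
        ≈⟨ solve 6 (λ x d s K k e → x :* (d :* s) :* (K :* k :* e) := K :* x :* ((k :* d) :* (e :* s)))
             refl (ρ ^ N) δ ε K κ e ⟩
      K * ρ ^ N * ((κ * δ) * (e * ε))
        ≈⟨ *-congˡ (trans (*-cong κ[1-ρ]≈1 eε≈1) (*-identityˡ 1#)) ⟩
      K * ρ ^ N * 1#
        ≈⟨ *-identityʳ _ ⟩
      K * ρ ^ N ∎
    Kρ^N<ε : K * ρ ^ N < ε
    Kρ^N<ε = <-≤-trans (<-respˡ-≈ eq (*-monoʳ-< 0<s Kκe<N))
      (≤-trans
        (≤-respʳ (solve 4 (λ x d s n → x :* (d :* s) :* n :+ s :* x := s :* (x :* (con (+ 1) :+ n :* d)))
            refl (ρ ^ N) δ ε (N · 1#))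
          (x≤x+y (*-nonneg (<⇒≤ 0<ε) (0≤ρ^ N))))
        (≤-respʳ (*-identityʳ ε) (*-monoʳ-≤ (<⇒≤ 0<ε) (bernoulli N))))

  geometric-sum : ∀ n → anti n (λ i _ → ρ ^ i) + κ * ρ ^ suc n ≈ κ
  geometric-sum zero    = trans (+-congˡ (*-congˡ (*-identityʳ ρ))) 1+κρ≈κ
  geometric-sum (suc n) = begin
    anti (suc n) (λ i _ → ρ ^ i) + κ * (ρ * ρ ^ suc n)
      ≈⟨ +-congʳ (anti-last n (λ i _ → ρ ^ i)) ⟩
    anti n (λ i _ → ρ ^ i) + ρ ^ suc n + κ * (ρ * ρ ^ suc n)
      ≈⟨ solve 4 (λ a x k r → a :+ x :+ k :* (r :* x) := a :+ (con (+ 1) :+ k :* r) :* x) refl _ _ _ _ ⟩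
    anti n (λ i _ → ρ ^ i) + (1# + κ * ρ) * ρ ^ suc n
      ≈⟨ +-congˡ (*-congʳ 1+κρ≈κ) ⟩
    anti n (λ i _ → ρ ^ i) + κ * ρ ^ suc n
      ≈⟨ geometric-sum n ⟩
    κ ∎

  geometric-sum≤κ : ∀ n → anti n (λ i _ → ρ ^ i) ≤ κ
  geometric-sum≤κ n = ≤-respʳ (geometric-sum n) (x≤x+y (*-nonneg (<⇒≤ 0<κ) (0≤ρ^ (suc n))))

  -- The product of the 1 + Kρ^j for j < m, which dominates both the finite products (z;p)_m and the
  -- reciprocals 1/(p)_m.
  majorant : Carrier → ℕ → Carrier
  majorant K zero    = 1#
  majorant K (suc m) = majorant K m * (1# + K * ρ ^ m)

  -- Once Eρʲ ≤ 1 with E = 2K/(1-ρ), the product majorant j * (1 + Eρʲ) decreases.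
  majorant-bounded : ∀ K → 0# ≤ K → ∃ λ B → ∀ m → majorant K m ≤ B
  majorant-bounded K 0≤K = from (ρ^→0 ((K + K) * κ) 1# (*-nonneg (+-nonneg 0≤K 0≤K) (<⇒≤ 0<κ)) 0<1)
   where
   from : (∃ λ N → ∀ n → N ℕ.≤ n → (K + K) * κ * ρ ^ n < 1#) → ∃ λ B → ∀ m → majorant K m ≤ B
   from (N , Eρ<1) = majorant K N * φ N , λ m → ≤-trans (mono m) (≤-trans (≤-φ m) (decreasing m))
    where
    E = (K + K) * κ
    0≤E : 0# ≤ E
    0≤E = *-nonneg (+-nonneg 0≤K 0≤K) (<⇒≤ 0<κ)
    φ : ℕ → Carrier
    φ j = 1# + E * ρ ^ j
    0≤Kρ^ : ∀ m → 0# ≤ K * ρ ^ m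
    0≤Kρ^ m = *-nonneg 0≤K (0≤ρ^ m)
    0≤majorant : ∀ m → 0# ≤ majorant K m
    0≤majorant zero    = 0≤1
    0≤majorant (suc m) = *-nonneg (0≤majorant m) (+-nonneg 0≤1 (0≤Kρ^ m))
    grow : ∀ {x y} → 0# ≤ x → 0# ≤ y → x ≤ x * (1# + y)
    grow {x} 0≤x 0≤y = ≤-respˡ (*-identityʳ x) (*-monoʳ-≤ 0≤x (x≤x+y 0≤y))
    mono : ∀ m → majorant K m ≤ majorant K (m ℕ.+ N)
    mono m = go N
      where
      go : ∀ i → majorant K m ≤ majorant K (m ℕ.+ i)
      go zero    = ≤-reflexive (reflexive (≡.cong (majorant K) (≡.sym (ℕ.+-identityʳ m))))
      go (suc i) = ≤-trans (go i) (≤-respʳ (reflexive (≡.cong (majorant K) (≡.sym (ℕ.+-suc m i))))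
        (grow (0≤majorant (m ℕ.+ i)) (0≤Kρ^ (m ℕ.+ i))))
    ≤-φ : ∀ m → majorant K (m ℕ.+ N) ≤ majorant K (m ℕ.+ N) * φ (m ℕ.+ N)
    ≤-φ m = grow (0≤majorant (m ℕ.+ N)) (*-nonneg 0≤E (0≤ρ^ (m ℕ.+ N)))
    -- Since E(1-ρ) = 2K, the right side exceeds the left by Kρ^j (1 - Eρ^{j+1}).
    factor : ∀ j → N ℕ.≤ suc j → (1# + K * ρ ^ j) * φ (suc j) ≤ φ j
    factor j N≤j = 0≤y-x⇒x≤y (≤-respʳ eq
      (*-nonneg (0≤Kρ^ j) (x≤y⇒0≤y-x (<⇒≤ (Eρ<1 (suc j) N≤j)))))
      where
      eq : K * ρ ^ j * (1# - E * ρ ^ suc j) ≈ φ j - (1# + K * ρ ^ j) * φ (suc j)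
      eq = begin
        K * ρ ^ j * (1# - E * ρ ^ suc j)
          ≈⟨ solve 4 (λ K x s r → K :* x :* (con (+ 1) :- s)
              := (K :+ K) :* con (+ 1) :* x :- K :* x :- K :* x :* s)
               refl K (ρ ^ j) (E * ρ ^ suc j) ρ ⟩
        (K + K) * 1# * ρ ^ j - K * ρ ^ j - K * ρ ^ j * (E * ρ ^ suc j)
          ≈⟨ +-congʳ (+-congʳ (*-congʳ (*-congˡ (sym κ[1-ρ]≈1)))) ⟩
        (K + K) * (κ * (1# - ρ)) * ρ ^ j - K * ρ ^ j - K * ρ ^ j * (E * ρ ^ suc j)
          ≈⟨ solve 4 (λ K k r x → (K :+ K) :* (k :* (con (+ 1) :- r)) :* x :- K :* x :- K :* x :* ((K :+ K) :* k :* (r :* x))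
              
                   := con (+ 1) :+ (K :+ K) :* k :* x :- (con (+ 1) :+ K :* x) :* (con (+ 1) :+ (K :+ K) :* k :* (r :* x)))
               refl K κ ρ (ρ ^ j) ⟩
        φ j - (1# + K * ρ ^ j) * φ (suc j) ∎
    decreasing : ∀ m → majorant K (m ℕ.+ N) * φ (m ℕ.+ N) ≤ majorant K N * φ N
    decreasing zero    = ≤-refl
    decreasing (suc m) = ≤-trans
      (≤-respˡ (sym (*-assoc _ _ _))
        (*-monoʳ-≤ (0≤majorant (m ℕ.+ N)) (factor (m ℕ.+ N) (ℕ.≤-trans (ℕ.m≤n+m N m) (ℕ.n≤1+n _)))))
      (decreasing m)

-- Finite sets of pairs

module UniqueLists {a} {A : Set a} where
  -- Each membership proof locates an element of xs inside ys, from where it is moved to the front;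
  -- no elements have to be compared.
  ⊆-complement : ∀ {xs ys : List A} → Unique xs → xs ⊆ ys → ∃ λ zs → ys ↭ xs ++ zs
  ⊆-complement {[]}     {ys} _          _     = ys , ↭.refl
  ⊆-complement {x ∷ xs} {ys} (x∉xs ∷ u) xs⊆ys with ∈-∃++ (xs⊆ys (here ≡.refl))
  ... | as , bs , ≡.refl with ⊆-complement u xs⊆
    where
    xs⊆ : xs ⊆ as ++ bs
    xs⊆ z∈xs with ↭ₚ.∈-resp-↭ (↭ₚ.shift x as bs) (xs⊆ys (there z∈xs))
    ... | here ≡.refl = ⊥-elim (All.lookup x∉xs z∈xs ≡.refl)
    ... | there z∈    = z∈
  ... | zs , p = zs , ↭.trans (↭ₚ.shift x as bs) (↭.prep x p)

  Unique-++⁻ : ∀ (xs : List A) {ys} → Unique (xs ++ ys) → Unique ys × (∀ {z} → z ∈ ys → z ∉ xs)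
  Unique-++⁻ []       u          = u , λ _ ()
  Unique-++⁻ (x ∷ xs) (x∉ ∷ u) with Unique-++⁻ xs u
  ... | uys , disjoint = uys , λ
    { z∈ys (here ≡.refl) → All.lookup x∉ (∈-++⁺ʳ xs z∈ys) ≡.refl
    ; z∈ys (there z∈xs)  → disjoint z∈ys z∈xs }

  Unique-resp-↭ : ∀ {xs ys : List A} → xs ↭ ys → Unique xs → Unique ys
  Unique-resp-↭ p = ↭ₛ.Unique-resp-↭ (≡.setoid A) (↭⇒↭ₛ p)

-- Listed in the order of the recursion of `anti`, so that list sums over it turn into antidiagonal
-- sums.
diagonal : ℕ → List (ℕ × ℕ)
diagonal zero    = (0 , 0) ∷ []
diagonal (suc n) = (0 , suc n) ∷ map (map₁ suc) (diagonal n)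

triangle : ℕ → List (ℕ × ℕ)
triangle zero    = diagonal 0
triangle (suc n) = diagonal (suc n) ++ triangle n

∈-diagonal⁺ : ∀ i j → (i , j) ∈ diagonal (i ℕ.+ j)
∈-diagonal⁺ zero    zero    = here ≡.refl
∈-diagonal⁺ zero    (suc j) = here ≡.refl
∈-diagonal⁺ (suc i) j       = there (∈-map⁺ (map₁ suc) (∈-diagonal⁺ i j))

∈-diagonal⁻ : ∀ n {i j} → (i , j) ∈ diagonal n → i ℕ.+ j ≡ n
∈-diagonal⁻ zero    (here ≡.refl) = ≡.refl
∈-diagonal⁻ (suc n) (here ≡.refl) = ≡.refl
∈-diagonal⁻ (suc n) (there p) with ∈-map⁻ (map₁ suc) p
... | _ , q , ≡.refl = ≡.cong suc (∈-diagonal⁻ n q)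

diagonal-unique : ∀ n → Unique (diagonal n)
diagonal-unique zero    = [] ∷ []
diagonal-unique (suc n) = All.tabulate distinct ∷ Unique.map⁺ (λ { ≡.refl → ≡.refl }) (diagonal-unique n)
  where
  distinct : ∀ {p} → p ∈ map (map₁ suc) (diagonal n) → (0 , suc n) ≡.≢ p
  distinct p∈ ≡.refl with ∈-map⁻ (map₁ suc) p∈
  ... | _ , _ , ()

∈-triangle⁻ : ∀ n {i j} → (i , j) ∈ triangle n → i ℕ.+ j ℕ.≤ n
∈-triangle⁻ zero    p = ℕ.≤-reflexive (∈-diagonal⁻ 0 p)
∈-triangle⁻ (suc n) p with ∈-++⁻ (diagonal (suc n)) p
... | inj₁ q = ℕ.≤-reflexive (∈-diagonal⁻ (suc n) q)
... | inj₂ q = ℕ.m≤n⇒m≤1+n (∈-triangle⁻ n q)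

∈-triangle⁺ : ∀ n {i j} → i ℕ.+ j ℕ.≤ n → (i , j) ∈ triangle n
∈-triangle⁺ zero    {zero} {zero} _ = here ≡.refl
∈-triangle⁺ (suc n) {i} {j} le with ℕ.m≤n⇒m<n∨m≡n le
... | inj₁ lt = ∈-++⁺ʳ (diagonal (suc n)) (∈-triangle⁺ n (ℕ.≤-pred lt))
... | inj₂ eq = ∈-++⁺ˡ (≡.subst (λ k → (i , j) ∈ diagonal k) eq (∈-diagonal⁺ i j))

triangle-unique : ∀ n → Unique (triangle n)
triangle-unique zero    = diagonal-unique 0
triangle-unique (suc n) = Unique.++⁺ (diagonal-unique (suc n)) (triangle-unique n)
  (λ { (p∈d , p∈t) → ℕ.<-irrefl (∈-diagonal⁻ (suc n) p∈d) (ℕ.s≤s (∈-triangle⁻ n p∈t)) })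

-- Lets a sum of nonnegative terms over an arbitrary list without repetitions be bounded by one over
-- a triangle.
⊆-triangle : ∀ (F : List (ℕ × ℕ)) → ∃ λ n → F ⊆ triangle n
⊆-triangle []            = 0 , λ ()
⊆-triangle ((i , j) ∷ F) with ⊆-triangle F
... | n , F⊆ = (i ℕ.+ j) ℕ.+ n , λ
  { (here ≡.refl) → ∈-triangle⁺ _ (ℕ.m≤m+n (i ℕ.+ j) n)
  ; (there p)     → ∈-triangle⁺ _ (ℕ.≤-trans (∈-triangle⁻ n (F⊆ p)) (ℕ.m≤n+m n (i ℕ.+ j))) }

-- Sums over lists

module ListSums {c ℓ} (R : CommutativeRing c ℓ) where
  open CommutativeRing R
  open IntegerSolver R
  open AntidiagonalSums R
  open Relation.Binary.Reasoning.Setoid setoid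

  sum : {I : Set} → List I → (I → Carrier) → Carrier
  sum F t = foldr _+_ 0# (map t F)

  sum-cong : {I : Set} (F : List I) {s t : I → Carrier} → (∀ x → s x ≈ t x) → sum F s ≈ sum F t
  sum-cong []      s≈t = refl
  sum-cong (x ∷ F) s≈t = +-cong (s≈t x) (sum-cong F s≈t)

  sum-++ : {I : Set} (F G : List I) (t : I → Carrier) → sum (F ++ G) t ≈ sum F t + sum G t
  sum-++ []      G t = sym (+-identityˡ _)
  sum-++ (x ∷ F) G t = trans (+-congˡ (sum-++ F G t)) (sym (+-assoc _ _ _))

  sum-↭ : {I : Set} {F G : List I} (t : I → Carrier) → F ↭ G → sum F t ≈ sum G t
  sum-↭ t ↭.refl         = refl
  sum-↭ t (↭.prep x p)   = +-congˡ (sum-↭ t p)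
  sum-↭ t (↭.swap x y p) = trans (+-congˡ (+-congˡ (sum-↭ t p)))
    (solve 3 (λ x y z → x :+ (y :+ z) := y :+ (x :+ z)) refl _ _ _)
  sum-↭ t (↭.trans p q)  = trans (sum-↭ t p) (sum-↭ t q)

  sum-diagonal : ∀ n t → sum (diagonal n) t ≈ anti n (λ i j → t (i , j))
  sum-diagonal zero    t = +-identityʳ _
  sum-diagonal (suc n) t = +-congˡ (trans (sum-map (diagonal n)) (sum-diagonal n (λ p → t (map₁ suc p))))
    where
    sum-map : ∀ F → sum (map (map₁ suc) F) t ≈ sum F (λ p → t (map₁ suc p))
    sum-map []      = refl
    sum-map (x ∷ F) = +-congˡ (sum-map F)

  sum-triangle : ∀ n t → sum (triangle n) t ≈ anti n (λ k _ → anti k (λ i j → t (i , j)))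
  sum-triangle zero    t = sum-diagonal 0 t
  sum-triangle (suc n) t = begin
    sum (diagonal (suc n) ++ triangle n) t
      ≈⟨ sum-++ (diagonal (suc n)) (triangle n) t ⟩
    sum (diagonal (suc n)) t + sum (triangle n) t
      ≈⟨ +-cong (sum-diagonal (suc n) t) (sum-triangle n t) ⟩
    anti (suc n) (λ i j → t (i , j)) + anti n (λ k _ → anti k (λ i j → t (i , j)))
      ≈⟨ +-comm _ _ ⟩
    anti n (λ k _ → anti k (λ i j → t (i , j))) + anti (suc n) (λ i j → t (i , j))
      ≈⟨ anti-last n (λ k _ → anti k (λ i j → t (i , j))) ⟨
    anti (suc n) (λ k _ → anti k (λ i j → t (i , j))) ∎

-- Limits approached at a geometric rate

-- z ≼ s stands for |z| ≤ s, which avoids the square root in |z|.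
record BoundedRing {c ℓ₁ ℓ₂ ℓ₃} (R : RealNumbers c ℓ₁ ℓ₂ ℓ₃) a ℓ : Set (c ⊔ ℓ₁ ⊔ lsuc (a ⊔ ℓ ⊔ ℓ₃)) where
  private
    module ℝ = RealInequalities R
  open Pochhammer ℝ.commutativeRing using () renaming (_^_ to _^ℝ_)
  infix 4 _≼_
  field
    commutativeRing : CommutativeRing a ℓ
  open CommutativeRing commutativeRing
  field
    _≼_       : Carrier → ℝ.Carrier → Set ℓ₃
    ≼⇒0≤      : ∀ {z s} → z ≼ s → ℝ.0# ℝ.≤ s
    ≼-resp    : ∀ {z w s} → z ≈ w → z ≼ s → w ≼ s
    ≼-mono    : ∀ {z s t} → s ℝ.≤ t → z ≼ s → z ≼ t
    ≼-bound   : ∀ z → ∃ λ s → z ≼ s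
    0≼0       : 0# ≼ ℝ.0#
    1≼1       : 1# ≼ ℝ.1#
    ≼-+       : ∀ {z w s t} → z ≼ s → w ≼ t → z + w ≼ s ℝ.+ t
    ≼-*       : ∀ {z w s t} → z ≼ s → w ≼ t → z * w ≼ s ℝ.* t
    ≼-neg     : ∀ {z s} → z ≼ s → - z ≼ s
    ≼-inverse : ∀ {z v s κ} → z ≼ s → s ℝ.< ℝ.1# → κ ℝ.* (ℝ.1# ℝ.- s) ℝ.≈ ℝ.1# → (1# - z) * v ≈ 1# → v ≼ κ
    separated : ∀ {z} → (∀ ε → ℝ.0# ℝ.< ε → z ≼ ε) → z ≈ 0#
    complete  : ∀ (ratio : Ratio R) (f : ℕ → Carrier) K → ℝ.0# ℝ.≤ K →
                (∀ n → f (suc n) - f n ≼ K ℝ.* Ratio.ρ ratio ^ℝ n) →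
                ∃ λ L → ∃ λ K′ → (ℝ.0# ℝ.≤ K′) × (∀ n → f n - L ≼ K′ ℝ.* Ratio.ρ ratio ^ℝ n)

module GeometricLimits {c ℓ₁ ℓ₂ ℓ₃ a ℓ} (R : RealNumbers c ℓ₁ ℓ₂ ℓ₃) (A : BoundedRing R a ℓ)
  (ratio : Ratio R) where
  open RealInequalities R using (_≤_; _<_)
    renaming (Carrier to ℝ; _≈_ to _≈ℝ_; _*_ to _*ℝ_; _+_ to _+ℝ_; _-_ to _-ℝ_; 0# to 0ℝ; 1# to 1ℝ)
  open Ratio ratio
  module ℝ = RealInequalities R
  module G = GeometricDecay R ratio
  module ∑ℝ = AntidiagonalSums ℝ.commutativeRing
  open G using () renaming (_^_ to _^ℝ_)
  open BoundedRing A
  open CommutativeRing commutativeRing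
  open IntegerSolver commutativeRing
  open AntidiagonalSums commutativeRing
  open Pochhammer commutativeRing
  open Algebra.Properties.Semiring.Exp semiring using (^-homo-*; ^-congˡ; ^-congʳ)
  open Relation.Binary.Reasoning.Setoid setoid

  Bounded : (ℕ → Carrier) → Set _
  Bounded f = ∃ λ B → ∀ n → f n ≼ B

  infix 4 _⟶_
  -- The ratio is fixed once and only K varies, so sums and products of convergent sequences stay in
  -- the class.
  _⟶_ : (ℕ → Carrier) → Carrier → Set _
  f ⟶ L = ∃ λ K → (0ℝ ≤ K) × (∀ n → f n - L ≼ K *ℝ ρ ^ℝ n)

  0≤κ : 0ℝ ≤ κ
  0≤κ = ℝ.<⇒≤ G.0<κ

  ⟶-const : ∀ x → (λ _ → x) ⟶ x
  ⟶-const x = 0ℝ , ℝ.≤-refl , λ n →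
    ≼-mono (ℝ.≤-reflexive (ℝ.sym (ℝ.zeroˡ _))) (≼-resp (sym (-‿inverseʳ x)) 0≼0)

  ⟶-resp : ∀ {f g L M} → (∀ n → f n ≈ g n) → L ≈ M → f ⟶ L → g ⟶ M
  ⟶-resp f≈g L≈M (K , 0≤K , f⟶L) = K , 0≤K , λ n → ≼-resp (+-cong (f≈g n) (-‿cong L≈M)) (f⟶L n)

  ⟶-+ : ∀ {f g L M} → f ⟶ L → g ⟶ M → (λ n → f n + g n) ⟶ L + M
  ⟶-+ {f} {g} {L} {M} (K , 0≤K , f⟶L) (K′ , 0≤K′ , g⟶M) = K +ℝ K′ , ℝ.+-nonneg 0≤K 0≤K′ , λ n →
    ≼-mono (ℝ.≤-reflexive (ℝ.solve 3 (λ x y z → (x ℝ.:* z) ℝ.:+ (y ℝ.:* z)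
        ℝ.:= (x ℝ.:+ y) ℝ.:* z) ℝ.refl K K′ (ρ ^ℝ n)))
      (≼-resp (solve 4 (λ f g l m → (f :- l) :+ (g :- m) := (f :+ g) :- (l :+ m)) refl (f n) (g n) L M)
        (≼-+ (f⟶L n) (g⟶M n)))

  ⟶⇒Bounded : ∀ {f L} → f ⟶ L → Bounded f
  ⟶⇒Bounded {f} {L} (K , 0≤K , f⟶L) = K *ℝ 1ℝ +ℝ proj₁ (≼-bound L) , λ n →
    ≼-resp (solve 2 (λ f l → (f :- l) :+ l := f) refl (f n) L)
      (≼-+ (≼-mono (ℝ.*-monoʳ-≤ 0≤K (G.ρ^≤1 n)) (f⟶L n)) (proj₂ (≼-bound L)))

  ⟶-* : ∀ {f g L M} → f ⟶ L → g ⟶ M → (λ n → f n * g n) ⟶ L * M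
  ⟶-* {f} {g} {L} {M} f⟶L@(K , 0≤K , f-L) g⟶M@(K′ , 0≤K′ , g-M) =
    K *ℝ B +ℝ S *ℝ K′ ,
    ℝ.+-nonneg (ℝ.*-nonneg 0≤K (≼⇒0≤ (g≼B 0))) (ℝ.*-nonneg (≼⇒0≤ L≼S) 0≤K′) , λ n →
    ≼-mono (ℝ.≤-reflexive (ℝ.solve 5 (λ k r b s m → (k ℝ.:* r) ℝ.:* b ℝ.:+ s ℝ.:* (m ℝ.:* r)
        ℝ.:= (k ℝ.:* b ℝ.:+ s ℝ.:* m) ℝ.:* r)
        ℝ.refl K (ρ ^ℝ n) B S K′))
      (≼-resp (solve 4 (λ f g l m → (f :- l) :* g :+ l :* (g :- m) := f :* g :- l :* m) refl (f n) (g n) L M)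
        (≼-+ (≼-* (f-L n) (g≼B n)) (≼-* L≼S (g-M n))))
    where
    B = proj₁ (⟶⇒Bounded g⟶M)
    g≼B = proj₂ (⟶⇒Bounded g⟶M)
    S = proj₁ (≼-bound L)
    L≼S = proj₂ (≼-bound L)

  ⟶-twice : ∀ {f L} → f ⟶ L → (λ n → f (twice n)) ⟶ L
  ⟶-twice (K , 0≤K , f⟶L) = K , 0≤K , λ n → ≼-mono (ℝ.*-monoʳ-≤ 0≤K (G.ρ^-mono (n≤twice n))) (f⟶L (twice n))
    where
    n≤twice : ∀ n → n ℕ.≤ twice n
    n≤twice n = ≡.subst (n ℕ.≤_) (≡.sym (twice≡+ n)) (ℕ.m≤m+n n n)

  ⟶-unique : ∀ {f L M} → f ⟶ L → f ⟶ M → L ≈ M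
  ⟶-unique {f} {L} {M} (K , 0≤K , f⟶L) (K′ , 0≤K′ , f⟶M) = begin
    L              ≈⟨ solve 2 (λ l m → l := (l :- m) :+ m) refl L M ⟩
    L - M + M      ≈⟨ +-congʳ (separated small) ⟩
    0# + M         ≈⟨ +-identityˡ M ⟩
    M              ∎
    where
    L-M≼ : ∀ n → L - M ≼ (K′ +ℝ K) *ℝ ρ ^ℝ n
    L-M≼ n = ≼-mono (ℝ.≤-reflexive (ℝ.solve 3 (λ x y z → (x ℝ.:* z) ℝ.:+ (y ℝ.:* z)
        ℝ.:= (x ℝ.:+ y) ℝ.:* z) ℝ.refl K′ K (ρ ^ℝ n)))
      (≼-resp (solve 3 (λ f l m → (f :- m) :+ :- (f :- l) := l :- m) refl (f n) L M) (≼-+ (f⟶M n) (≼-neg (f⟶L n))))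
    small : ∀ ε → 0ℝ < ε → L - M ≼ ε
    small ε 0<ε = from (G.ρ^→0 (K′ +ℝ K) ε (ℝ.+-nonneg 0≤K′ 0≤K) 0<ε)
      where
      from : (∃ λ N → ∀ n → N ℕ.≤ n → (K′ +ℝ K) *ℝ ρ ^ℝ n < ε) → L - M ≼ ε
      from (N , lt) = ≼-mono (ℝ.<⇒≤ (lt N ℕ.≤-refl)) (L-M≼ N)

  anti-≼ : ∀ n {F : ℕ → ℕ → Carrier} {g : ℕ → ℕ → ℝ} →
           (∀ i j → i ℕ.+ j ≡ n → F i j ≼ g i j) → anti n F ≼ ∑ℝ.anti n g
  anti-≼ zero    F≼g = F≼g 0 0 ≡.refl
  anti-≼ (suc n) F≼g = ≼-+ (F≼g 0 (suc n) ≡.refl) (anti-≼ n (λ i j eq → F≼g (suc i) j (≡.cong suc eq)))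

  ^-≼ : ∀ {z} → z ≼ ρ → ∀ n → z ^ n ≼ ρ ^ℝ n
  ^-≼ z≼ρ zero    = 1≼1
  ^-≼ z≼ρ (suc n) = ≼-* z≼ρ (^-≼ z≼ρ n)

  ^-≼-mono : ∀ {z m n} → z ≼ ρ → m ℕ.≤ n → z ^ n ≼ ρ ^ℝ m
  ^-≼-mono {n = n} z≼ρ m≤n = ≼-mono (G.ρ^-mono m≤n) (^-≼ z≼ρ n)

  ^-≼1 : ∀ {z} → z ≼ ρ → ∀ n → z ^ n ≼ 1ℝ
  ^-≼1 z≼ρ n = ^-≼-mono {n = n} z≼ρ ℕ.z≤n

  ρ^+ : ∀ m n → ρ ^ℝ (m ℕ.+ n) ℝ.≈ ρ ^ℝ m *ℝ ρ ^ℝ n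
  ρ^+ = Algebra.Properties.Semiring.Exp.^-homo-* ℝ.semiring ρ

  -- The error is at most BK times the sum of ρ^{2i+j} over i + j = n. One factor ρ^i joins ρ^j to
  -- give the rate ρ^n, the other sums to at most κ; this is why f must decay like ρ^{2i}.
  tannery : ∀ (f : ℕ → Carrier) (w : ℕ → ℕ → Carrier) L {B K} → 0ℝ ≤ K →
            (∀ n → f n ≼ B *ℝ ρ ^ℝ (n ℕ.+ n)) → (∀ i j → w i j - L ≼ K *ℝ ρ ^ℝ j) →
            (λ n → anti n (λ i j → f i * w i j) - L * anti n (λ i _ → f i)) ⟶ 0#
  tannery f w L {B} {K} 0≤K f≼ w-L≼ = (B *ℝ K) *ℝ κ , ℝ.*-nonneg 0≤BK 0≤κ , λ n →
    ≼-mono (bound n) (≼-resp (difference n) (anti-≼ n (λ i j _ → ≼-* (f≼ i) (w-L≼ i j))))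
    where
    0≤B : 0ℝ ≤ B
    0≤B = ℝ.≤-respʳ (ℝ.*-identityʳ B) (≼⇒0≤ (f≼ 0))
    0≤BK : 0ℝ ≤ B *ℝ K
    0≤BK = ℝ.*-nonneg 0≤B 0≤K
    difference : ∀ n → anti n (λ i j → f i * (w i j - L))
                     ≈ (anti n (λ i j → f i * w i j) - L * anti n (λ i _ → f i)) - 0#
    difference n = begin
      anti n (λ i j → f i * (w i j - L))
        ≈⟨ anti-cong n (λ i j → solve 3 (λ f w l → f :* (w :- l) := f :* w :+ :- l :* f) refl (f i) (w i j) L) ⟩
      anti n (λ i j → f i * w i j + - L * f i)
        ≈⟨ anti-+ n (λ i j → f i * w i j) (λ i _ → - L * f i) ⟩
      anti n (λ i j → f i * w i j) + anti n (λ i _ → - L * f i)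
        ≈⟨ +-congˡ (anti-*ˡ n (- L) (λ i _ → f i)) ⟩
      anti n (λ i j → f i * w i j) + - L * anti n (λ i _ → f i)
        ≈⟨ solve 3 (λ x l y → x :+ :- l :* y := (x :- l :* y) :- con (+ 0)) refl _ L _ ⟩
      (anti n (λ i j → f i * w i j) - L * anti n (λ i _ → f i)) - 0# ∎
    rearrange : ∀ n i j → i ℕ.+ j ≡ n → (B *ℝ ρ ^ℝ (i ℕ.+ i)) *ℝ (K *ℝ ρ ^ℝ j) ℝ.≈ ((B *ℝ K) *ℝ ρ ^ℝ n) *ℝ ρ ^ℝ i
    rearrange n i j ≡.refl = ℝ.trans
      (ℝ.*-congʳ (ℝ.*-congˡ (ρ^+ i i)))
      (ℝ.trans
        (ℝ.solve 4 (λ b k x y → (b ℝ.:* (x ℝ.:* x)) ℝ.:* (k ℝ.:* y) ℝ.:= ((b ℝ.:* k) ℝ.:* (x ℝ.:* y)) ℝ.:* x)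
          ℝ.refl B K (ρ ^ℝ i) (ρ ^ℝ j))
        (ℝ.*-congʳ (ℝ.*-congˡ (ℝ.sym (ρ^+ i j)))))
    bound : ∀ n → ∑ℝ.anti n (λ i j → (B *ℝ ρ ^ℝ (i ℕ.+ i)) *ℝ (K *ℝ ρ ^ℝ j)) ≤ ((B *ℝ K) *ℝ κ) *ℝ ρ ^ℝ n
    bound n = ℝ.≤-respˡ (ℝ.sym (ℝ.trans (∑ℝ.anti-cong-≡ n (rearrange n)) (∑ℝ.anti-*ˡ n _ (λ i _ → ρ ^ℝ i))))
      (ℝ.≤-respʳ (ℝ.solve 3 (λ x y z → (x ℝ.:* y) ℝ.:* z ℝ.:= (x ℝ.:* z) ℝ.:* y) ℝ.refl (B *ℝ K) (ρ ^ℝ n) κ)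
        (ℝ.*-monoʳ-≤ (ℝ.*-nonneg 0≤BK (G.0≤ρ^ n)) (G.geometric-sum≤κ n)))

  private
    Cauchy⇒⟶ : ∀ f K → 0ℝ ≤ K → (∀ n → f (suc n) - f n ≼ K *ℝ ρ ^ℝ n) → ∃ λ L → f ⟶ L
    Cauchy⇒⟶ = complete ratio

  module InfiniteProduct (z p : Carrier) (p≼ρ : p ≼ ρ) where
    private
      S = proj₁ (≼-bound z)
      z≼S = proj₂ (≼-bound z)
      0≤S = ≼⇒0≤ z≼S

    poch-bounded : Bounded (poch z p)
    poch-bounded = proj₁ (G.majorant-bounded S 0≤S) , λ n → ≼-mono (proj₂ (G.majorant-bounded S 0≤S) n) (poch≼ n)
      where
      poch≼ : ∀ n → poch z p n ≼ G.majorant S n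
      poch≼ zero    = 1≼1
      poch≼ (suc n) = ≼-* (poch≼ n) (≼-+ 1≼1 (≼-neg (≼-* z≼S (^-≼ p≼ρ n))))

    private
      B = proj₁ poch-bounded
      poch≼B = proj₂ poch-bounded

    poch-converges : ∃ λ L → poch z p ⟶ L
    poch-converges = Cauchy⇒⟶ (poch z p) (B *ℝ S) (ℝ.*-nonneg (≼⇒0≤ (poch≼B 0)) 0≤S) λ n →
      ≼-mono (ℝ.≤-reflexive (ℝ.sym (ℝ.*-assoc _ _ _)))
        (≼-resp (solve 2 (λ x y → x :* :- y := x :* (con (+ 1) :- y) :- x) refl _ _)
          (≼-* (poch≼B n) (≼-neg (≼-* z≼S (^-≼ p≼ρ n)))))

  -- The reciprocals 1/(p)_n and their limit

  module Reciprocals (p : Carrier) (p≼ρ : p ≼ ρ) (u : ℕ → Carrier) (poch*u≈1 : Reciprocal p u) where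
    open QSeries commutativeRing p u poch*u≈1 using (u-suc; u-zero)

    private
      -- The quotient of consecutive reciprocals, 1/(1 - p^{n+1}).
      v : ℕ → Carrier
      v n = u (suc n) * poch p p n

      v-inverse : ∀ n → (1# - p ^ suc n) * v n ≈ 1#
      v-inverse n = trans (solve 3 (λ x y z → x :* (y :* z) := (z :* x) :* y) refl _ _ _) (poch*u≈1 (suc n))

      -- From 1/(1-x) = 1 + x/(1-x) with |x| ≤ ρ^{n+1} ≤ ρ. The uniform bound κ alone would not keep
      -- the product of these factors bounded.
      v≼ : ∀ n → v n ≼ 1ℝ +ℝ κ *ℝ ρ ^ℝ n
      v≼ n = ≼-resp eq (≼-+ 1≼1 (≼-mono (ℝ.*-monoʳ-≤ 0≤κ (G.ρ^-mono (ℕ.n≤1+n n))) (≼-* v≼κ (^-≼ p≼ρ (suc n)))))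
        where
        v≼κ : v n ≼ κ
        v≼κ = ≼-inverse (≼-mono (ℝ.≤-reflexive (ℝ.*-identityʳ ρ)) (^-≼-mono {n = suc n} p≼ρ (ℕ.s≤s ℕ.z≤n)))
          ρ<1 κ[1-ρ]≈1 (v-inverse n)
        eq : 1# + v n * p ^ suc n ≈ v n
        eq = trans (+-congʳ (sym (v-inverse n)))
          (solve 2 (λ v x → (con (+ 1) :- x) :* v :+ v :* x := v) refl (v n) (p ^ suc n))

      u≼ : ∀ n → u n ≼ G.majorant κ n
      u≼ zero    = ≼-resp (sym u-zero) 1≼1
      u≼ (suc n) = ≼-resp eq (≼-* (u≼ n) (v≼ n))
        where
        eq : u n * v n ≈ u (suc n)
        eq = begin
          u n * (u (suc n) * poch p p n)   ≈⟨ solve 3 (λ x y z → x :* (y :* z) := y :* (z :* x)) refl _ _ _ ⟩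
          u (suc n) * (poch p p n * u n)   ≈⟨ *-congˡ (poch*u≈1 n) ⟩
          u (suc n) * 1#                   ≈⟨ *-identityʳ _ ⟩
          u (suc n)                        ∎

    u-bounded : Bounded u
    u-bounded = proj₁ (G.majorant-bounded κ 0≤κ) , λ n → ≼-mono (proj₂ (G.majorant-bounded κ 0≤κ) n) (u≼ n)

    private
      B = proj₁ u-bounded
      u≼B = proj₂ u-bounded

    u-converges : ∃ λ L → u ⟶ L
    u-converges = Cauchy⇒⟶ u B (≼⇒0≤ (u≼B 0)) λ n →
      ≼-resp (trans (solve 2 (λ u x → u :* x := u :- (con (+ 1) :- x) :* u) refl (u (suc n)) (p ^ suc n))
          (+-congˡ (-‿cong (u-suc n))))
        (≼-* (u≼B (suc n)) (^-≼-mono {n = suc n} p≼ρ (ℕ.n≤1+n n)))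

    u∞ : Carrier
    u∞ = proj₁ u-converges

    u⟶u∞ : u ⟶ u∞
    u⟶u∞ = proj₂ u-converges

    open InfiniteProduct p p p≼ρ

    poch∞ : Carrier
    poch∞ = proj₁ poch-converges

    poch⟶poch∞ : poch p p ⟶ poch∞
    poch⟶poch∞ = proj₂ poch-converges

    -- Limits multiply, and the products are constantly 1; hence the infinite product is invertible
    -- without any lower estimate of it.
    poch∞*u∞≈1 : poch∞ * u∞ ≈ 1#
    poch∞*u∞≈1 = ⟶-unique (⟶-* poch⟶poch∞ u⟶u∞) (⟶-resp (λ n → sym (poch*u≈1 n)) refl (⟶-const 1#))

    -- The rate is uniform in r because s r j ≥ j. The cases used are s r j = j + 2r for the triple
    -- product and j + 2r + 1 for the Bailey pair.
    weight-rate : ∀ (s : ℕ → ℕ → ℕ) → (∀ r j → j ℕ.≤ s r j) →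
                  ∃ λ K → (0ℝ ≤ K) × (∀ r j → u j * u (s r j) - u∞ * u∞ ≼ K *ℝ ρ ^ℝ j)
    weight-rate s j≤s = from u⟶u∞
      where
      S = proj₁ (≼-bound u∞)
      from : u ⟶ u∞ → ∃ λ K → (0ℝ ≤ K) × (∀ r j → u j * u (s r j) - u∞ * u∞ ≼ K *ℝ ρ ^ℝ j)
      from (K , 0≤K , u-u∞) =
        K *ℝ B +ℝ S *ℝ K ,
        ℝ.+-nonneg (ℝ.*-nonneg 0≤K (≼⇒0≤ (u≼B 0))) (ℝ.*-nonneg (≼⇒0≤ (proj₂ (≼-bound u∞))) 0≤K) , λ r j →
        ≼-mono (ℝ.≤-reflexive (ℝ.solve 5 (λ k r b s m → (k ℝ.:* r) ℝ.:* b ℝ.:+ s ℝ.:* (m ℝ.:* r)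
            ℝ.:= (k ℝ.:* b ℝ.:+ s ℝ.:* m) ℝ.:* r)
            ℝ.refl K (ρ ^ℝ j) B S K))
          (≼-resp (solve 4 (λ f g l m → (f :- l) :* g :+ l :* (g :- m)
              := f :* g :- l :* m) refl (u j) (u (s r j)) u∞ u∞)
            (≼-+ (≼-* (u-u∞ j) (u≼B (s r j)))
              (≼-* (proj₂ (≼-bound u∞))
                (≼-mono (ℝ.*-monoʳ-≤ 0≤K (G.ρ^-mono (j≤s r j))) (u-u∞ (s r j))))))

  -- Unconditional summation of the double series

  open ListSums commutativeRing using (sum; sum-cong)

  -- Unconditional convergence with a rate. The triangles have size 2n because the limit of the
  -- triangular partial sums is established along even indices.
  RapidSum : (ℕ × ℕ → Carrier) → Carrier → Set _
  RapidSum t S = ∃ λ K → (0ℝ ≤ K) × (∀ n F → Unique F → triangle (twice n) ⊆ F → sum F t - S ≼ K *ℝ ρ ^ℝ n)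

  RapidSum-resp : ∀ {s t S T} → (∀ i → s i ≈ t i) → S ≈ T → RapidSum s S → RapidSum t T
  RapidSum-resp s≈t S≈T (K , 0≤K , rate) = K , 0≤K , λ n F uF ⊆F →
    ≼-resp (+-cong (sum-cong F s≈t) (-‿cong S≈T)) (rate n F uF ⊆F)

  -- p, x and y are variables since a numeral power of a complex number, when unfolded, doubles in
  -- size with each factor.
  module DoubleSeries
    (q : Carrier) (q≼ρ : q ≼ ρ)
    (u : ℕ → Carrier) (poch*u≈1 : Reciprocal q u)
    (p x y : Carrier) (q²⁰≈p : q ^ 20 ≈ p) (q⁶≈x : q ^ 6 ≈ x) (q¹⁴≈y : q ^ 14 ≈ y)
    (u′ : ℕ → Carrier) (poch*u′≈1 : Reciprocal p u′) where

    open ListSums commutativeRing using (sum-++; sum-↭; sum-triangle)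
    open ImaginaryGauss commutativeRing q
    module ∑ℝᴸ = ListSums ℝ.commutativeRing

    private
      p≼ρ : p ≼ ρ
      p≼ρ = ≼-resp q²⁰≈p (≼-mono (ℝ.≤-reflexive (ℝ.*-identityʳ ρ)) (^-≼-mono {m = 1} {n = 20} q≼ρ (ℕ.s≤s ℕ.z≤n)))

      2ℝ : ℝ
      2ℝ = 1ℝ +ℝ 1ℝ

    module Q = Reciprocals q q≼ρ u poch*u≈1
    module P = Reciprocals p p≼ρ u′ poch*u′≈1
    module B = InfiniteProduct x p p≼ρ
    module C = InfiniteProduct y p p≼ρ

    A∞ B∞ C∞ D∞ : Carrier
    A∞ = P.poch∞
    B∞ = proj₁ B.poch-converges
    C∞ = proj₁ C.poch-converges
    D∞ = Q.poch∞

    private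
      -- The powers of z alone give the decay that `tannery` asks for; the quadratic exponent of p
      -- is estimated by 1.
      gauss≼ : ∀ {z} → z ≼ ρ ^ℝ 2 → ∀ r → gauss z p r ≼ ρ ^ℝ (r ℕ.+ r)
      gauss≼ x≼ρ² zero    = 1≼1
      gauss≼ x≼ρ² (suc r) = ≼-mono (ℝ.≤-reflexive eq)
        (≼-* (gauss≼ x≼ρ² r) (≼-* (≼-neg x≼ρ²) (^-≼1 p≼ρ r)))
        where
        lemma : ∀ r → (r ℕ.+ r) ℕ.+ 2 ≡ suc r ℕ.+ suc r
        lemma = solve-∀
        eq : ρ ^ℝ (r ℕ.+ r) *ℝ (ρ ^ℝ 2 *ℝ 1ℝ) ≈ℝ ρ ^ℝ (suc r ℕ.+ suc r)
        eq = ℝ.trans (ℝ.*-congˡ (ℝ.*-identityʳ _)) (ℝ.trans (ℝ.sym (ρ^+ (r ℕ.+ r) 2)) (ℝ.reflexive (≡.cong (ρ ^ℝ_) (lemma r))))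

      θ≼ : ∀ r → θ y x p r ≼ 2ℝ *ℝ ρ ^ℝ (r ℕ.+ r)
      θ≼ zero    = ≼-mono (ℝ.≤-respʳ (ℝ.sym (ℝ.*-identityʳ 2ℝ)) (ℝ.x≤x+y ℝ.0≤1)) 1≼1
      θ≼ (suc r) = ≼-mono (ℝ.≤-reflexive (ℝ.solve 1 (λ x → x ℝ.:+ x
          ℝ.:= (ℝ.con (+ 1) ℝ.:+ ℝ.con (+ 1)) ℝ.:* x) ℝ.refl _))
        (≼-+ (gauss≼ (≼-resp q⁶≈x (^-≼-mono {m = 2} {n = 6} q≼ρ (ℕ.s≤s (ℕ.s≤s ℕ.z≤n)))) (suc r))
             (gauss≼ (≼-resp q¹⁴≈y (^-≼-mono {m = 2} {n = 14} q≼ρ (ℕ.s≤s (ℕ.s≤s ℕ.z≤n)))) (suc r)))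

      1*1≤1 : 1ℝ *ℝ 1ℝ ≤ 1ℝ
      1*1≤1 = ℝ.≤-reflexive (ℝ.*-identityˡ 1ℝ)

      U≼1 : ∀ r → U r ≼ 1ℝ
      V≼1 : ∀ r → V r ≼ 1ℝ
      U≼1 zero    = 1≼1
      U≼1 (suc r) = ≼-mono 1*1≤1 (≼-* (≼-neg (^-≼1 q≼ρ (suc r))) (V≼1 r))
      V≼1 zero    = ≼-mono ℝ.0≤1 0≼0
      V≼1 (suc r) = ≼-mono 1*1≤1 (≼-* (^-≼1 q≼ρ r) (U≼1 r))

      r+r≤r[1+r] : ∀ r → r ℕ.+ r ℕ.≤ r ℕ.* suc r
      r+r≤r[1+r] zero    = ℕ.z≤n
      r+r≤r[1+r] (suc r) = ≡.subst (suc r ℕ.+ suc r ℕ.≤_) (lemma r) (ℕ.m≤m+n (suc r ℕ.+ suc r) (r ℕ.* suc r))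
        where
        lemma : ∀ r → (suc r ℕ.+ suc r) ℕ.+ r ℕ.* suc r ≡ suc r ℕ.* suc (suc r)
        lemma = solve-∀

      weight≼ : ∀ r → q ^ (r ℕ.* suc r) ≼ ρ ^ℝ (r ℕ.+ r)
      weight≼ r = ^-≼-mono {n = r ℕ.* suc r} q≼ρ (r+r≤r[1+r] r)

      -- One of the two weights q^{r(r+1)} supplies the decay, the other is bounded by 1, and α by
      -- 2.
      α″≼ : ∀ r → α″ r ≼ 2ℝ *ℝ ρ ^ℝ (r ℕ.+ r)
      α″≼ r = ≼-mono
        (ℝ.≤-reflexive (ℝ.solve 2 (λ x y → x ℝ.:* (ℝ.con (+ 1) ℝ.:* y) ℝ.:= y ℝ.:* x) ℝ.refl (ρ ^ℝ (r ℕ.+ r)) 2ℝ))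
        (≼-* (weight≼ r) (≼-* (^-≼1 q≼ρ (r ℕ.* suc r)) (≼-+ (U≼1 r) (U≼1 (suc r)))))

      inner : ℕ → ℕ → Carrier
      inner k m = q ^ (k ℕ.* suc k) * u m * (u (suc (twice k)) * poch (- q) (q ^ 2) k)

      Bᵤ = proj₁ Q.u-bounded
      module Π = InfiniteProduct (- q) (q ^ 2)
        (≼-mono (ℝ.≤-reflexive (ℝ.*-identityʳ ρ)) (^-≼-mono {m = 1} {n = 2} q≼ρ (ℕ.s≤s ℕ.z≤n)))
      Bπ = proj₁ Π.poch-bounded

      M : ℝ
      M = Bᵤ *ℝ (Bᵤ *ℝ Bπ)

      0≤M : 0ℝ ≤ M
      0≤M = ≼⇒0≤ (≼-* (proj₂ Q.u-bounded 0) (≼-* (proj₂ Q.u-bounded 0) (proj₂ Π.poch-bounded 0)))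

      inner≼ : ∀ k m → inner k m ≼ M *ℝ ρ ^ℝ k
      inner≼ k m = ≼-mono
        (ℝ.≤-reflexive (ℝ.solve 4 (λ x b y z → x ℝ.:* b ℝ.:* (y ℝ.:* z)
            ℝ.:= b ℝ.:* (y ℝ.:* z) ℝ.:* x) ℝ.refl _ _ _ _))
        (≼-* (≼-* (^-≼-mono {n = k ℕ.* suc k} q≼ρ (ℕ.≤-trans (ℕ.m≤m+n k k) (r+r≤r[1+r] k))) (proj₂ Q.u-bounded m))
          (≼-* (proj₂ Q.u-bounded (suc (twice k))) (proj₂ Π.poch-bounded k)))

      -- The terms with m + k fixed, without the outer factor 1/(q)_{N-n} of the finite identity,
      -- which Tannery's theorem removes.
      row : ℕ → Carrier
      row k = q ^ (k ℕ.* suc k) * anti k inner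

      row≼ : ∀ k → row k ≼ (M *ℝ κ) *ℝ ρ ^ℝ (k ℕ.+ k)
      row≼ k = ≼-mono (ℝ.≤-reflexive (ℝ.*-comm _ _)) (≼-* (weight≼ k)
        (≼-mono (ℝ.≤-respˡ (ℝ.sym (∑ℝ.anti-*ˡ k M (λ i _ → ρ ^ℝ i))) (ℝ.*-monoʳ-≤ 0≤M (G.geometric-sum≤κ k)))
          (anti-≼ k (λ i j _ → inner≼ i j))))

    term : ℕ × ℕ → Carrier
    term (m , k) = q ^ ((m ℕ.+ k) ℕ.* suc (m ℕ.+ k)) * inner k m

    private
      term≼ : ∀ m k → term (m , k) ≼ M *ℝ ρ ^ℝ ((m ℕ.+ k) ℕ.+ (m ℕ.+ k))
      term≼ m k = ≼-mono (ℝ.≤-reflexive (ℝ.*-comm _ _)) (≼-* (weight≼ (m ℕ.+ k))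
        (≼-mono (ℝ.≤-respʳ (ℝ.*-identityʳ M) (ℝ.*-monoʳ-≤ 0≤M (G.ρ^≤1 k))) (inner≼ k m)))

      ⟶-differenceˡ : ∀ {f g L} → (λ n → f n - g n) ⟶ 0# → f ⟶ L → g ⟶ L
      ⟶-differenceˡ {f} {g} {L} f-g⟶0 f⟶L = ⟶-resp
        (λ n → solve 2 (λ f g → f :+ :- con (+ 1) :* (f :- g) := g) refl (f n) (g n))
        (solve 1 (λ l → l :+ :- con (+ 1) :* con (+ 0) := l) refl L)
        (⟶-+ f⟶L (⟶-* (⟶-const (- 1#)) f-g⟶0))

      ⟶-differenceʳ : ∀ {f g L} → (λ n → f n - g n) ⟶ 0# → g ⟶ L → f ⟶ L
      ⟶-differenceʳ {f} {g} {L} f-g⟶0 g⟶L = ⟶-resp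
        (λ n → solve 2 (λ f g → (f :- g) :+ g := f) refl (f n) (g n))
        (+-identityˡ L)
        (⟶-+ f-g⟶0 g⟶L)

      ∑θ ∑α″ ∑row : ℕ → Carrier
      ∑θ n   = anti n (λ r _ → θ y x p r)
      ∑α″ n  = anti n (λ r _ → α″ r)
      ∑row n = anti n (λ k _ → row k)

      yx≈p : y * x ≈ p
      yx≈p = trans (sym (*-cong q¹⁴≈y q⁶≈x)) (trans (sym (^-homo-* q 14 6)) q²⁰≈p)

      θ-cong : ∀ r → θ (q ^ 14) (q ^ 6) (q ^ 20) r ≈ θ y x p r
      θ-cong zero    = refl
      θ-cong (suc r) = +-cong (gauss-cong q⁶≈x (suc r)) (gauss-cong q¹⁴≈y (suc r))
        where
        gauss-cong : ∀ {w z} → w ≈ z → ∀ r → gauss w (q ^ 20) r ≈ gauss z p r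
        gauss-cong w≈z zero    = refl
        gauss-cong w≈z (suc r) = *-cong (gauss-cong w≈z r) (*-cong (-‿cong w≈z) (^-congˡ r q²⁰≈p))

      open QSeries.JacobiTriple commutativeRing p u′ poch*u′≈1 y x yx≈p
      open FiniteIdentity commutativeRing q u poch*u≈1 using (double-sum)

      -- In the folded triple product the left side behaves like u′∞² times the partial theta sum,
      -- the right side tends to u′∞ C∞ B∞. Multiplying by A∞² clears the reciprocals and leaves one
      -- A∞.
      ∑θ⟶ : ∑θ ⟶ A∞ * B∞ * C∞
      ∑θ⟶ = ⟶-resp (λ n → clear (∑θ n)) (clear′ B∞ C∞) (⟶-* (⟶-const (A∞ * A∞)) u′²∑θ⟶)
        where
        u′∞ = P.u∞
        weights = P.weight-rate (λ r j → j ℕ.+ twice r) (λ r j → ℕ.m≤m+n j (twice r))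
        u′²∑θ⟶ : (λ n → u′∞ * u′∞ * ∑θ n) ⟶ u′∞ * (C∞ * B∞)
        u′²∑θ⟶ = ⟶-differenceˡ
          (tannery (θ y x p) (λ r j → u′ j * u′ (j ℕ.+ twice r)) (u′∞ * u′∞)
            (proj₁ (proj₂ weights)) θ≼ (proj₂ (proj₂ weights)))
          (⟶-resp (λ n → sym (jacobi-triple-folded n)) refl
            (⟶-* (⟶-twice P.u⟶u∞) (⟶-* (proj₂ C.poch-converges) (proj₂ B.poch-converges))))
        clear : ∀ x → A∞ * A∞ * (u′∞ * u′∞ * x) ≈ x
        clear x = begin
          A∞ * A∞ * (u′∞ * u′∞ * x)       ≈⟨ solve 3 (λ a u x → a :* a :* (u :* u :* x)
              := (a :* u) :* (a :* u) :* x) refl A∞ u′∞ x ⟩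
          (A∞ * u′∞) * (A∞ * u′∞) * x     ≈⟨ *-congʳ (trans (*-cong P.poch∞*u∞≈1 P.poch∞*u∞≈1) (*-identityˡ 1#)) ⟩
          1# * x                          ≈⟨ *-identityˡ x ⟩
          x                               ∎
        clear′ : ∀ x y → A∞ * A∞ * (u′∞ * (y * x)) ≈ A∞ * x * y
        clear′ x y = begin
          A∞ * A∞ * (u′∞ * (y * x))       ≈⟨ solve 4 (λ a u x y → a :* a :* (u :* (y :* x))
              := (a :* u) :* (a :* x :* y)) refl A∞ u′∞ x y ⟩
          (A∞ * u′∞) * (A∞ * x * y)       ≈⟨ *-congʳ P.poch∞*u∞≈1 ⟩
          1# * (A∞ * x * y)               ≈⟨ *-identityˡ _ ⟩
          A∞ * x * y                      ∎

      u∞ = Q.u∞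

      -- Both weights tend to u∞, and the bare sum of α″ up to 2n is the theta sum up to n.
      double-sum⟶ : (λ n → anti (twice n) (λ r j → α″ r * (u j * u (j ℕ.+ suc (twice r))))) ⟶ u∞ * u∞ * (A∞ * B∞ * C∞)
      double-sum⟶ = ⟶-differenceʳ
        (⟶-twice (tannery α″ (λ r j → u j * u (j ℕ.+ suc (twice r))) (u∞ * u∞)
          (proj₁ (proj₂ weights)) α″≼ (proj₂ (proj₂ weights))))
        (⟶-* (⟶-const (u∞ * u∞)) (⟶-resp (λ n → sym (trans (∑α″≈∑θ n) (anti-cong n (λ r _ → θ-cong r)))) refl ∑θ⟶))
        where
        weights = Q.weight-rate (λ r j → j ℕ.+ suc (twice r)) (λ r j → ℕ.m≤m+n j (suc (twice r)))

      -- The outer reciprocal contributes one u∞ on the left, which D∞ cancels against one of the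
      -- two on the right. The surviving u∞ is the denominator of the theorem.
      ∑row⟶ : (λ n → ∑row (twice n)) ⟶ A∞ * B∞ * C∞ * u∞
      ∑row⟶ = ⟶-resp (λ n → clear (∑row (twice n))) clear′ (⟶-* (⟶-const D∞) u∑row⟶)
        where
        regroup : ∀ n → anti n (λ k m → q ^ (k ℕ.* suc k) * u m * anti k inner) ≈ anti n (λ k m → row k * u m)
        regroup n = anti-cong n (λ k m → solve 3 (λ x y z → x :* y :* z := x :* z :* y) refl _ _ _)
        rate : ∃ λ K → (0ℝ ≤ K) × (∀ j → u j - u∞ ≼ K *ℝ ρ ^ℝ j)
        rate = Q.u⟶u∞
        u∑row⟶ : (λ n → u∞ * ∑row (twice n)) ⟶ u∞ * u∞ * (A∞ * B∞ * C∞)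
        u∑row⟶ = ⟶-differenceˡ
          (⟶-twice (tannery row (λ _ j → u j) u∞ (proj₁ (proj₂ rate)) row≼ (λ _ → proj₂ (proj₂ rate))))
          (⟶-resp (λ n → trans (sym (double-sum (twice n))) (regroup (twice n))) refl double-sum⟶)
        clear : ∀ x → D∞ * (u∞ * x) ≈ x
        clear x = trans (sym (*-assoc _ _ _)) (trans (*-congʳ Q.poch∞*u∞≈1) (*-identityˡ x))
        clear′ : D∞ * (u∞ * u∞ * (A∞ * B∞ * C∞)) ≈ A∞ * B∞ * C∞ * u∞
        clear′ = trans (*-congˡ (*-assoc _ _ _)) (trans (clear _) (*-comm _ _))

      triangle≈∑row : ∀ n → sum (triangle n) term ≈ ∑row n
      triangle≈∑row n = trans (sum-triangle n term) (anti-cong n (λ k _ → begin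
        anti k (λ m i → term (m , i))
          ≈⟨ anti-flip k (λ m i → term (m , i)) ⟨
        anti k (λ i m → term (m , i))
          ≈⟨ anti-cong-≡ k (λ i m i+m≡k → *-congʳ (^-congʳ q
               (≡.cong (λ k → k ℕ.* suc k) (≡.trans (ℕ.+-comm m i) i+m≡k)))) ⟩
        anti k (λ i m → q ^ (k ℕ.* suc k) * inner i m)
          ≈⟨ anti-*ˡ k _ inner ⟩
        row k ∎))

      sum-≼ : ∀ (F : List (ℕ × ℕ)) {t : ℕ × ℕ → Carrier} {g : ℕ × ℕ → ℝ} →
              (∀ {x} → x ∈ F → t x ≼ g x) → sum F t ≼ ∑ℝᴸ.sum F g
      sum-≼ []      t≼g = 0≼0
      sum-≼ (x ∷ F) t≼g = ≼-+ (t≼g (here ≡.refl)) (sum-≼ F (λ x∈F → t≼g (there x∈F)))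

      sum-nonneg : ∀ (F : List (ℕ × ℕ)) {g : ℕ × ℕ → ℝ} → (∀ x → 0ℝ ≤ g x) → 0ℝ ≤ ∑ℝᴸ.sum F g
      sum-nonneg []      0≤g = ℝ.≤-refl
      sum-nonneg (x ∷ F) 0≤g = ℝ.+-nonneg (0≤g x) (sum-nonneg F 0≤g)

      geometric : ℝ → ℕ × ℕ → ℝ
      geometric K (m , k) = K *ℝ (ρ ^ℝ m *ℝ ρ ^ℝ k)

      geometric-triangle : ∀ K → 0ℝ ≤ K → ∀ n → ∑ℝᴸ.sum (triangle n) (geometric K) ≤ K *ℝ (κ *ℝ κ)
      geometric-triangle K 0≤K n = ℝ.≤-respˡ (ℝ.sym eq)
        (ℝ.*-monoʳ-≤ 0≤K (≤κκ n))
        where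
        eq : ∑ℝᴸ.sum (triangle n) (geometric K) ≈ℝ K *ℝ ∑ℝ.anti n (λ i j → ρ ^ℝ i *ℝ ∑ℝ.anti j (λ k _ → ρ ^ℝ k))
        eq = ℝ.trans (∑ℝᴸ.sum-triangle n (geometric K))
          (ℝ.trans (∑ℝ.anti-assoc n (λ i k _ → geometric K (i , k)))
            (ℝ.trans (∑ℝ.anti-cong n (λ i j → ℝ.trans (∑ℝ.anti-*ˡ j K (λ k _ → ρ ^ℝ i *ℝ ρ ^ℝ k))
                (ℝ.*-congˡ (∑ℝ.anti-*ˡ j (ρ ^ℝ i) (λ k _ → ρ ^ℝ k)))))
              (∑ℝ.anti-*ˡ n K (λ i j → ρ ^ℝ i *ℝ ∑ℝ.anti j (λ k _ → ρ ^ℝ k)))))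
        anti-mono : ∀ n {f g : ℕ → ℕ → ℝ} → (∀ i j → f i j ≤ g i j) → ∑ℝ.anti n f ≤ ∑ℝ.anti n g
        anti-mono zero    f≤g = f≤g 0 0
        anti-mono (suc n) f≤g = ℝ.+-mono-≤ (f≤g 0 (suc n)) (anti-mono n (λ i j → f≤g (suc i) j))
        ≤κκ : ∀ n → ∑ℝ.anti n (λ i j → ρ ^ℝ i *ℝ ∑ℝ.anti j (λ k _ → ρ ^ℝ k)) ≤ κ *ℝ κ
        ≤κκ n = ℝ.≤-trans
          (anti-mono n (λ i j → ℝ.≤-respʳ (ℝ.*-comm _ _) (ℝ.*-monoʳ-≤ (G.0≤ρ^ i) (G.geometric-sum≤κ j))))
          (ℝ.≤-respˡ (ℝ.sym (∑ℝ.anti-*ˡ n κ (λ i _ → ρ ^ℝ i))) (ℝ.*-monoʳ-≤ 0≤κ (G.geometric-sum≤κ n)))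

      -- F lies in some triangle and the remaining terms are nonnegative. Over a triangle the sum is
      -- at most a product of two geometric series.
      geometric-list : ∀ K → 0ℝ ≤ K → ∀ F → Unique F → ∑ℝᴸ.sum F (geometric K) ≤ K *ℝ (κ *ℝ κ)
      geometric-list K 0≤K F uF = from (⊆-triangle F)
        where
        from : (∃ λ n → F ⊆ triangle n) → ∑ℝᴸ.sum F (geometric K) ≤ K *ℝ (κ *ℝ κ)
        from (n , F⊆) = within (UniqueLists.⊆-complement uF F⊆)
          where
          within : (∃ λ G → triangle n ↭ F ++ G) → ∑ℝᴸ.sum F (geometric K) ≤ K *ℝ (κ *ℝ κ)
          within (G , p) = ℝ.≤-trans
            (ℝ.≤-respʳ (ℝ.sym (ℝ.trans (∑ℝᴸ.sum-↭ (geometric K) p) (∑ℝᴸ.sum-++ F G (geometric K))))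
              (ℝ.x≤x+y (sum-nonneg G (λ (m , k) → ℝ.*-nonneg 0≤K (ℝ.*-nonneg (G.0≤ρ^ m) (G.0≤ρ^ k))))))
            (geometric-triangle K 0≤K n)

      -- Outside the triangle m + k ≥ 2n ≥ n. Of the two factors ρ^{m+k} in `term≼`, one yields ρ^n
      -- and the other the summable ρ^m ρ^k.
      tail≼ : ∀ n G → Unique G → (∀ {x} → x ∈ G → x ∉ triangle (twice n)) → sum G term ≼ (M *ℝ ρ ^ℝ n) *ℝ (κ *ℝ κ)
      tail≼ n G uG outside = ≼-mono (geometric-list (M *ℝ ρ ^ℝ n) (ℝ.*-nonneg 0≤M (G.0≤ρ^ n)) G uG)
        (sum-≼ G λ {x} x∈G → small x (ℕ.≰⇒≥ (λ le → outside x∈G (∈-triangle⁺ (twice n) le))))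
        where
        small : ∀ x → twice n ℕ.≤ proj₁ x ℕ.+ proj₂ x → term x ≼ geometric (M *ℝ ρ ^ℝ n) x
        small (m , k) le = ≼-mono
          (ℝ.≤-respˡ (ℝ.*-congˡ (ℝ.sym (ρ^+ (m ℕ.+ k) (m ℕ.+ k))))
            (ℝ.≤-respʳ (ℝ.sym (ℝ.*-assoc M (ρ ^ℝ n) _))
              (ℝ.*-monoʳ-≤ 0≤M (ℝ.*-mono-≤ (G.0≤ρ^ (m ℕ.+ k)) (ℝ.*-nonneg (G.0≤ρ^ m) (G.0≤ρ^ k))
                (G.ρ^-mono (ℕ.≤-trans (≡.subst (n ℕ.≤_) (≡.sym (twice≡+ n)) (ℕ.m≤m+n n n)) le))
                (ℝ.≤-reflexive (ρ^+ m k))))))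
          (term≼ m k)

    -- A finite set containing the triangle is, up to order, the triangle followed by a rest G;
    -- `∑row⟶` handles the first and `tail≼` the second.
    sum-term-rate : RapidSum term (A∞ * B∞ * C∞ * Q.u∞)
    sum-term-rate = from ∑row⟶
      where
      S = A∞ * B∞ * C∞ * u∞
      from : (λ n → ∑row (twice n)) ⟶ S → RapidSum term S
      from (K , 0≤K , ∑row-S≼) = K +ℝ M *ℝ (κ *ℝ κ) , ℝ.+-nonneg 0≤K (ℝ.*-nonneg 0≤M (ℝ.*-nonneg 0≤κ 0≤κ)) , bound
        where
        bound : ∀ n F → Unique F → triangle (twice n) ⊆ F → sum F term - S ≼ (K +ℝ M *ℝ (κ *ℝ κ)) *ℝ ρ ^ℝ n
        bound n F uF ⊆F = split (UniqueLists.⊆-complement (triangle-unique (twice n)) ⊆F)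
          where
          Tₙ = triangle (twice n)
          split : (∃ λ G → F ↭ Tₙ ++ G) → sum F term - S ≼ (K +ℝ M *ℝ (κ *ℝ κ)) *ℝ ρ ^ℝ n
          split (G , p) = ≼-mono
            (ℝ.≤-reflexive (ℝ.solve 4 (λ k r m x → k ℝ.:* r ℝ.:+ m ℝ.:* r ℝ.:* x
                ℝ.:= (k ℝ.:+ m ℝ.:* x) ℝ.:* r) ℝ.refl K (ρ ^ℝ n) M (κ *ℝ κ)))
            (≼-resp eq (≼-+ (∑row-S≼ n) (tail≼ n G (proj₁ unique) (proj₂ unique))))
            where
            unique = UniqueLists.Unique-++⁻ Tₙ (UniqueLists.Unique-resp-↭ p uF)
            eq : (∑row (twice n) - S) + sum G term ≈ sum F term - S
            eq = begin
              (∑row (twice n) - S) + sum G term   ≈⟨ solve 3 (λ a s g → (a :- s) :+ g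
                  := (a :+ g) :- s) refl _ _ _ ⟩
              (∑row (twice n) + sum G term) - S   ≈⟨ +-congʳ (+-congʳ (triangle≈∑row (twice n))) ⟨
              (sum Tₙ term + sum G term) - S      ≈⟨ +-congʳ (sum-++ Tₙ G term) ⟨
              sum (Tₙ ++ G) term - S              ≈⟨ +-congʳ (sum-↭ term p) ⟨
              sum F term - S                      ∎

    product-formula : ∃ λ A → ∃ λ B → ∃ λ C → ∃ λ D → ∃ λ D⁻¹ →
      (poch p p ⟶ A) × (poch x p ⟶ B) × (poch y p ⟶ C) × (poch q q ⟶ D) ×
      (D * D⁻¹ ≈ 1#) × RapidSum term (A * B * C * D⁻¹)
    product-formula = A∞ , B∞ , C∞ , D∞ , Q.u∞ ,
      P.poch⟶poch∞ , proj₂ B.poch-converges , proj₂ C.poch-converges , Q.poch⟶poch∞ ,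
      Q.poch∞*u∞≈1 , sum-term-rate

-- The complex numbers

module RealCompleteness {c ℓ₁ ℓ₂ ℓ₃} (R : RealNumbers c ℓ₁ ℓ₂ ℓ₃) (ratio : Ratio R) where
  open RealInequalities R
  open Ratio ratio
  open GeometricDecay R ratio
  open RealNumbers R using (Cauchy; ConvergesTo; complete)

  -- g n + Kκρⁿ is nonincreasing and g n - Kκρⁿ is nondecreasing.
  geometric-limit : ∀ (g : ℕ → Carrier) K → 0# ≤ K →
    (∀ n → g (suc n) - g n ≤ K * ρ ^ n) → (∀ n → g n - g (suc n) ≤ K * ρ ^ n) →
    ∃ λ x → ∀ n → (g n - x ≤ K * κ * ρ ^ n) × (x - g n ≤ K * κ * ρ ^ n)
  geometric-limit g K 0≤K up down = from (complete g cauchy)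
    where
    e : ℕ → Carrier
    e n = K * κ * ρ ^ n
    0≤e : ∀ n → 0# ≤ e n
    0≤e n = *-nonneg (*-nonneg 0≤K (<⇒≤ 0<κ)) (0≤ρ^ n)
    -- As κ(1-ρ) = 1, the allowed increment telescopes, which makes the two sequences g ± e
    -- monotone.
    e-step : ∀ n → K * ρ ^ n ≈ e n - e (suc n)
    e-step n = trans (trans (sym (*-identityˡ _)) (*-congʳ (sym κ[1-ρ]≈1)))
      (solve 4 (λ k c r x → (c :* (con (+ 1) :- r)) :* (k :* x)
          := k :* c :* x :- k :* c :* (r :* x)) refl K κ ρ (ρ ^ n))
    rearrange : ∀ {w x y z} → w - x ≤ y - z → w + z ≤ x + y
    rearrange {w} {x} {y} {z} le = ≤-respˡ (solve 3 (λ w x z → (w :- x) :+ (x :+ z) := w :+ z) refl w x z)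
      (≤-respʳ (solve 3 (λ x y z → (y :- z) :+ (x :+ z) := x :+ y) refl x y z) (+-monoˡ-≤ (x + z) le))
    upper : ∀ N i → g (N ℕ.+ i) + e (N ℕ.+ i) ≤ g N + e N
    upper N zero    = ≤-reflexive (reflexive (≡.cong (λ k → g k + e k) (ℕ.+-identityʳ N)))
    upper N (suc i) = ≤-respˡ (reflexive (≡.cong (λ k → g k + e k) (≡.sym (ℕ.+-suc N i))))
      (≤-trans (rearrange (≤-respʳ (e-step (N ℕ.+ i)) (up (N ℕ.+ i)))) (upper N i))
    -- Monotonicity of g - e with the subtractions moved to the other side.
    lower : ∀ N i → g N + e (N ℕ.+ i) ≤ g (N ℕ.+ i) + e N
    lower N zero    = ≤-reflexive (reflexive (≡.cong₂ (λ k l → g k + e l) (≡.sym (ℕ.+-identityʳ N)) (ℕ.+-identityʳ N)))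
    lower N (suc i) = ≤-respˡ (+-congˡ (reflexive (≡.cong e (≡.sym (ℕ.+-suc N i)))))
      (≤-respʳ (+-congʳ (reflexive (≡.cong g (≡.sym (ℕ.+-suc N i)))))
        (0≤y-x⇒x≤y (≤-respʳ
          (solve 6 (λ gN gk gk′ eN ek ek′ → ((gk :+ eN) :- (gN :+ ek)) :+ ((gk′ :+ ek) :- (gk :+ ek′))
              := (gk′ :+ eN) :- (gN :+ ek′)) refl
            (g N) (g (N ℕ.+ i)) (g (suc (N ℕ.+ i))) (e N) (e (N ℕ.+ i)) (e (suc (N ℕ.+ i))))
          (+-nonneg (x≤y⇒0≤y-x (lower N i))
            (x≤y⇒0≤y-x (rearrange (≤-respʳ (e-step (N ℕ.+ i)) (down (N ℕ.+ i)))))))))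
    ≤upper : ∀ {N m} → N ℕ.≤ m → g m ≤ g N + e N
    ≤upper {N} {m} N≤m = ≡.subst (λ k → g k ≤ g N + e N) (ℕ.m+[n∸m]≡n N≤m)
      (≤-trans (x≤x+y (0≤e (N ℕ.+ (m ℕ.∸ N)))) (upper N (m ℕ.∸ N)))
    ≤lower : ∀ {N m} → N ℕ.≤ m → g N ≤ g m + e N
    ≤lower {N} {m} N≤m = ≡.subst (λ k → g N ≤ g k + e N) (ℕ.m+[n∸m]≡n N≤m)
      (≤-trans (x≤x+y (0≤e (N ℕ.+ (m ℕ.∸ N)))) (lower N (m ℕ.∸ N)))
    cauchy : Cauchy g
    cauchy ε 0<ε = near (ρ^→0 (K * κ + K * κ) ε (+-nonneg (*-nonneg 0≤K (<⇒≤ 0<κ)) (*-nonneg 0≤K (<⇒≤ 0<κ))) 0<ε)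
      where
      near : (∃ λ N → ∀ n → N ℕ.≤ n → (K * κ + K * κ) * ρ ^ n < ε) →
             ∃ λ N → ∀ m n → N ℕ.≤ m → N ℕ.≤ n → g m - g n < ε
      near (N , lt) = N , λ m n N≤m N≤n → ≤-<-trans
        (0≤y-x⇒x≤y (≤-respʳ
          (solve 6 (λ gN gm gn k c x → ((gN :+ k :* c :* x) :- gm) :+ ((gn :+ k :* c :* x) :- gN)
              := (k :* c :+ k :* c) :* x :- (gm :- gn)) refl
            (g N) (g m) (g n) K κ (ρ ^ N))
          (+-nonneg (x≤y⇒0≤y-x (≤upper N≤m)) (x≤y⇒0≤y-x (≤lower N≤n)))))
        (lt N ℕ.≤-refl)
    from : (∃ λ x → ConvergesTo g x) → ∃ λ x → ∀ n → (g n - x ≤ e n) × (x - g n ≤ e n)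
    from (x , g→x) = x , λ n → g-x≤ n , x-g≤ n
      where
      g-x≤ : ∀ n → g n - x ≤ e n
      -- The supposed excess over the bound is positive and serves as ε; at an index beyond both N
      -- and n it contradicts `≤lower`.
      g-x≤ n lt = contra (g→x ((g n - x) - e n) (x<y⇒0<y-x lt))
        where
        contra : (∃ λ N → ∀ m → N ℕ.≤ m → (g m - x < (g n - x) - e n) × (x - g m < (g n - x) - e n)) → _
        contra (N , close) = ≤lower (ℕ.m≤n+m n N) (0<y-x⇒x<y (<-respʳ-≈
          (solve 4 (λ gm gn x e → ((gn :- x) :- e) :- (gm :- x)
              := gn :- (gm :+ e)) refl (g (N ℕ.+ n)) (g n) x (e n))
          (x<y⇒0<y-x (proj₁ (close (N ℕ.+ n) (ℕ.m≤m+n N n))))))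
      x-g≤ : ∀ n → x - g n ≤ e n
      x-g≤ n lt = contra (g→x ((x - g n) - e n) (x<y⇒0<y-x lt))
        where
        contra : (∃ λ N → ∀ m → N ℕ.≤ m → (g m - x < (x - g n) - e n) × (x - g m < (x - g n) - e n)) → _
        contra (N , close) = ≤upper (ℕ.m≤n+m n N) (0<y-x⇒x<y (<-respʳ-≈
          (solve 4 (λ gm gn x e → ((x :- gn) :- e) :- (x :- gm)
              := gm :- (gn :+ e)) refl (g (N ℕ.+ n)) (g n) x (e n))
          (x<y⇒0<y-x (proj₂ (close (N ℕ.+ n) (ℕ.m≤m+n N n))))))

module ComplexNumbers {c ℓ₁ ℓ₂ ℓ₃} (R : RealNumbers c ℓ₁ ℓ₂ ℓ₃) where
  module ℝ = RealInequalities R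
  open ℝ using (solve; con; _:=_; _:+_; _:*_; _:-_; :-_)
  open Complex R

  private
    isCommutativeRing : IsCommutativeRing _≈_ _+_ _*_ -_ 0ℂ 1ℂ
    isCommutativeRing = record
      { isRing = record
        { +-isAbelianGroup = record
          { isGroup = record
            { isMonoid = record
              { isSemigroup = record
                { isMagma = record
                  { isEquivalence = record
                    { refl  = ℝ.refl , ℝ.refl
                    ; sym   = λ (p , q) → ℝ.sym p , ℝ.sym q
                    ; trans = λ (p , q) (r , s) → ℝ.trans p r , ℝ.trans q s }
                  ; ∙-cong = λ (p , q) (r , s) → ℝ.+-cong p r , ℝ.+-cong q s }
                ; assoc = λ x y z → ℝ.+-assoc _ _ _ , ℝ.+-assoc _ _ _ }
              ; identity = (λ x → ℝ.+-identityˡ _ , ℝ.+-identityˡ _) , (λ x → ℝ.+-identityʳ _ , ℝ.+-identityʳ _) }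
            ; inverse = (λ x → inverseˡ _ , inverseˡ _) , (λ x → inverseʳ _ , inverseʳ _)
            ; ⁻¹-cong = λ (p , q) → ℝ.-‿cong p , ℝ.-‿cong q }
          ; comm = λ x y → ℝ.+-comm _ _ , ℝ.+-comm _ _ }
        ; *-cong = λ (p , q) (r , s) →
            ℝ.+-cong (ℝ.*-cong p r) (ℝ.-‿cong (ℝ.*-cong q s)) , ℝ.+-cong (ℝ.*-cong p s) (ℝ.*-cong q r)
        ; *-assoc = λ (a +i b) (c +i d) (e +i f) →
            solve 6 (λ a b c d e f → (a :* c :- b :* d) :* e :- (a :* d :+ b :* c) :* f
              := a :* (c :* e :- d :* f) :- b :* (c :* f :+ d :* e)) ℝ.refl a b c d e f ,
            solve 6 (λ a b c d e f → (a :* c :- b :* d) :* f :+ (a :* d :+ b :* c) :* e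
              := a :* (c :* f :+ d :* e) :+ b :* (c :* e :- d :* f)) ℝ.refl a b c d e f
        ; *-identity =
            (λ (a +i b) →
              solve 2 (λ a b → con (+ 1) :* a :- con (+ 0) :* b := a) ℝ.refl a b ,
              solve 2 (λ a b → con (+ 1) :* b :+ con (+ 0) :* a := b) ℝ.refl a b) ,
            (λ (a +i b) →
              solve 2 (λ a b → a :* con (+ 1) :- b :* con (+ 0) := a) ℝ.refl a b ,
              solve 2 (λ a b → a :* con (+ 0) :+ b :* con (+ 1) := b) ℝ.refl a b)
        ; distrib =
            (λ (a +i b) (c +i d) (e +i f) →
              solve 6 (λ a b c d e f → a :* (c :+ e) :- b :* (d :+ f)
                  := (a :* c :- b :* d) :+ (a :* e :- b :* f)) ℝ.refl a b c d e f ,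
              solve 6 (λ a b c d e f → a :* (d :+ f) :+ b :* (c :+ e)
                  := (a :* d :+ b :* c) :+ (a :* f :+ b :* e)) ℝ.refl a b c d e f) ,
            (λ (a +i b) (c +i d) (e +i f) →
              solve 6 (λ a b c d e f → (c :+ e) :* a :- (d :+ f) :* b
                  := (c :* a :- d :* b) :+ (e :* a :- f :* b)) ℝ.refl a b c d e f ,
              solve 6 (λ a b c d e f → (c :+ e) :* b :+ (d :+ f) :* a
                  := (c :* b :+ d :* a) :+ (e :* b :+ f :* a)) ℝ.refl a b c d e f)
        }
      ; *-comm = λ (a +i b) (c +i d) →
          solve 4 (λ a b c d → a :* c :- b :* d := c :* a :- d :* b) ℝ.refl a b c d ,
          solve 4 (λ a b c d → a :* d :+ b :* c := c :* b :+ d :* a) ℝ.refl a b c d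
      }
      where
      inverseˡ : ∀ x → ℝ.- x ℝ.+ x ℝ.≈ ℝ.0#
      inverseˡ = solve 1 (λ x → :- x :+ x := con (+ 0)) ℝ.refl
      inverseʳ : ∀ x → x ℝ.+ ℝ.- x ℝ.≈ ℝ.0#
      inverseʳ = solve 1 (λ x → x :+ :- x := con (+ 0)) ℝ.refl

  ℂ-commutativeRing : CommutativeRing c ℓ₁
  ℂ-commutativeRing = record { isCommutativeRing = isCommutativeRing }

  ∣∣²-cong : ∀ {z w} → z ≈ w → ∣ z ∣² ℝ.≈ ∣ w ∣²
  ∣∣²-cong (p , q) = ℝ.+-cong (ℝ.*-cong p p) (ℝ.*-cong q q)

  ∣∣²-* : ∀ z w → ∣ z * w ∣² ℝ.≈ ∣ z ∣² ℝ.* ∣ w ∣²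
  ∣∣²-* (a +i b) (c +i d) = ℝ.brahmagupta a b c d

  ∣1∣² : ∣ 1ℂ ∣² ℝ.≈ ℝ.1#
  ∣1∣² = solve 0 (con (+ 1) :* con (+ 1) :+ con (+ 0) :* con (+ 0) := con (+ 1)) ℝ.refl

  0≤∣∣² : ∀ z → ℝ.0# ℝ.≤ ∣ z ∣²
  0≤∣∣² z = ℝ.x²+y²≮0 (re z) (im z)

  infix 4 _≼_
  _≼_ : ℂ → ℝ.Carrier → Set ℓ₃
  z ≼ s = (ℝ.0# ℝ.≤ s) × (∣ z ∣² ℝ.≤ s ℝ.* s)

  re≤ : ∀ {z s} → z ≼ s → re z ℝ.≤ s
  re≤ {z} (0≤s , ≤s²) = ℝ.square-cancel-≤ 0≤s (ℝ.≤-trans (ℝ.x≤x+y (ℝ.0≤x² (im z))) ≤s²)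

  im≤ : ∀ {z s} → z ≼ s → im z ℝ.≤ s
  im≤ {z} (0≤s , ≤s²) = ℝ.square-cancel-≤ 0≤s
    (ℝ.≤-trans (ℝ.≤-respʳ (ℝ.+-comm _ _) (ℝ.x≤x+y (ℝ.0≤x² (re z)))) ≤s²)

  square≤ : ∀ {x s} → x ℝ.≤ s → ℝ.- x ℝ.≤ s → x ℝ.* x ℝ.≤ s ℝ.* s
  square≤ {x} {s} x≤s -x≤s = ℝ.0≤y-x⇒x≤y (ℝ.≤-respʳ
    (solve 2 (λ x s → (s :- x) :* (s :- :- x) := s :* s :- x :* x) ℝ.refl x s)
    (ℝ.*-nonneg (ℝ.x≤y⇒0≤y-x x≤s) (ℝ.x≤y⇒0≤y-x -x≤s)))

  private
    ≼-resp : ∀ {z w s} → z ≈ w → z ≼ s → w ≼ s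
    ≼-resp z≈w (0≤s , le) = 0≤s , ℝ.≤-respˡ (∣∣²-cong z≈w) le

    ≼-mono : ∀ {z s t} → s ℝ.≤ t → z ≼ s → z ≼ t
    ≼-mono s≤t (0≤s , le) = ℝ.≤-trans 0≤s s≤t , ℝ.≤-trans le (ℝ.*-mono-≤ 0≤s (ℝ.≤-trans 0≤s s≤t) s≤t s≤t)

    -- 1 + |z|² bounds |z| without a square root, since (1+a)² - a = 1 + a + a².
    ≼-bound : ∀ z → ∃ λ s → z ≼ s
    ≼-bound z = ℝ.1# ℝ.+ ∣ z ∣² , ℝ.+-nonneg ℝ.0≤1 (0≤∣∣² z) ,
      ℝ.0≤y-x⇒x≤y (ℝ.≤-respʳ
        (solve 1 (λ a → con (+ 1) :+ (a :+ a :* a) := (con (+ 1) :+ a) :* (con (+ 1) :+ a) :- a) ℝ.refl ∣ z ∣²)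
        (ℝ.+-nonneg ℝ.0≤1 (ℝ.+-nonneg (0≤∣∣² z) (ℝ.0≤x² ∣ z ∣²))))

    0≼0 : 0ℂ ≼ ℝ.0#
    0≼0 = ℝ.≤-refl , ℝ.≤-reflexive (solve 0 (con (+ 0) :* con (+ 0) :+ con (+ 0) :* con (+ 0)
        := con (+ 0) :* con (+ 0)) ℝ.refl)

    1≼1 : 1ℂ ≼ ℝ.1#
    1≼1 = ℝ.0≤1 , ℝ.≤-reflexive (ℝ.trans ∣1∣² (ℝ.sym (ℝ.*-identityˡ _)))

    -- Lagrange's identity gives the Cauchy–Schwarz inequality for the inner product d.
    ≼-+ : ∀ {z w s t} → z ≼ s → w ≼ t → z + w ≼ s ℝ.+ t
    ≼-+ {a +i b} {x +i y} {s} {t} (0≤s , z≤) (0≤t , w≤) = ℝ.+-nonneg 0≤s 0≤t ,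
      ℝ.≤-respˡ (solve 4 (λ a b x y → (a :* a :+ b :* b) :+ (x :* x :+ y :* y) :+ ((a :* x :+ b :* y) :+ (a :* x :+ b :* y))
          := (a :+ x) :* (a :+ x) :+ (b :+ y) :* (b :+ y)) ℝ.refl a b x y)
        (ℝ.≤-respʳ (solve 2 (λ s t → (s :* s) :+ (t :* t) :+ (s :* t :+ s :* t)
            := (s :+ t) :* (s :+ t)) ℝ.refl s t)
          (ℝ.+-mono-≤ (ℝ.+-mono-≤ z≤ w≤) (ℝ.+-mono-≤ d≤st d≤st)))
      where
      d = a ℝ.* x ℝ.+ b ℝ.* y
      d²≤ : d ℝ.* d ℝ.≤ (s ℝ.* t) ℝ.* (s ℝ.* t)
      d²≤ = ℝ.≤-trans
        (ℝ.≤-respʳ (solve 4 (λ a b x y → (a :* x :+ b :* y) :* (a :* x :+ b :* y) :+ (a :* y :- b :* x) :* (a :* y :- b :* x)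
            := (a :* a :+ b :* b) :* (x :* x :+ y :* y)) ℝ.refl a b x y)
          (ℝ.x≤x+y (ℝ.0≤x² _)))
        (ℝ.≤-respʳ (solve 2 (λ s t → (s :* s) :* (t :* t) := (s :* t) :* (s :* t)) ℝ.refl s t)
          (ℝ.*-mono-≤ (0≤∣∣² (a +i b)) (ℝ.0≤x² t) z≤ w≤))
      d≤st : d ℝ.≤ s ℝ.* t
      d≤st = ℝ.square-cancel-≤ (ℝ.*-nonneg 0≤s 0≤t) d²≤

    ≼-* : ∀ {z w s t} → z ≼ s → w ≼ t → z * w ≼ s ℝ.* t
    ≼-* {z} {w} {s} {t} (0≤s , z≤) (0≤t , w≤) = ℝ.*-nonneg 0≤s 0≤t ,
      ℝ.≤-respˡ (ℝ.sym (∣∣²-* z w))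
        (ℝ.≤-respʳ (solve 2 (λ s t → (s :* s) :* (t :* t) := (s :* t) :* (s :* t)) ℝ.refl s t)
          (ℝ.*-mono-≤ (0≤∣∣² z) (ℝ.0≤x² t) z≤ w≤))

    ≼-neg : ∀ {z s} → z ≼ s → - z ≼ s
    ≼-neg {a +i b} (0≤s , z≤) = 0≤s ,
      ℝ.≤-respˡ (solve 2 (λ a b → a :* a :+ b :* b := :- a :* :- a :+ :- b :* :- b) ℝ.refl a b) z≤

    -- |1 - z| ≥ Re (1 - z) ≥ 1 - s
    ≼-inverse : ∀ {z v s κ} → z ≼ s → s ℝ.< ℝ.1# → κ ℝ.* (ℝ.1# ℝ.- s) ℝ.≈ ℝ.1# → (1ℂ - z) * v ≈ 1ℂ → v ≼ κ
    ≼-inverse {z} {v} {s} {κ} z≼s s<1 κ[1-s]≈1 [1-z]v≈1 = 0≤κ ,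
      ℝ.≤-respˡ eq₁ (ℝ.≤-respʳ eq₂ (ℝ.*-monoʳ-≤ (ℝ.*-nonneg (ℝ.0≤x² κ) (0≤∣∣² v)) [1-s]²≤))
      where
      0<1-s : ℝ.0# ℝ.< ℝ.1# ℝ.- s
      0<1-s = ℝ.x<y⇒0<y-x s<1
      0≤κ : ℝ.0# ℝ.≤ κ
      0≤κ = ℝ.<⇒≤ (ℝ.positive-cancel 0<1-s κ[1-s]≈1)
      1-s≤1-x : ℝ.1# ℝ.- s ℝ.≤ ℝ.1# ℝ.- re z
      1-s≤1-x = ℝ.0≤y-x⇒x≤y (ℝ.≤-respʳ
        (solve 2 (λ x s → s :- x := (con (+ 1) :- x) :- (con (+ 1) :- s)) ℝ.refl (re z) s) (ℝ.x≤y⇒0≤y-x (re≤ z≼s)))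
      [1-s]²≤ : (ℝ.1# ℝ.- s) ℝ.* (ℝ.1# ℝ.- s) ℝ.≤ ∣ 1ℂ - z ∣²
      [1-s]²≤ = ℝ.≤-trans
        (ℝ.*-mono-≤ (ℝ.<⇒≤ 0<1-s) (ℝ.≤-trans (ℝ.<⇒≤ 0<1-s) 1-s≤1-x) 1-s≤1-x 1-s≤1-x)
        (ℝ.x≤x+y (ℝ.0≤x² _))
      eq₁ : κ ℝ.* κ ℝ.* ∣ v ∣² ℝ.* ((ℝ.1# ℝ.- s) ℝ.* (ℝ.1# ℝ.- s)) ℝ.≈ ∣ v ∣²
      eq₁ = ℝ.trans
        (solve 3 (λ k v d → k :* k :* v :* (d :* d) := (k :* d) :* (k :* d) :* v) ℝ.refl κ ∣ v ∣² (ℝ.1# ℝ.- s))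
        (ℝ.trans (ℝ.*-congʳ (ℝ.trans (ℝ.*-cong κ[1-s]≈1 κ[1-s]≈1) (ℝ.*-identityˡ _))) (ℝ.*-identityˡ _))
      eq₂ : κ ℝ.* κ ℝ.* ∣ v ∣² ℝ.* ∣ 1ℂ - z ∣² ℝ.≈ κ ℝ.* κ
      eq₂ = ℝ.trans (ℝ.*-assoc _ _ _) (ℝ.trans
        (ℝ.*-congˡ (ℝ.trans (ℝ.*-comm _ _) (ℝ.trans (ℝ.sym (∣∣²-* (1ℂ - z) v)) (ℝ.trans (∣∣²-cong [1-z]v≈1) ∣1∣²))))
        (ℝ.*-identityʳ _))

    half : ∃ λ h → h ℝ.* (ℝ.1# ℝ.+ ℝ.1#) ℝ.≈ ℝ.1#
    half = ℝ.reciprocal (ℝ.0<x+y ℝ.0<1 ℝ.0≤1)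

    -- A positive x would violate the hypothesis at ε = x/2.
    nonpositive : ∀ {x} → (∀ ε → ℝ.0# ℝ.< ε → x ℝ.≤ ε) → x ℝ.≤ ℝ.0#
    nonpositive {x} x≤ 0<x = from half
      where
      from : (∃ λ h → h ℝ.* (ℝ.1# ℝ.+ ℝ.1#) ℝ.≈ ℝ.1#) → _
      from (h , h2≈1) = x≤ (h ℝ.* x) (ℝ.*-pos 0<h 0<x) (ℝ.0<y-x⇒x<y (ℝ.<-respʳ-≈
        (ℝ.trans (solve 2 (λ h x → h :* x := (h :* (con (+ 1) :+ con (+ 1))) :* x :- h :* x) ℝ.refl h x)
          (ℝ.+-congʳ (ℝ.trans (ℝ.*-congʳ h2≈1) (ℝ.*-identityˡ x))))
        (ℝ.*-pos 0<h 0<x)))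
        where
        0<h : ℝ.0# ℝ.< h
        0<h = ℝ.positive-cancel (ℝ.0<x+y ℝ.0<1 ℝ.0≤1) h2≈1

    tight : ∀ {x} → x ℝ.≤ ℝ.0# → ℝ.- x ℝ.≤ ℝ.0# → x ℝ.≈ ℝ.0#
    tight {x} x≤0 -x≤0 = proj₁ (RealNumbers.tight R x ℝ.0#) λ x#0 →
      [ (λ x<0 → -x≤0 (ℝ.x<0⇒0<-x x<0)) , x≤0 ]′ (ℝ.#⇒<⊎> x#0)

    separated : ∀ {z} → (∀ ε → ℝ.0# ℝ.< ε → z ≼ ε) → z ≈ 0ℂ
    separated {z} z≼ =
      tight (nonpositive (λ ε 0<ε → re≤ (z≼ ε 0<ε))) (nonpositive (λ ε 0<ε → re≤ (≼-neg (z≼ ε 0<ε)))) ,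
      tight (nonpositive (λ ε 0<ε → im≤ (z≼ ε 0<ε))) (nonpositive (λ ε 0<ε → im≤ (≼-neg (z≼ ε 0<ε))))

  open Pochhammer ℝ.commutativeRing using () renaming (_^_ to _^ℝ_)

  private
    complete : ∀ (ratio : Ratio R) (f : ℕ → ℂ) K → ℝ.0# ℝ.≤ K →
               (∀ n → f (suc n) - f n ≼ K ℝ.* Ratio.ρ ratio ^ℝ n) →
               ∃ λ L → ∃ λ K′ → (ℝ.0# ℝ.≤ K′) × (∀ n → f n - L ≼ K′ ℝ.* Ratio.ρ ratio ^ℝ n)
    complete ratio f K 0≤K f≼ =
      from (geometric-limit (λ n → re (f n)) K 0≤K (λ n → re≤ (f≼ n)) (λ n → ℝ.≤-respˡ (flip _ _) (re≤ (≼-neg (f≼ n)))))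
           (geometric-limit (λ n → im (f n)) K 0≤K (λ n → im≤ (f≼ n)) (λ n → ℝ.≤-respˡ (flip _ _) (im≤ (≼-neg (f≼ n)))))
      where
      open Ratio ratio
      open RealCompleteness R ratio
      open GeometricDecay R ratio using (0<κ; 0≤ρ^)
      flip : ∀ x y → ℝ.- (x ℝ.- y) ℝ.≈ y ℝ.- x
      flip = solve 2 (λ x y → :- (x :- y) := y :- x) ℝ.refl
      0≤Kκ : ℝ.0# ℝ.≤ K ℝ.* κ
      0≤Kκ = ℝ.*-nonneg 0≤K (ℝ.<⇒≤ 0<κ)
      near : (ℕ → ℝ.Carrier) → ℝ.Carrier → Set ℓ₃
      near g x = ∀ n → (g n ℝ.- x ℝ.≤ K ℝ.* κ ℝ.* ρ ^ℝ n) × (x ℝ.- g n ℝ.≤ K ℝ.* κ ℝ.* ρ ^ℝ n)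
      from : (∃ λ x → near (λ n → re (f n)) x) → (∃ λ y → near (λ n → im (f n)) y) →
             ∃ λ L → ∃ λ K′ → (ℝ.0# ℝ.≤ K′) × (∀ n → f n - L ≼ K′ ℝ.* ρ ^ℝ n)
      -- Real and imaginary part each lie within Kκρⁿ of their limits; the constant 2Kκ replaces √2
      -- Kκ.
      from (x , re-near) (y , im-near) = x +i y , (K ℝ.* κ ℝ.+ K ℝ.* κ) , ℝ.+-nonneg 0≤Kκ 0≤Kκ , bound
        where
        bound : ∀ n → f n - (x +i y) ≼ (K ℝ.* κ ℝ.+ K ℝ.* κ) ℝ.* ρ ^ℝ n
        bound n = ℝ.*-nonneg (ℝ.+-nonneg 0≤Kκ 0≤Kκ) (0≤ρ^ n) ,
          ℝ.≤-trans (ℝ.+-mono-≤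
              (square≤ (proj₁ (re-near n)) (ℝ.≤-respˡ (ℝ.sym (flip _ _)) (proj₂ (re-near n))))
              (square≤ (proj₁ (im-near n)) (ℝ.≤-respˡ (ℝ.sym (flip _ _)) (proj₂ (im-near n)))))
            (ℝ.≤-respʳ
              (solve 2 (λ k r → ((k :* r) :* (k :* r) :+ (k :* r) :* (k :* r)) :+ ((k :* r) :* (k :* r) :+ (k :* r) :* (k :* r))
                := ((k :+ k) :* r) :* ((k :+ k) :* r)) ℝ.refl (K ℝ.* κ) (ρ ^ℝ n))
              (ℝ.x≤x+y (ℝ.+-nonneg (ℝ.0≤x² _) (ℝ.0≤x² _))))

  ℂ-boundedRing : BoundedRing R c ℓ₁
  ℂ-boundedRing = record
    { commutativeRing = ℂ-commutativeRing ; _≼_ = _≼_ ; ≼⇒0≤ = proj₁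
    ; ≼-resp = λ {z} {w} → ≼-resp {z} {w} ; ≼-mono = λ {z} → ≼-mono {z} ; ≼-bound = ≼-bound ; 0≼0 = 0≼0 ; 1≼1 = 1≼1
    ; ≼-+ = λ {z} {w} → ≼-+ {z} {w} ; ≼-* = λ {z} {w} → ≼-* {z} {w} ; ≼-neg = λ {z} → ≼-neg {z}
    ; ≼-inverse = λ {z} {v} → ≼-inverse {z} {v} ; separated = λ {z} → separated {z} ; complete = complete }



-- Transfer to the complex statement

2T≡ : ∀ {c ℓ₁ ℓ₂ ℓ₃} (R : RealNumbers c ℓ₁ ℓ₂ ℓ₃) j → 2 ℕ.* Complex.T R j ≡ j ℕ.* suc j
2T≡ R j = begin
  2 ℕ.* (j ℕ.* (j ℕ.+ 1) ℕ./ 2)             ≡⟨ ≡.cong (λ k → 2 ℕ.* (k ℕ./ 2)) (even j) ⟩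
  2 ℕ.* (triangular j ℕ.* 2 ℕ./ 2)          ≡⟨ ≡.cong (2 ℕ.*_) (ℕ.m*n/n≡m (triangular j) 2) ⟩
  2 ℕ.* triangular j                        ≡⟨ ℕ.*-comm 2 (triangular j) ⟩
  triangular j ℕ.* 2                        ≡⟨ even j ⟨
  j ℕ.* (j ℕ.+ 1)                           ≡⟨ ≡.cong (j ℕ.*_) (ℕ.+-comm j 1) ⟩
  j ℕ.* suc j                               ∎
  where
  open ≡.≡-Reasoning
  -- The division by 2 in `T` is exact because j(j+1) is twice this recursively defined sum.
  triangular : ℕ → ℕ
  triangular zero    = 0
  triangular (suc j) = suc j ℕ.+ triangular j
  lemma : ∀ j t → suc j ℕ.* 2 ℕ.+ j ℕ.* (j ℕ.+ 1) ≡ suc j ℕ.* (suc j ℕ.+ 1)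
  lemma = solve-∀
  even : ∀ j → j ℕ.* (j ℕ.+ 1) ≡ triangular j ℕ.* 2
  even zero    = ≡.refl
  even (suc j) = begin
    suc j ℕ.* (suc j ℕ.+ 1)               ≡⟨ lemma j 0 ⟨
    suc j ℕ.* 2 ℕ.+ j ℕ.* (j ℕ.+ 1)       ≡⟨ ≡.cong (suc j ℕ.* 2 ℕ.+_) (even j) ⟩
    suc j ℕ.* 2 ℕ.+ triangular j ℕ.* 2    ≡⟨ ℕ.*-distribʳ-+ 2 (suc j) (triangular j) ⟨
    triangular (suc j) ℕ.* 2              ∎

module Inverses {c ℓ} (R : CommutativeRing c ℓ) where
  open CommutativeRing R
  open IntegerSolver R
  open Relation.Binary.Reasoning.Setoid setoid

  inverse-unique : ∀ x {y z} → x * y ≈ 1# → x * z ≈ 1# → y ≈ z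
  inverse-unique x {y} {z} xy≈1 xz≈1 = begin
    y              ≈⟨ *-identityʳ y ⟨
    y * 1#         ≈⟨ *-congˡ xz≈1 ⟨
    y * (x * z)    ≈⟨ solve 3 (λ x y z → y :* (x :* z) := (x :* y) :* z) refl x y z ⟩
    (x * y) * z    ≈⟨ *-congʳ xy≈1 ⟩
    1# * z         ≈⟨ *-identityˡ z ⟩
    z              ∎

  *-inverse : ∀ {x y x⁻¹ y⁻¹} → x * x⁻¹ ≈ 1# → y * y⁻¹ ≈ 1# → (x * y) * (x⁻¹ * y⁻¹) ≈ 1#
  *-inverse xx⁻¹≈1 yy⁻¹≈1 = trans
    (solve 4 (λ x y v w → (x :* y) :* (v :* w) := (x :* v) :* (y :* w)) refl _ _ _ _)
    (trans (*-cong xx⁻¹≈1 yy⁻¹≈1) (*-identityˡ 1#))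

module _ {c ℓ₁ ℓ₂ ℓ₃} (R : RealNumbers c ℓ₁ ℓ₂ ℓ₃) where
  open Complex R
  open ComplexNumbers R
  private
    module ℂʳ = CommutativeRing ℂ-commutativeRing
  open Pochhammer ℂ-commutativeRing using (poch) renaming (_^_ to _^ᵣ_)
  open Inverses ℂ-commutativeRing
  open ℝ using (solve; con; _:=_; _:+_; _:*_; _:-_; :-_)

  ^ᵣ≈^ : ∀ q n → q ^ᵣ n ≈ q ^ n
  ^ᵣ≈^ q n = ℂʳ.refl {q ^ n}

  poch≡⟨⨾⟩ : ∀ a q m → poch a q m ≡ ⟨ a ⨾ q ⟩ m
  poch≡⟨⨾⟩ a q zero    = ≡.refl
  poch≡⟨⨾⟩ a q (suc m) = ≡.cong (_* (1ℂ - a * q ^ m)) (poch≡⟨⨾⟩ a q m)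

  w*inv≈1 : ∀ w (w≉0 : w ≉0) → w * inv w w≉0 ≈ 1ℂ
  w*inv≈1 (a +i b) w≉0 = from (ℝ.#⇒invertible w≉0)
    where
    n² : ℝ.Carrier
    n² = a ℝ.* a ℝ.+ b ℝ.* b
    from : (i : ∃ λ n → (n ℝ.* (n² ℝ.- ℝ.0#) ℝ.≈ ℝ.1#) × ((n² ℝ.- ℝ.0#) ℝ.* n ℝ.≈ ℝ.1#)) →
           (a +i b) * ((a ℝ.* proj₁ i) +i ((ℝ.- b) ℝ.* proj₁ i)) ≈ 1ℂ
    from (n , _ , n²n≈1) =
      ℝ.trans (solve 3 (λ a b n → a :* (a :* n) :- b :* (:- b :* n)
          := (a :* a :+ b :* b :- con (+ 0)) :* n) ℝ.refl a b n) n²n≈1 ,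
      solve 3 (λ a b n → a :* (:- b :* n) :+ b :* (a :* n) := con (+ 0)) ℝ.refl a b n

  -- |q| ≤ (1 + |q|²)/2 by AM-GM, so no square root is needed to find a ratio below 1.
  module Radius (q : ℂ) (∣q∣²<1 : ∣ q ∣² ℝ.< ℝ.1#) (h : ℝ.Carrier) (h2≈1 : h ℝ.* (ℝ.1# ℝ.+ ℝ.1#) ℝ.≈ ℝ.1#) where
    s ρ : ℝ.Carrier
    s = ∣ q ∣²
    ρ = h ℝ.* (ℝ.1# ℝ.+ s)

    0<h : ℝ.0# ℝ.< h
    0<h = ℝ.positive-cancel (ℝ.0<x+y ℝ.0<1 ℝ.0≤1) h2≈1

    0<ρ : ℝ.0# ℝ.< ρ
    0<ρ = ℝ.*-pos 0<h (ℝ.0<x+y ℝ.0<1 (0≤∣∣² q))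

    ρ<1 : ρ ℝ.< ℝ.1#
    ρ<1 = ℝ.<-respʳ-≈ h2≈1 (ℝ.*-monoʳ-< 0<h
      (ℝ.<-respˡ-≈ (ℝ.+-comm _ _) (ℝ.+-monoˡ-< ℝ.1# ∣q∣²<1)))

    q≼ρ : q ≼ ρ
    q≼ρ = ℝ.<⇒≤ 0<ρ , ℝ.0≤y-x⇒x≤y (ℝ.≤-respʳ eq (ℝ.*-nonneg (ℝ.0≤x² h) (ℝ.0≤x² (ℝ.1# ℝ.- s))))
      where
      -- With h = 1/2 this is ((1+s)/2)² - s = ((1-s)/2)².
      eq : h ℝ.* h ℝ.* ((ℝ.1# ℝ.- s) ℝ.* (ℝ.1# ℝ.- s)) ℝ.≈ ρ ℝ.* ρ ℝ.- s
      eq = ℝ.trans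
        (solve 2 (λ h s → h :* h :* ((con (+ 1) :- s) :* (con (+ 1) :- s))
         
              := (h :* (con (+ 1) :+ s)) :* (h :* (con (+ 1) :+ s)) :- (h :* (con (+ 1) :+ con (+ 1))) :* (h :* (con (+ 1) :+ con (+ 1))) :* s)
          ℝ.refl h s)
        (ℝ.+-congˡ (ℝ.-‿cong (ℝ.trans (ℝ.*-congʳ (ℝ.trans (ℝ.*-cong h2≈1 h2≈1) (ℝ.*-identityˡ _))) (ℝ.*-identityˡ s))))

  module Assembly (q : ℂ) (∣q∣<1 : ∣ q ∣< ℝ.1#) (p x y : ℂ) (q²⁰≈p : q ^ᵣ 20 ≈ p) (q⁶≈x : q ^ᵣ 6 ≈ x) (q¹⁴≈y : q ^ᵣ 14 ≈ y) (∣p∣<1 : ∣ p ∣< ℝ.1#)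
    (ratio : Ratio R) (q≼ρ : q ≼ Ratio.ρ ratio) where
    open Ratio ratio

    u u′ : ℕ → ℂ
    u m  = inv (⟨ q ⨾ q ⟩ m) (⟨q⨾q⟩≉0 ∣q∣<1 m)
    u′ m = inv (⟨ p ⨾ p ⟩ m) (⟨q⨾q⟩≉0 ∣p∣<1 m)

    poch*u≈1 : ∀ m → poch q q m * u m ≈ 1ℂ
    poch*u≈1 m = ≡.subst (λ w → w * u m ≈ 1ℂ) (≡.sym (poch≡⟨⨾⟩ q q m)) (w*inv≈1 (⟨ q ⨾ q ⟩ m) (⟨q⨾q⟩≉0 ∣q∣<1 m))

    poch*u′≈1 : ∀ m → poch p p m * u′ m ≈ 1ℂ
    poch*u′≈1 m = ≡.subst (λ w → w * u′ m ≈ 1ℂ) (≡.sym (poch≡⟨⨾⟩ p p m))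
      (w*inv≈1 (⟨ p ⨾ p ⟩ m) (⟨q⨾q⟩≉0 ∣p∣<1 m))

    open GeometricLimits R ℂ-boundedRing ratio using (_⟶_; RapidSum; RapidSum-resp; module DoubleSeries)
    open DoubleSeries q q≼ρ u poch*u≈1 p x y q²⁰≈p q⁶≈x q¹⁴≈y u′ poch*u′≈1
      using (term; product-formula)
    open GeometricDecay R ratio using (ρ^→0) renaming (_^_ to _^ℝ_)

    ≼∧<⇒∣∣< : ∀ {z s ε} → z ≼ s → s ℝ.< ε → ∣ z ∣< ε
    ≼∧<⇒∣∣< (0≤s , ≤s²) s<ε = ℝ.≤-<-trans 0≤s s<ε , ℝ.≤-<-trans ≤s² (ℝ.square-mono-< 0≤s s<ε)

    poch⟶⇒Limit : ∀ a p L → poch a p ⟶ L → ⟨ a ⨾ p ⟩∞↦ L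
    poch⟶⇒Limit a p L (K , 0≤K , rate) ε 0<ε = from (ρ^→0 K ε 0≤K 0<ε)
      where
      from : (∃ λ N → ∀ n → N ℕ.≤ n → K ℝ.* ρ ^ℝ n ℝ.< ε) → ∃ λ N → ∀ n → N ℕ.≤ n → ∣ ⟨ a ⨾ p ⟩ n - L ∣< ε
      from (N , lt) = N , λ n N≤n → ≡.subst (λ w → ∣ w - L ∣< ε) (poch≡⟨⨾⟩ a p n)
        (≼∧<⇒∣∣< {poch a p n - L} (rate n) (lt n N≤n))

    -- The summand inverts the product (q)_m (q)_{2k+1} as a whole; uniqueness of inverses splits
    -- this into two reciprocals.
    summand≈term : ∀ x → summand q ∣q∣<1 x ≈ term x
    summand≈term (m , k) = ℂʳ.trans
      (ℂʳ.*-congʳ {⟨ - q ⨾ q ^ 2 ⟩ k} (ℂʳ.*-cong exponents inverses))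
      (ℂʳ.trans
        (regroup (q ^ ((m ℕ.+ k) ℕ.* suc (m ℕ.+ k))) (q ^ (k ℕ.* suc k)) (u m) (u (suc (twice k))) (⟨ - q ⨾ q ^ 2 ⟩ k))
        (ℂʳ.reflexive (≡.cong (λ w → q ^ ((m ℕ.+ k) ℕ.* suc (m ℕ.+ k)) * (q ^ (k ℕ.* suc k) * u m * (u (suc (twice k)) * w)))
          (≡.sym (poch≡⟨⨾⟩ (- q) (q ^ 2) k)))))
      where
      open Algebra.Properties.Semiring.Exp ℂʳ.semiring using (^-homo-*)
      W = ⟨ q ⨾ q ⟩ m * ⟨ q ⨾ q ⟩ (2 ℕ.* k ℕ.+ 1)
      W≉0 = ≉0-* (⟨q⨾q⟩≉0 ∣q∣<1 m) (⟨q⨾q⟩≉0 ∣q∣<1 (2 ℕ.* k ℕ.+ 1))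
      exponents : q ^ (2 ℕ.* T k ℕ.+ 2 ℕ.* T (m ℕ.+ k)) ≈ q ^ (k ℕ.* suc k) * q ^ ((m ℕ.+ k) ℕ.* suc (m ℕ.+ k))
      exponents = ℂʳ.trans (ℂʳ.reflexive (≡.cong₂ (λ x y → q ^ (x ℕ.+ y)) (2T≡ R k) (2T≡ R (m ℕ.+ k))))
        (^-homo-* q (k ℕ.* suc k) ((m ℕ.+ k) ℕ.* suc (m ℕ.+ k)))
      odd : 2 ℕ.* k ℕ.+ 1 ≡ suc (twice k)
      odd = ≡.trans (ℕ.+-comm (2 ℕ.* k) 1)
        (≡.cong suc (≡.trans (≡.cong (k ℕ.+_) (ℕ.+-identityʳ k)) (≡.sym (twice≡+ k))))
      inverses : inv W W≉0 ≈ u m * u (suc (twice k))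
      inverses = ℂʳ.trans
        (inverse-unique W {inv W W≉0} {u m * u (2 ℕ.* k ℕ.+ 1)} (w*inv≈1 W W≉0)
          (*-inverse {⟨ q ⨾ q ⟩ m} {⟨ q ⨾ q ⟩ (2 ℕ.* k ℕ.+ 1)} {u m} {u (2 ℕ.* k ℕ.+ 1)}
            (w*inv≈1 (⟨ q ⨾ q ⟩ m) (⟨q⨾q⟩≉0 ∣q∣<1 m)) (w*inv≈1 (⟨ q ⨾ q ⟩ (2 ℕ.* k ℕ.+ 1)) (⟨q⨾q⟩≉0 ∣q∣<1 (2 ℕ.* k ℕ.+ 1)))))
        (ℂʳ.reflexive (≡.cong (λ n → u m * u n) odd))
      regroup : ∀ x y v w z → y * x * (v * w) * z ≈ x * (y * v * (w * z))
      regroup = S.solve 5 (λ x y v w z → y S.:* x S.:* (v S.:* w) S.:* z S.:= x S.:* (y S.:* v S.:* (w S.:* z))) ℂʳ.refl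
        where module S = IntegerSolver ℂ-commutativeRing

    hasSum : ∀ S → RapidSum (summand q ∣q∣<1) S → HasSum (summand q ∣q∣<1) S
    hasSum S (K , 0≤K , rate) ε 0<ε = from (ρ^→0 K ε 0≤K 0<ε)
      where
      from : (∃ λ N → ∀ n → N ℕ.≤ n → K ℝ.* ρ ^ℝ n ℝ.< ε) →
             ∃ λ F₀ → ∀ F → Unique F → F₀ ⊆ F → ∣ ∑ F (summand q ∣q∣<1) - S ∣< ε
      from (N , lt) = triangle (twice N) , λ F uF ⊆F →
        ≼∧<⇒∣∣< {∑ F (summand q ∣q∣<1) - S} (rate N F uF ⊆F) (lt N ℕ.≤-refl)

    -- |D|² |D⁻¹|² = 1 is apart from 0, hence so is its first factor.
    unit⇒≉0 : ∀ D D⁻¹ → D * D⁻¹ ≈ 1ℂ → D ≉0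
    unit⇒≉0 D D⁻¹ DD⁻¹≈1 = ℝ.xy#0⇒x#0 (ℝ.>⇒# (ℝ.<-respʳ-≈
      (ℝ.sym (ℝ.trans (ℝ.sym (∣∣²-* D D⁻¹)) (ℝ.trans (∣∣²-cong DD⁻¹≈1) ∣1∣²))) ℝ.0<1))

    Goal : Set _
    Goal = ∃ λ A → ∃ λ B → ∃ λ C → ∃ λ D →
      (⟨ p ⨾ p ⟩∞↦ A) × (⟨ x ⨾ p ⟩∞↦ B) × (⟨ y ⨾ p ⟩∞↦ C) × (⟨ q ⨾ q ⟩∞↦ D) ×
      Σ (D ≉0) λ D≉0 → HasSum (summand q ∣q∣<1) (A * B * C / D [ D≉0 ])

    theorem : Goal
    theorem = from product-formula
      where
      from : (∃ λ A → ∃ λ B → ∃ λ C → ∃ λ D → ∃ λ D⁻¹ →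
        (poch p p ⟶ A) × (poch x p ⟶ B) × (poch y p ⟶ C) × (poch q q ⟶ D) ×
        (D * D⁻¹ ≈ 1ℂ) × RapidSum term (A * B * C * D⁻¹)) → Goal
      from (A , B , C , D , D⁻¹ , →A , →B , →C , →D , DD⁻¹≈1 , sums) = A , B , C , D ,
        poch⟶⇒Limit p p A →A , poch⟶⇒Limit x p B →B , poch⟶⇒Limit y p C →C , poch⟶⇒Limit q q D →D ,
        D≉0 , hasSum (A * B * C / D [ D≉0 ])
          (RapidSum-resp (λ i → ℂʳ.sym {summand q ∣q∣<1 i} {term i} (summand≈term i))
            (ℂʳ.*-congˡ {A * B * C} {D⁻¹} {inv D D≉0} (inverse-unique D {D⁻¹} {inv D D≉0} DD⁻¹≈1 (w*inv≈1 D D≉0)))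
            sums)
        where
        D≉0 = unit⇒≉0 D D⁻¹ DD⁻¹≈1

mainTheorem11 : ∀ {c ℓ₁ ℓ₂ ℓ₃} (R : RealNumbers c ℓ₁ ℓ₂ ℓ₃) →
    let open Complex R in
    ∀ q (∣q∣<1 : ∣ q ∣< RealNumbers.1# R) →
    ∃ λ A → ∃ λ B → ∃ λ C → ∃ λ D →
    (⟨ q ^ 20 ⨾ q ^ 20 ⟩∞↦ A) ×
    (⟨ q ^ 6 ⨾ q ^ 20 ⟩∞↦ B) ×
    (⟨ q ^ 14 ⨾ q ^ 20 ⟩∞↦ C) ×
    (⟨ q ⨾ q ⟩∞↦ D) ×
    Σ (D ≉0) λ D≉0 →
    HasSum (summand q ∣q∣<1) (A * B * C / D [ D≉0 ])
mainTheorem11 R q ∣q∣<1 = withHalf (ℝ.reciprocal (ℝ.0<x+y ℝ.0<1 ℝ.0≤1))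
  where
  open Complex R
  module ℝ = RealInequalities R
  Goal : Set _
  Goal = ∃ λ A → ∃ λ B → ∃ λ C → ∃ λ D →
    (⟨ q ^ 20 ⨾ q ^ 20 ⟩∞↦ A) × (⟨ q ^ 6 ⨾ q ^ 20 ⟩∞↦ B) × (⟨ q ^ 14 ⨾ q ^ 20 ⟩∞↦ C) × (⟨ q ⨾ q ⟩∞↦ D) ×
    Σ (D ≉0) λ D≉0 → HasSum (summand q ∣q∣<1) (A * B * C / D [ D≉0 ])
  ∣q∣²<1 : ∣ q ∣² ℝ.< ℝ.1#
  ∣q∣²<1 = ℝ.<-respʳ-≈ (ℝ.*-identityˡ ℝ.1#) (proj₂ ∣q∣<1)
  ∣q^20∣<1 : ∣ q ^ 20 ∣< ℝ.1#
  -- The bound is stated for q^{1+j}, so the twentieth power is j = 19.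
  ∣q^20∣<1 = ℝ.0<1 , ℝ.<-respʳ-≈ (ℝ.sym (ℝ.*-identityˡ ℝ.1#)) (∣q^1+j∣²<1 {q} ∣q∣<1 19)
  withHalf : (∃ λ h → h ℝ.* (ℝ.1# ℝ.+ ℝ.1#) ℝ.≈ ℝ.1#) → Goal
  withHalf (h , h2≈1) = withReciprocal (ℝ.reciprocal (ℝ.x<y⇒0<y-x ρ<1))
    where
    open Radius R q ∣q∣²<1 h h2≈1
    withReciprocal : (∃ λ κ → κ ℝ.* (ℝ.1# ℝ.- ρ) ℝ.≈ ℝ.1#) → Goal
    withReciprocal (κ , κ[1-ρ]≈1) = Assembly.theorem R q ∣q∣<1
      (q ^ 20) (q ^ 6) (q ^ 14) (^ᵣ≈^ R q 20) (^ᵣ≈^ R q 6) (^ᵣ≈^ R q 14) ∣q^20∣<1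
      (record { ρ = ρ ; κ = κ ; 0<ρ = 0<ρ ; ρ<1 = ρ<1 ; κ[1-ρ]≈1 = κ[1-ρ]≈1 }) q≼ρ
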